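{- Suppose that $M$ and $N$ are $3$-connected matroids such that $|E(N)| \geq 4$, and $C^{*}$ is a cocircuit of $M$ with the property that $M / x_{0}$ has an $N$-minor for some $x_{0} \in C^{*}$. Then at least one of the following holds: (i) there is an element $x \in C^{*}$ such that $\operatorname{si}(M / x)$ is $3$-connected and has an $N$-minor; (ii) there is a four-element fan $(x_{1}, x_{2}, x_{3}, x_{4})$ of $M$ such that $x_{1}, x_{3} \in C^{*}$, and $\operatorname{si}(M / x_{2})$ is $3$-connected with an $N$-minor; (iii) there is a segment-cosegment pair $(L, L^{*})$ of $M$, with $L = \{x_1,\ldots,x_t\}$ and $L^{*} = \{y_1,\ldots,y_t\}$, such that $L \subseteq C^{*}$, and $\operatorname{cl}(L) - L$ contains a single element $e$; in this case $e \notin C^{*}$ and $\operatorname{si}(M / e)$ is $3$-connected with an $N$-minor; moreover $M / \operatorname{cl}(L)$ is $3$-connected with an $N$-minor, and if $x_{i} \in L$ then $M / x_{i}$ is $3$-connected up to a unique spore $(\operatorname{cl}(L) - \{x_{i}\}, y_{i})$; or (iv) there is a segment-cosegment pair $(L, L^{*})$ of $M$, with $L = \{x_1,\ldots,x_t\}$ and $L^{*} = \{y_1,\ldots,y_t\}$, such that $L$ is a flat of $M$ and $|L - C^{*}| \leq 1$; in this case $M / L$ is $3$-connected with an $N$-minor, and if $x_{i} \in L$ then $M / x_{i}$ is $3$-connected up to a unique spore $(L - \{x_{i}\}, y_{i})$.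
   Context: All matroids are finite. For a matroid $M$ with ground set $E$, rank function $r$ and closure operator $\operatorname{cl}$, the connectivity function is $\lambda_M(X) = r(X) + r(E - X) - r(M)$ for $X \subseteq E$. A $k$-separation of $M$ is a partition $(X, E-X)$ of $E$ with $\lambda_M(X) < k$ and $|X|, |E-X| \geq k$. $M$ is $n$-connected if it has no $k$-separation for any $k < n$ ($k$ a positive integer). $\operatorname{si}(M)$ is the simple matroid associated with $M$ (delete all loops and all but one element of each parallel class). A matroid has an $N$-minor if it has a minor isomorphic to $N$. A triangle is a three-element circuit and a triad is a three-element cocircuit. A four-element fan of $M$ is a sequence $(x_1,x_2,x_3,x_4)$ of distinct elements of $E(M)$ such that $\{x_1,x_2,x_3\}$ is a triangle and $\{x_2,x_3,x_4\}$ is a triad. A segment of $M$ is a set $L \subseteq E(M)$ with $|L| \geq 3$ such that every three-element subset of $L$ is a triangle of $M$. A segment-cosegment pair of $M$ is a pair $(L, L^{*})$ where $L = \{x_1,\ldots,x_t\}$ is a segment of $M$ and $L^{*} = \{y_1,\ldots,y_t\}$ is a set such that $L \cap L^{*} = \emptyset$ and, for every $i \in \{1,\ldots,t\}$, the set $(\operatorname{cl}(L) - \{x_i\}) \cup \{y_i\}$ is a cocircuit of $M$. A spore of a matroid is a pair $(P, s)$ such that $P$ is a rank-one flat, $s$ is an element of the ground set, and $P \cup \{s\}$ is a cocircuit. A matroid $M$ is $3$-connected up to a unique spore $(P,s)$ if $(P,s)$ is the only spore of $M$, and whenever $(X, Y)$ is a $k$-separation of $M$ for some $k < 3$, then either $X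 \subseteq P \cup \{s\}$ or $Y \subseteq P \cup \{s\}$. -}

module Defs where

open import Data.Bool using (true; false)
open import Data.Fin using (Fin; _<_)
open import Data.Fin.Properties using (any?; _<?_) renaming (_≟_ to _≟ᶠ_)
open import Data.Fin.Subset
open import Data.Fin.Subset.Properties
open import Data.List as List using (List; []; _∷_)
open import Data.List.Relation.Unary.Unique.Propositional using (Unique)
open import Data.Nat as ℕ using (ℕ; suc; _+_; _∸_; _≤_)
open import Data.Nat.Properties as ℕₚ using (module ≤-Reasoning)
open import Data.Product using (_×_; _,_; ∃; ∃₂; Σ-syntax; proj₁; proj₂)
open import Data.Sum using (_⊎_; inj₁; inj₂; [_,_]′)
open import Data.Vec using ([]; _∷_; tabulate; here; there)
open import Function using (_∘_; _↔_; _⇔_; Inverse)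
open import Function.Definitions using (Injective)
open import Relation.Binary.PropositionalEquality
open import Relation.Nullary
open import Relation.Nullary.Decidable using (map′; _×-dec_; _⊎-dec_)
open import Relation.Unary using (Decidable)

private
  variable
    m n t : ℕ

∣∪∣+∣∩∣ : (p q : Subset n) → ∣ p ∪ q ∣ + ∣ p ∩ q ∣ ≡ ∣ p ∣ + ∣ q ∣
∣∪∣+∣∩∣ [] [] = refl
∣∪∣+∣∩∣ (true  ∷ p) (true  ∷ q) = cong suc (trans (ℕₚ.+-suc _ _)
  (trans (cong suc (∣∪∣+∣∩∣ p q)) (sym (ℕₚ.+-suc _ _))))
∣∪∣+∣∩∣ (true  ∷ p) (false ∷ q) = cong suc (∣∪∣+∣∩∣ p q)
∣∪∣+∣∩∣ (false ∷ p) (true  ∷ q) =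
  trans (cong suc (∣∪∣+∣∩∣ p q)) (sym (ℕₚ.+-suc _ _))
∣∪∣+∣∩∣ (false ∷ p) (false ∷ q) = ∣∪∣+∣∩∣ p q

∪-⊆ : {p q s : Subset n} → p ⊆ s → q ⊆ s → p ∪ q ⊆ s
∪-⊆ {p = p} {q} a b = [ a , b ]′ ∘ x∈p∪q⁻ p q

∪-mono : {p p′ q q′ : Subset n} → p ⊆ p′ → q ⊆ q′ → p ∪ q ⊆ p′ ∪ q′
∪-mono {p′ = p′} {q′ = q′} a b = ∪-⊆ (p⊆p∪q q′ ∘ a) (q⊆p∪q p′ q′ ∘ b)

x∈p─q⇒x∉q : (p q : Subset n) → ∀ {x} → x ∈ p ─ q → x ∉ q
x∈p─q⇒x∉q (_ ∷ p) (true  ∷ q) (there a) (there b) = x∈p─q⇒x∉q p q a b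
x∈p─q⇒x∉q (_ ∷ p) (false ∷ q) (there a) (there b) = x∈p─q⇒x∉q p q a b

─-monoʳ : (p : Subset n) {q q′ : Subset n} → q ⊆ q′ → p ─ q′ ⊆ p ─ q
─-monoʳ p {q} {q′} s x∈ =
  x∈p∧x∉q⇒x∈p─q (p─q⊆p p q′ x∈) (x∈p─q⇒x∉q p q′ x∈ ∘ s)

─-∪ : (p q s : Subset n) → p ─ (q ∪ s) ≡ (p ─ q) ∩ (p ─ s)
─-∪ [] [] [] = refl
─-∪ (true  ∷ p) (true  ∷ q) (true  ∷ s) = cong (_ ∷_) (─-∪ p q s)
─-∪ (true  ∷ p) (true  ∷ q) (false ∷ s) = cong (_ ∷_) (─-∪ p q s)
─-∪ (true  ∷ p) (false ∷ q) (true  ∷ s) = cong (_ ∷_) (─-∪ p q s)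
─-∪ (true  ∷ p) (false ∷ q) (false ∷ s) = cong (_ ∷_) (─-∪ p q s)
─-∪ (false ∷ p) (true  ∷ q) (true  ∷ s) = cong (_ ∷_) (─-∪ p q s)
─-∪ (false ∷ p) (true  ∷ q) (false ∷ s) = cong (_ ∷_) (─-∪ p q s)
─-∪ (false ∷ p) (false ∷ q) (true  ∷ s) = cong (_ ∷_) (─-∪ p q s)
─-∪ (false ∷ p) (false ∷ q) (false ∷ s) = cong (_ ∷_) (─-∪ p q s)

─-∩ : (p q s : Subset n) → p ─ (q ∩ s) ≡ (p ─ q) ∪ (p ─ s)
─-∩ [] [] [] = refl
─-∩ (true  ∷ p) (true  ∷ q) (true  ∷ s) = cong (_ ∷_) (─-∩ p q s)
─-∩ (true  ∷ p) (true  ∷ q) (false ∷ s) = cong (_ ∷_) (─-∩ p q s)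
─-∩ (true  ∷ p) (false ∷ q) (true  ∷ s) = cong (_ ∷_) (─-∩ p q s)
─-∩ (true  ∷ p) (false ∷ q) (false ∷ s) = cong (_ ∷_) (─-∩ p q s)
─-∩ (false ∷ p) (true  ∷ q) (true  ∷ s) = cong (_ ∷_) (─-∩ p q s)
─-∩ (false ∷ p) (true  ∷ q) (false ∷ s) = cong (_ ∷_) (─-∩ p q s)
─-∩ (false ∷ p) (false ∷ q) (true  ∷ s) = cong (_ ∷_) (─-∩ p q s)
─-∩ (false ∷ p) (false ∷ q) (false ∷ s) = cong (_ ∷_) (─-∩ p q s)

⊆∪─ : (p q : Subset n) → p ⊆ q ∪ (p ─ q)
⊆∪─ p q {x} x∈p with x ∈? q
... | yes x∈q = p⊆p∪q (p ─ q) x∈q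
... | no  x∉q = q⊆p∪q q (p ─ q) (x∈p∧x∉q⇒x∈p─q x∈p x∉q)

∣p∣+∣q─p∣ : {p q : Subset n} → p ⊆ q → ∣ p ∣ + ∣ q ─ p ∣ ≡ ∣ q ∣
∣p∣+∣q─p∣ {p = []} {[]} _ = refl
∣p∣+∣q─p∣ {p = true  ∷ p} {true  ∷ q} s = cong suc (∣p∣+∣q─p∣ (drop-∷-⊆ s))
∣p∣+∣q─p∣ {p = true  ∷ p} {false ∷ q} s with s here
... | ()
∣p∣+∣q─p∣ {p = false ∷ p} {true  ∷ q} s =
  trans (ℕₚ.+-suc _ _) (cong suc (∣p∣+∣q─p∣ (drop-∷-⊆ s)))
∣p∣+∣q─p∣ {p = false ∷ p} {false ∷ q} s = ∣p∣+∣q─p∣ (drop-∷-⊆ s)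

+-swap : ∀ a b c d → (a + b) + (c + d) ≡ (a + c) + (b + d)
+-swap a b c d = begin
  (a + b) + (c + d) ≡⟨ ℕₚ.+-assoc a b (c + d) ⟩
  a + (b + (c + d)) ≡⟨ cong (a +_) (sym (ℕₚ.+-assoc b c d)) ⟩
  a + ((b + c) + d) ≡⟨ cong (λ z → a + (z + d)) (ℕₚ.+-comm b c) ⟩
  a + ((c + b) + d) ≡⟨ cong (a +_) (ℕₚ.+-assoc c b d) ⟩
  a + (c + (b + d)) ≡⟨ sym (ℕₚ.+-assoc a c (b + d)) ⟩
  (a + c) + (b + d) ∎
  where open ≡-Reasoning

∸-shift : ∀ k {a b c d} → k ≤ a → k ≤ b → a + b ≤ c + d →
          (a ∸ k) + (b ∸ k) ≤ (c ∸ k) + (d ∸ k)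
∸-shift k {a} {b} {c} {d} k≤a k≤b le = ℕₚ.+-cancelˡ-≤ (k + k) _ _ (begin
  (k + k) + ((a ∸ k) + (b ∸ k)) ≡⟨ +-swap k k (a ∸ k) (b ∸ k) ⟩
  (k + (a ∸ k)) + (k + (b ∸ k)) ≡⟨ cong₂ _+_ (ℕₚ.m+[n∸m]≡n k≤a) (ℕₚ.m+[n∸m]≡n k≤b) ⟩
  a + b                         ≤⟨ le ⟩
  c + d                         ≤⟨ ℕₚ.+-mono-≤ (ℕₚ.m≤n+m∸n c k) (ℕₚ.m≤n+m∸n d k) ⟩
  (k + (c ∸ k)) + (k + (d ∸ k)) ≡⟨ +-swap k (c ∸ k) k (d ∸ k) ⟩
  (k + k) + ((c ∸ k) + (d ∸ k)) ∎)
  where open ≤-Reasoning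

-- The ground set is an arbitrary subset of Fin n rather than all of Fin n, so
-- that minors of M live on subsets of the ground set of M.  Values of the rank
-- function at sets that are not contained in the ground set carry no meaning.

record Matroid (n : ℕ) : Set where
  field
    E        : Subset n
    r        : Subset n → ℕ
    r-bound  : ∀ {X} → X ⊆ E → r X ≤ ∣ X ∣
    r-mono   : ∀ {X Y} → X ⊆ Y → Y ⊆ E → r X ≤ r Y
    r-submod : ∀ {X Y} → X ⊆ E → Y ⊆ E → r (X ∪ Y) + r (X ∩ Y) ≤ r X + r Y

  r-subadd : ∀ {X Y} → X ⊆ E → Y ⊆ E → r (X ∪ Y) ≤ r X + r Y
  r-subadd X⊆E Y⊆E = ℕₚ.m+n≤o⇒m≤o _ (r-submod X⊆E Y⊆E)

open Matroid public using (E; r)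

infix 8 _*
infixl 6 _╲_ _/_

_╲_ : Matroid n → Subset n → Matroid n
M ╲ D = record
  { E        = E M ─ D
  ; r        = r M
  ; r-bound  = λ X⊆ → r-bound (p─q⊆p _ D ∘ X⊆)
  ; r-mono   = λ X⊆Y Y⊆ → r-mono X⊆Y (p─q⊆p _ D ∘ Y⊆)
  ; r-submod = λ X⊆ Y⊆ → r-submod (p─q⊆p _ D ∘ X⊆) (p─q⊆p _ D ∘ Y⊆)
  }
  where open Matroid M using (r-bound; r-mono; r-submod)

-- C is intersected with the ground set only to make contraction total.

_/_ : Matroid n → Subset n → Matroid n
_/_ {n} M C = record
  { E        = E M ─ C
  ; r        = λ X → r M (X ∪ K) ∸ k
  ; r-bound  = λ {X} X⊆ → ℕₚ.m≤n+o⇒m∸n≤o (r M (X ∪ K)) k (begin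
      r M (X ∪ K)     ≤⟨ r-subadd (E⊆ X⊆) K⊆E ⟩
      r M X + k       ≤⟨ ℕₚ.+-monoˡ-≤ k (r-bound (E⊆ X⊆)) ⟩
      ∣ X ∣ + k       ≡⟨ ℕₚ.+-comm ∣ X ∣ k ⟩
      k + ∣ X ∣       ∎)
  ; r-mono   = λ X⊆Y Y⊆ →
      ℕₚ.∸-monoˡ-≤ k (r-mono (∪-mono X⊆Y (λ z → z)) (∪-⊆ (E⊆ Y⊆) K⊆E))
  ; r-submod = λ {X} {Y} X⊆ Y⊆ →
      ∸-shift k
        (r-mono (q⊆p∪q (X ∪ Y) K) (∪-⊆ (∪-⊆ (E⊆ X⊆) (E⊆ Y⊆)) K⊆E))
        (r-mono (q⊆p∪q (X ∩ Y) K) (∪-⊆ (E⊆ X⊆ ∘ p∩q⊆p X Y) K⊆E))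
        (begin
          r M ((X ∪ Y) ∪ K) + r M ((X ∩ Y) ∪ K)
            ≡⟨ cong₂ (λ p q → r M p + r M q) (∪-lemma X Y) (∪-distribʳ-∩ K X Y) ⟩
          r M ((X ∪ K) ∪ (Y ∪ K)) + r M ((X ∪ K) ∩ (Y ∪ K))
            ≤⟨ r-submod (∪-⊆ (E⊆ X⊆) K⊆E) (∪-⊆ (E⊆ Y⊆) K⊆E) ⟩
          r M (X ∪ K) + r M (Y ∪ K)
            ∎)
  }
  where
  open Matroid M using (r-bound; r-mono; r-submod; r-subadd)
  open ≤-Reasoning
  K : Subset n
  K = C ∩ E M
  k : ℕ
  k = r M K
  K⊆E : K ⊆ E M
  K⊆E = p∩q⊆q C (E M)
  E⊆ : ∀ {X} → X ⊆ E M ─ C → X ⊆ E M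
  E⊆ X⊆ = p─q⊆p (E M) C ∘ X⊆
  ∪-lemma : ∀ X Y → (X ∪ Y) ∪ K ≡ (X ∪ K) ∪ (Y ∪ K)
  ∪-lemma X Y = ⊆-antisym
    (∪-⊆ (∪-mono (p⊆p∪q K) (p⊆p∪q K)) (q⊆p∪q (X ∪ K) (Y ∪ K) ∘ q⊆p∪q Y K))
    (∪-⊆ (∪-mono (p⊆p∪q Y) (λ z → z)) (∪-mono (q⊆p∪q X Y) (λ z → z)))

_* : Matroid n → Matroid n
M * = record
  { E        = E M
  ; r        = λ X → ∣ X ∣ + r M (E M ─ X) ∸ r M (E M)
  ; r-bound  = λ {X} _ → ℕₚ.m≤n+o⇒m∸n≤o (∣ X ∣ + r M (E M ─ X)) (r M (E M)) (begin
      ∣ X ∣ + r M (E M ─ X)   ≤⟨ ℕₚ.+-monoʳ-≤ ∣ X ∣ (r-mono (E─⊆ X) (λ z → z)) ⟩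
      ∣ X ∣ + r M (E M)       ≡⟨ ℕₚ.+-comm ∣ X ∣ _ ⟩
      r M (E M) + ∣ X ∣       ∎)
  ; r-mono   = λ {X} {Y} X⊆Y Y⊆E → ℕₚ.∸-monoˡ-≤ (r M (E M)) (begin
      ∣ X ∣ + r M (E M ─ X)
        ≤⟨ ℕₚ.+-monoʳ-≤ ∣ X ∣ (r-mono (cover X Y)
             (∪-⊆ (Y⊆E ∘ p─q⊆p Y X) (E─⊆ Y))) ⟩
      ∣ X ∣ + r M ((Y ─ X) ∪ (E M ─ Y))
        ≤⟨ ℕₚ.+-monoʳ-≤ ∣ X ∣ (r-subadd (Y⊆E ∘ p─q⊆p Y X) (E─⊆ Y)) ⟩
      ∣ X ∣ + (r M (Y ─ X) + r M (E M ─ Y))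
        ≡⟨ sym (ℕₚ.+-assoc ∣ X ∣ _ _) ⟩
      (∣ X ∣ + r M (Y ─ X)) + r M (E M ─ Y)
        ≤⟨ ℕₚ.+-monoˡ-≤ _ (ℕₚ.+-monoʳ-≤ ∣ X ∣ (r-bound (Y⊆E ∘ p─q⊆p Y X))) ⟩
      (∣ X ∣ + ∣ Y ─ X ∣) + r M (E M ─ Y)
        ≡⟨ cong (_+ r M (E M ─ Y)) (∣p∣+∣q─p∣ X⊆Y) ⟩
      ∣ Y ∣ + r M (E M ─ Y)
        ∎)
  ; r-submod = λ {X} {Y} X⊆E Y⊆E →
      ∸-shift (r M (E M))
        (large (∪-⊆ X⊆E Y⊆E)) (large (X⊆E ∘ p∩q⊆p X Y))
        (begin
          (∣ X ∪ Y ∣ + r M (E M ─ (X ∪ Y))) + (∣ X ∩ Y ∣ + r M (E M ─ (X ∩ Y)))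
            ≡⟨ +-swap (∣ X ∪ Y ∣) _ (∣ X ∩ Y ∣) _ ⟩
          (∣ X ∪ Y ∣ + ∣ X ∩ Y ∣) + (r M (E M ─ (X ∪ Y)) + r M (E M ─ (X ∩ Y)))
            ≡⟨ cong₂ _+_ (∣∪∣+∣∩∣ X Y)
                 (trans (cong₂ (λ p q → r M p + r M q)
                           (─-∪ (E M) X Y) (─-∩ (E M) X Y))
                        (ℕₚ.+-comm (r M ((E M ─ X) ∩ (E M ─ Y))) _)) ⟩
          (∣ X ∣ + ∣ Y ∣) + (r M ((E M ─ X) ∪ (E M ─ Y)) + r M ((E M ─ X) ∩ (E M ─ Y)))
            ≤⟨ ℕₚ.+-monoʳ-≤ (∣ X ∣ + ∣ Y ∣) (r-submod (E─⊆ X) (E─⊆ Y)) ⟩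
          (∣ X ∣ + ∣ Y ∣) + (r M (E M ─ X) + r M (E M ─ Y))
            ≡⟨ +-swap (∣ X ∣) (∣ Y ∣) _ _ ⟩
          (∣ X ∣ + r M (E M ─ X)) + (∣ Y ∣ + r M (E M ─ Y))
            ∎)
  }
  where
  open Matroid M using (r-bound; r-mono; r-submod; r-subadd)
  open ≤-Reasoning
  E─⊆ : ∀ X → E M ─ X ⊆ E M
  E─⊆ X = p─q⊆p (E M) X
  cover : ∀ X Y → E M ─ X ⊆ (Y ─ X) ∪ (E M ─ Y)
  cover X Y {x} x∈ with x ∈? Y
  ... | yes x∈Y = p⊆p∪q (E M ─ Y) (x∈p∧x∉q⇒x∈p─q x∈Y (x∈p─q⇒x∉q (E M) X x∈))
  ... | no  x∉Y = q⊆p∪q (Y ─ X) (E M ─ Y) (x∈p∧x∉q⇒x∈p─q (E─⊆ X x∈) x∉Y)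
  large : ∀ {X} → X ⊆ E M → r M (E M) ≤ ∣ X ∣ + r M (E M ─ X)
  large {X} X⊆E = begin
    r M (E M)               ≤⟨ r-mono (⊆∪─ (E M) X) (∪-⊆ X⊆E (E─⊆ X)) ⟩
    r M (X ∪ (E M ─ X))     ≤⟨ r-subadd X⊆E (E─⊆ X) ⟩
    r M X + r M (E M ─ X)   ≤⟨ ℕₚ.+-monoˡ-≤ _ (r-bound X⊆E) ⟩
    ∣ X ∣ + r M (E M ─ X)   ∎

Element : Matroid n → Set
Element M = ∃ λ e → e ∈ E M

-- The premise relating X and Y says that Y is the image of X.

_≅_ : Matroid m → Matroid n → Set
M ≅ N = Σ[ φ ∈ Element M ↔ Element N ]
  (∀ {X Y} → X ⊆ E M → Y ⊆ E N →
    (∀ e → proj₁ e ∈ X ⇔ proj₁ (Inverse.to φ e) ∈ Y) →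
    r M X ≡ r N Y)

_HasMinor_ : Matroid n → Matroid m → Set
M HasMinor N = ∃₂ λ C D →
  C ⊆ E M × D ⊆ E M × Empty (C ∩ D) × (M / C ╲ D) ≅ N

-- Truncated subtraction is exact here for X ⊆ E M, by subadditivity of r.

conn : Matroid n → Subset n → ℕ
conn M X = r M X + r M (E M ─ X) ∸ r M (E M)

-- The separation is the pair (X , E M ─ X).

Separation : Matroid n → ℕ → Subset n → Set
Separation M k X =
  1 ≤ k × X ⊆ E M × conn M X ℕ.< k × k ≤ ∣ X ∣ × k ≤ ∣ E M ─ X ∣

Connected : ℕ → Matroid n → Set
Connected j M = ∀ {k X} → 1 ≤ k → k ℕ.< j → ¬ Separation M k X

comprehension : {P : Fin n → Set} → Decidable P → Subset n
comprehension P? = tabulate (does ∘ P?)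

cl : Matroid n → Subset n → Subset n
cl M X = comprehension λ e → (e ∈? E M) ×-dec (r M (X ∪ ⁅ e ⁆) ℕ.≟ r M X)

Flat : Matroid n → Subset n → Set
Flat M F = F ⊆ E M × cl M F ≡ F

Independent : Matroid n → Subset n → Set
Independent M X = X ⊆ E M × r M X ≡ ∣ X ∣

Dependent : Matroid n → Subset n → Set
Dependent M X = X ⊆ E M × r M X ≢ ∣ X ∣

Circuit : Matroid n → Subset n → Set
Circuit M C = Dependent M C × (∀ {X} → X ⊂ C → Independent M X)

Cocircuit : Matroid n → Subset n → Set
Cocircuit M = Circuit (M *)

circuit? : (M : Matroid n) → Decidable (Circuit M)
circuit? M C =
  ((C ⊆? E M) ×-dec ¬? (r M C ℕ.≟ ∣ C ∣))
  ×-dec map′ all⇒ ⇒all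
    (¬? (anySubset? λ X → (X ⊂? C) ×-dec ¬? (independent? X)))
  where
  independent? : Decidable (Independent M)
  independent? X = (X ⊆? E M) ×-dec (r M X ℕ.≟ ∣ X ∣)
  all⇒ : ¬ (∃ λ X → X ⊂ C × ¬ Independent M X) →
         ∀ {X} → X ⊂ C → Independent M X
  all⇒ ¬∃ {X} X⊂C with independent? X
  ... | yes i = i
  ... | no ¬i = contradiction (X , X⊂C , ¬i) ¬∃
  ⇒all : (∀ {X} → X ⊂ C → Independent M X) →
         ¬ (∃ λ X → X ⊂ C × ¬ Independent M X)
  ⇒all f (X , X⊂C , ¬i) = ¬i (f X⊂C)

Loop : Matroid n → Fin n → Set
Loop M e = Circuit M ⁅ e ⁆

Parallel : Matroid n → Fin n → Fin n → Set
Parallel M e f = e ≢ f × Circuit M (⁅ e ⁆ ∪ ⁅ f ⁆)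

-- The element kept from each parallel class is the one of least index; any
-- other choice gives an isomorphic matroid.

Redundant : Matroid n → Fin n → Set
Redundant M e = Loop M e ⊎ ∃ λ f → f < e × Parallel M f e

redundant? : (M : Matroid n) → Decidable (Redundant M)
redundant? M e =
  circuit? M ⁅ e ⁆ ⊎-dec
  any? λ f → (f <? e) ×-dec (¬? (f ≟ᶠ e) ×-dec circuit? M (⁅ f ⁆ ∪ ⁅ e ⁆))

si : Matroid n → Matroid n
si M = M ╲ comprehension (redundant? M)

Triangle : Matroid n → Subset n → Set
Triangle M T = Circuit M T × ∣ T ∣ ≡ 3

Triad : Matroid n → Subset n → Set
Triad M T = Cocircuit M T × ∣ T ∣ ≡ 3

Fan₄ : Matroid n → (x₁ x₂ x₃ x₄ : Fin n) → Set
Fan₄ M x₁ x₂ x₃ x₄ =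
  Unique (x₁ ∷ x₂ ∷ x₃ ∷ x₄ ∷ []) ×
  Triangle M (⁅ x₁ ⁆ ∪ ⁅ x₂ ⁆ ∪ ⁅ x₃ ⁆) ×
  Triad M (⁅ x₂ ⁆ ∪ ⁅ x₃ ⁆ ∪ ⁅ x₄ ⁆)

Segment : Matroid n → Subset n → Set
Segment M L = L ⊆ E M × 3 ≤ ∣ L ∣ × (∀ {T} → T ⊆ L → ∣ T ∣ ≡ 3 → Triangle M T)

-- The set {x₁,…,xₜ} listed by x.

range : (Fin t → Fin n) → Subset n
range x = ⋃ (List.tabulate (⁅_⁆ ∘ x))

-- L = range x and L* = range y; the two sets come with their matched listings
-- (without repetition, so that both have t elements).

record SegmentCosegmentPair (M : Matroid n) (x y : Fin t → Fin n) : Set where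
  field
    x-injective : Injective _≡_ _≡_ x
    y-injective : Injective _≡_ _≡_ y
    segment     : Segment M (range x)
    disjoint    : Empty (range x ∩ range y)
    cocircuit   : ∀ i → Cocircuit M ((cl M (range x) - x i) ∪ ⁅ y i ⁆)

Spore : Matroid n → Subset n → Fin n → Set
Spore M P s = (Flat M P × r M P ≡ 1) × s ∈ E M × Cocircuit M (P ∪ ⁅ s ⁆)

record ThreeConnectedUpToUniqueSpore
         (M : Matroid n) (P : Subset n) (s : Fin n) : Set where
  field
    spore       : Spore M P s
    unique      : ∀ {P′ s′} → Spore M P′ s′ → P′ ≡ P × s′ ≡ s
    separations : ∀ {k X} → k ℕ.< 3 → Separation M k X →
                  X ⊆ P ∪ ⁅ s ⁆ ⊎ E M ─ X ⊆ P ∪ ⁅ s ⁆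

{-# OPTIONS --safe #-}
module Submission where

-- Suppose that (i) fails.  Then every x ∈ C* such that M / x has an N-minor lies in
-- a vertical 3-partition (X , x , Y) in which X contains at most one element of N.
-- Decomposing M / x as a 2-sum along (X , Y) shows that M / x / y has an N-minor for
-- every y ∈ X outside the closure of Y, and C* contains such a y.  For |X| minimal,
-- uncrossing X with a vertical 3-partition at y covers X ∪ {x} by two lines through
-- y, and varying y leaves only one possibility: X = (L - x) ∪ {z} for a line L
-- through x.  So X is a cocircuit, M / L has an N-minor, and L has at most one
-- point off C*.
--
-- Let w be another point of L such that si(M / w) is not 3-connected.  Uncrossing
-- vertical 3-partitions at two such points shows that (L - w) ∪ {z′} is a cocircuit
-- for some z′.  Three cocircuits of this form make M / L 3-connected, because of two
-- of the elements z′ on the same side of a 2-separation of M / L each would keep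
-- that side from spanning the point belonging to the other; and then the only
-- 2-separations of M / w lie in (L - w) ∪ {z′}.  The point e of L off C*, if there is
-- one, decides the outcome: it is (iv) if there is no e or si(M / e) is not
-- 3-connected, and otherwise (ii) or (iii), according as |L| = 3 or |L| ≥ 4.

open import Defs
open import Data.Bool using (Bool; true; false; _∧_; _∨_; not; T; T?)
import Data.Empty as Empty
open import Data.Fin as Fin using (Fin; zero; suc; toℕ)
open import Data.Fin.Properties as Finₚ using () renaming (_≟_ to _≟ᶠ_)
open import Data.Fin.Subset
open import Data.Fin.Subset.Properties renaming (x∈p∧x∉q⇒x∈p─q to ∈-─⁺)
open import Data.List as List using (List; []; _∷_; _++_)
open import Data.List.Membership.Propositional using () renaming (_∈_ to _∈ˡ_)
open import Data.List.Membership.Propositional.Properties as Listₚ using ()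
open import Data.List.Relation.Unary.All as All using (All; []; _∷_)
import Data.List.Relation.Unary.All.Properties as Allₚ
open import Data.List.Relation.Unary.AllPairs using ([]; _∷_)
open import Data.List.Relation.Unary.Any using (here; there)
open import Data.Nat as ℕ using (ℕ; zero; suc; _+_; _∸_; _≤_; _<_; z≤n; s≤s; _≤ᵇ_)
import Data.Nat.Properties as ℕₚ
open ℕₚ using (≤-trans; ≤-reflexive; ≤-antisym; +-monoˡ-≤; +-monoʳ-≤; +-mono-≤; +-cancelʳ-≤; +-assoc; +-comm; ≰⇒>; ≮⇒≥; <⇒≱; 1+n≰n)
open import Data.Product using (_×_; _,_; ∃; ∃₂; ∃-syntax; Σ-syntax; proj₁; proj₂)
open import Data.Sum using (_⊎_; inj₁; inj₂; [_,_]′)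
open import Data.Unit using (tt)
open import Data.Vec as Vec using (Vec; []; _∷_; lookup; allFin; here; there)
open import Data.Vec.N-ary using (N-ary; _$ⁿ_)
open import Data.Vec.Properties using (lookup-map; lookup-zipWith; lookup⇒[]=; []=⇒lookup; lookup-replicate; lookup∘tabulate)
open import Data.Vec.Properties.WithK using ([]=-irrelevant)
open import Function using (_∘_; id; case_of_; Equivalence; Inverse; _⇔_; mk⇔; mk↔ₛ′)
open import Function.Definitions using (Injective)
open import Relation.Binary.Definitions using (tri<; tri≈; tri>)
open import Relation.Binary.PropositionalEquality using (_≡_; _≢_; refl; sym; trans; cong; cong₂; subst; subst₂; module ≡-Reasoning)
open import Relation.Nullary
open import Relation.Nullary.Decidable using (_×-dec_; dec-true)

-- The descent moves a concrete copy of N: an injection of `E N` into `E M` with a contracted set.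
-- Only for a fixed copy does it make sense that a side holds at most one element of N, and one
-- element of N can then be exchanged while the others stay put. The contracted set may be
-- dependent, so a whole line joins it once two of its points are there. The bound |E N| ≥ 4 acts
-- twice. It makes N simple and cosimple, so that no loop, coloop or parallel pair obstructs such
-- exchanges; and it leaves two elements of N outside any two sides that hold at most one each, as
-- needed to bound the connectivity of the union of crossing sides. The main obstacle is that
-- uncrossing must produce something smaller than X. A piece of X that misses y is smaller, but a
-- piece that also picks up x need not be: it has to miss a second element h of X. Such an h exists
-- because X has rank at least 3 while a piece on a line through y has rank at most 2. All rank
-- inequalities are sums of instances of submodularity and known bounds, so only the instances are
-- recorded and the summation is left to computation.

private
  variable
    k m n t : ℕ

-- Set algebra and rank inequalities by reflection

infixl 5.9 _∖_
infixr 7 _⊓_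
infixr 6 _⊔_
infixr 5.8 _⊕_
infix  5.5 _⊑_ _≼_

data Ex (k : ℕ) : Set where
  var     : Fin k → Ex k
  _⊔_ _⊓_ _∖_ : Ex k → Ex k → Ex k
  ~_      : Ex k → Ex k
  ● ○     : Ex k

infix 8 ~_

⟦_⟧ : Ex k → Vec (Subset n) k → Subset n
⟦ var i ⟧ ρ = lookup ρ i
⟦ a ⊔ b ⟧ ρ = ⟦ a ⟧ ρ ∪ ⟦ b ⟧ ρ
⟦ a ⊓ b ⟧ ρ = ⟦ a ⟧ ρ ∩ ⟦ b ⟧ ρ
⟦ a ∖ b ⟧ ρ = ⟦ a ⟧ ρ ─ ⟦ b ⟧ ρ
⟦ ~ a ⟧ ρ   = ∁ (⟦ a ⟧ ρ)
⟦ ● ⟧ ρ     = ⊤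
⟦ ○ ⟧ ρ     = ⊥

val : Ex k → Vec Bool k → Bool
val (var i) c = lookup c i
val (a ⊔ b) c = val a c ∨ val b c
val (a ⊓ b) c = val a c ∧ val b c
val (a ∖ b) c = val a c ∧ not (val b c)
val (~ a) c   = not (val a c)
val ● c       = true
val ○ c       = false

-- The atom of the Boolean algebra generated by `ρ` that contains `i`, as a membership vector.
-- Whether `i` belongs to an expression depends on nothing else.
cell : Vec (Subset n) k → Fin n → Vec Bool k
cell ρ i = Vec.map (λ S → lookup S i) ρ

lookup-─ : (p q : Subset n) (i : Fin n) → lookup (p ─ q) i ≡ lookup p i ∧ not (lookup q i)
lookup-─ (true  ∷ p) (true  ∷ q) zero    = refl
lookup-─ (true  ∷ p) (false ∷ q) zero    = refl
lookup-─ (false ∷ p) (true  ∷ q) zero    = refl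
lookup-─ (false ∷ p) (false ∷ q) zero    = refl
lookup-─ (_ ∷ p)     (true  ∷ q) (suc i) = lookup-─ p q i
lookup-─ (_ ∷ p)     (false ∷ q) (suc i) = lookup-─ p q i

lookup-⟦⟧ : (e : Ex k) (ρ : Vec (Subset n) k) (i : Fin n) →
            lookup (⟦ e ⟧ ρ) i ≡ val e (cell ρ i)
lookup-⟦⟧ (var j) ρ i = sym (lookup-map j _ ρ)
lookup-⟦⟧ (a ⊔ b) ρ i = trans (lookup-zipWith _∨_ i (⟦ a ⟧ ρ) (⟦ b ⟧ ρ))
  (cong₂ _∨_ (lookup-⟦⟧ a ρ i) (lookup-⟦⟧ b ρ i))
lookup-⟦⟧ (a ⊓ b) ρ i = trans (lookup-zipWith _∧_ i (⟦ a ⟧ ρ) (⟦ b ⟧ ρ))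
  (cong₂ _∧_ (lookup-⟦⟧ a ρ i) (lookup-⟦⟧ b ρ i))
lookup-⟦⟧ (a ∖ b) ρ i = trans (lookup-─ (⟦ a ⟧ ρ) (⟦ b ⟧ ρ) i)
  (cong₂ (λ u v → u ∧ not v) (lookup-⟦⟧ a ρ i) (lookup-⟦⟧ b ρ i))
lookup-⟦⟧ (~ a) ρ i = trans (lookup-map i not (⟦ a ⟧ ρ)) (cong not (lookup-⟦⟧ a ρ i))
lookup-⟦⟧ ● ρ i = lookup-replicate i true
lookup-⟦⟧ ○ ρ i = lookup-replicate i false

record Fact (k : ℕ) : Set where
  constructor _⊑_
  field sub sup : Ex k

⟦_⟧ᶠ : Fact k → Vec (Subset n) k → Set
⟦ a ⊑ b ⟧ᶠ ρ = ⟦ a ⟧ ρ ⊆ ⟦ b ⟧ ρ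

_⇛_ : Bool → Bool → Bool
true  ⇛ b = b
false ⇛ b = true

feasible : List (Fact k) → Vec Bool k → Bool
feasible []             c = true
feasible (a ⊑ b ∷ fs) c = (val a c ⇛ val b c) ∧ feasible fs c

⇛-intro : ∀ a {b} → (a ≡ true → b ≡ true) → (a ⇛ b) ≡ true
⇛-intro true  f = f refl
⇛-intro false f = refl

⇛-elim : ∀ {a b} → (a ⇛ b) ≡ true → a ≡ true → b ≡ true
⇛-elim p refl = p

feasible-cell : (ρ : Vec (Subset n) k) (fs : List (Fact k)) →
                All (λ f → ⟦ f ⟧ᶠ ρ) fs → ∀ i → feasible fs (cell ρ i) ≡ true
feasible-cell ρ [] [] i = refl
feasible-cell ρ (a ⊑ b ∷ fs) (p ∷ ps) i = cong₂ _∧_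
  (⇛-intro (val a (cell ρ i)) λ va → trans (sym (lookup-⟦⟧ b ρ i))
    ([]=⇒lookup (p (lookup⇒[]= i (⟦ a ⟧ ρ) (trans (lookup-⟦⟧ a ρ i) va)))))
  (feasible-cell ρ fs ps i)

cells : ∀ k → List (Vec Bool k)
cells zero    = [] ∷ []
cells (suc k) = List.map (true ∷_) (cells k) ++ List.map (false ∷_) (cells k)

∈-cells : (c : Vec Bool k) → c ∈ˡ cells k
∈-cells []          = here refl
∈-cells (true  ∷ c) = Listₚ.∈-++⁺ˡ (Listₚ.∈-map⁺ (true ∷_) (∈-cells c))
∈-cells {suc k} (false ∷ c) =
  Listₚ.∈-++⁺ʳ (List.map (true ∷_) (cells k)) (Listₚ.∈-map⁺ (false ∷_) (∈-cells c))


possible : List (Fact k) → List (Vec Bool k)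
possible {k} fs = List.filterᵇ (feasible fs) (cells k)

∈-possible : (ρ : Vec (Subset n) k) (fs : List (Fact k)) →
             All (λ f → ⟦ f ⟧ᶠ ρ) fs → ∀ i → cell ρ i ∈ˡ possible fs
∈-possible ρ fs ps i = Listₚ.∈-filter⁺ (T? ∘ feasible fs) (∈-cells (cell ρ i))
  (subst T (sym (feasible-cell ρ fs ps i)) tt)

Table : Set
Table = List Bool

_⊆ᵇ_ : Table → Table → Bool
(a ∷ as) ⊆ᵇ (b ∷ bs) = (a ⇛ b) ∧ (as ⊆ᵇ bs)
_        ⊆ᵇ _        = true

table : List (Vec Bool k) → Ex k → Table
table cs e = List.map (val e) cs

∧-true : ∀ {a b} → (a ∧ b) ≡ true → a ≡ true × b ≡ true
∧-true {true} p = refl , p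

⊆ᵇ-sound : (cs : List (Vec Bool k)) (a b : Ex k) → (table cs a ⊆ᵇ table cs b) ≡ true →
           ∀ {c} → c ∈ˡ cs → val a c ≡ true → val b c ≡ true
⊆ᵇ-sound (c ∷ cs) a b p (here refl) = ⇛-elim (proj₁ (∧-true p))
⊆ᵇ-sound (c ∷ cs) a b p (there c∈)  = ⊆ᵇ-sound cs a b (proj₂ (∧-true p)) c∈

⊆-sound : (ρ : Vec (Subset n) k) (cs : List (Vec Bool k)) → (∀ i → cell ρ i ∈ˡ cs) →
          (a b : Ex k) → (table cs a ⊆ᵇ table cs b) ≡ true → ⟦ a ⟧ ρ ⊆ ⟦ b ⟧ ρ
⊆-sound ρ cs all a b p {i} i∈ = lookup⇒[]= i (⟦ b ⟧ ρ) (trans (lookup-⟦⟧ b ρ i)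
  (⊆ᵇ-sound cs a b p (all i) (trans (sym (lookup-⟦⟧ a ρ i)) ([]=⇒lookup i∈))))

vars : Vec (Ex k) k
vars = Vec.map var (allFin _)

-- Goals are written as functions of named expressions; applying them to the variables in order
-- turns them into closed data on which a check can run.
saturate : ∀ k {B : Set} → N-ary k (Ex k) B → B
saturate k f = _$ⁿ_ {n = k} f vars

infix 2 _⊢_
record Inclusion (k : ℕ) : Set where
  constructor _⊢_
  field facts : List (Fact k) ; concl : Fact k

-- A Boolean inclusion follows from others as soon as it does so pointwise, which
-- is a finite check on the atoms.

sets-sound : (ρ : Vec (Subset n) k) (p : Inclusion k) →
  let open Inclusion p ; cs = possible facts in
  (table cs (Fact.sub concl) ⊆ᵇ table cs (Fact.sup concl)) ≡ true →
  All (λ f → ⟦ f ⟧ᶠ ρ) facts → ⟦ concl ⟧ᶠ ρ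
sets-sound ρ (fs ⊢ a ⊑ b) check ps =
  ⊆-sound ρ (possible fs) (∈-possible ρ fs ps) a b check

sets : ∀ {n k} (ρ : Vec (Subset n) k) (P : N-ary k (Ex k) (Inclusion k)) →
  let open Inclusion (saturate k {Inclusion k} P) ; cs = possible facts in
  (table cs (Fact.sub concl) ⊆ᵇ table cs (Fact.sup concl)) ≡ true →
  All (λ f → ⟦ f ⟧ᶠ ρ) facts → ⟦ concl ⟧ᶠ ρ
sets {k = k} ρ P = sets-sound ρ (saturate k P)

data Lin (k : ℕ) : Set where
  ϱ   : Ex k → Lin k
  #   : ℕ → Lin k
  _⊕_ : Lin k → Lin k → Lin k

record Bound (k : ℕ) : Set where
  constructor _≼_
  field lower upper : Lin k

-- Defined for all subsets: elements outside the ground set count as loops.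

rk : Matroid n → Subset n → ℕ
rk M X = r M (X ∩ E M)

rk-mono : (M : Matroid n) {X Y : Subset n} → X ⊆ Y → rk M X ≤ rk M Y
rk-mono M {X} {Y} X⊆Y = Matroid.r-mono M
  (λ z → x∈p∩q⁺ (X⊆Y (proj₁ (x∈p∩q⁻ X (E M) z)) , proj₂ (x∈p∩q⁻ X (E M) z)))
  (p∩q⊆q Y (E M))

rk-submod : (M : Matroid n) (X Y : Subset n) →
            rk M (X ∩ Y) + rk M (X ∪ Y) ≤ rk M X + rk M Y
rk-submod M X Y = subst (_≤ rk M X + rk M Y)
  (trans (+-comm (r M ((X ∩ E M) ∪ (Y ∩ E M))) _)
    (cong₂ (λ p q → r M p + r M q)
      (⊆-antisym
        (sets (X ∷ Y ∷ E M ∷ []) (λ X Y E → [] ⊢ (X ⊓ E) ⊓ (Y ⊓ E) ⊑ (X ⊓ Y) ⊓ E) refl [])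
        (sets (X ∷ Y ∷ E M ∷ []) (λ X Y E → [] ⊢ (X ⊓ Y) ⊓ E ⊑ (X ⊓ E) ⊓ (Y ⊓ E)) refl []))
      (sym (∩-distribʳ-∪ (E M) X Y))))
  (Matroid.r-submod M (p∩q⊆q X (E M)) (p∩q⊆q Y (E M)))

rk-≤-∣∣ : (M : Matroid n) (X : Subset n) → rk M X ≤ ∣ X ∩ E M ∣
rk-≤-∣∣ M X = Matroid.r-bound M (p∩q⊆q X (E M))

rk-⊥ : (M : Matroid n) → rk M ⊥ ≡ 0
rk-⊥ {n} M = ℕₚ.n≤0⇒n≡0 (≤-trans (rk-≤-∣∣ M ⊥)
  (≤-trans (∣p∩q∣≤∣p∣ ⊥ (E M)) (≤-reflexive (∣⊥∣≡0 n))))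

module _ (M : Matroid n) where

  ⟦_⟧ˡ : Lin k → Vec (Subset n) k → ℕ
  ⟦ ϱ e ⟧ˡ ρ   = rk M (⟦ e ⟧ ρ)
  ⟦ # c ⟧ˡ ρ   = c
  ⟦ s ⊕ u ⟧ˡ ρ = ⟦ s ⟧ˡ ρ + ⟦ u ⟧ˡ ρ

  ⟦_⟧ᵇ : Bound k → Vec (Subset n) k → Set
  ⟦ s ≼ u ⟧ᵇ ρ = ⟦ s ⟧ˡ ρ ≤ ⟦ u ⟧ˡ ρ

ranks : Lin k → List (Ex k) → List (Ex k)
ranks (ϱ e)   es = e ∷ es
ranks (# c)   es = es
ranks (s ⊕ u) es = ranks s (ranks u es)

const : Lin k → ℕ
const (ϱ e)   = 0
const (# c)   = c
const (s ⊕ u) = const s + const u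

empty : Table → Bool
empty t = t ⊆ᵇ List.map (λ _ → false) t

_=ᵇ_ : Table → Table → Bool
a =ᵇ b = (a ⊆ᵇ b) ∧ (b ⊆ᵇ a)

-- The truth table is stored beside the expression, so that the matching below compares lists of
-- Booleans without evaluating expressions again.
record Entry (cs : List (Vec Bool k)) : Set where
  constructor entry
  field
    ex : Ex k
    tb : Table
    ok : tb ≡ table cs ex

open Entry

entries : (cs : List (Vec Bool k)) → List (Ex k) → List (Entry cs)
entries cs = List.map λ e → entry e (table cs e) refl

module _ {cs : List (Vec Bool k)} (_≲_ : Table → Table → Bool) where

  remove : Table → List (Entry cs) → Bool × List (Entry cs)
  remove t []       = false , []
  remove t (e ∷ es) with t ≲ tb e
  ... | true  = true , es
  ... | false = let b , es′ = remove t es in b , e ∷ es′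

  cancel : List (Entry cs) → List (Entry cs) → List (Entry cs) × List (Entry cs)
  cancel []       R = [] , R
  cancel (e ∷ L) R with remove (tb e) R
  ... | true  , R′ = cancel L R′
  ... | false , R′ = let L″ , R″ = cancel L R in e ∷ L″ , R″

allEmpty : {cs : List (Vec Bool k)} → List (Entry cs) → Bool
allEmpty []       = true
allEmpty (e ∷ es) = empty (tb e) ∧ allEmpty es

-- Equal sets are cancelled before inclusions are tried: a greedy choice of a larger set could
-- otherwise use up the exact partner of another one. What stays unmatched in `L` must be empty,
-- hence of rank 0.
balanced : {cs : List (Vec Bool k)} → List (Entry cs) → List (Entry cs) → Bool
balanced L R =
  let L′ , R′ = cancel _=ᵇ_ L R
      L″ , _  = cancel _⊆ᵇ_ L′ R′
  in allEmpty L″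

infix 1 _∣_by_⊩_
record Estimate (k : ℕ) : Set where
  constructor _∣_by_⊩_
  field
    facts  : List (Fact k)
    bounds : List (Bound k)
    submod : List (Ex k × Ex k)
    concl  : Bound k

totalᵉ : (Bound k → Lin k) → List (Bound k) → List (Ex k)
totalᵉ f []       = []
totalᵉ f (b ∷ bs) = ranks (f b) (totalᵉ f bs)

totalᶜ : (Bound k → Lin k) → List (Bound k) → ℕ
totalᶜ f []       = 0
totalᶜ f (b ∷ bs) = const (f b) + totalᶜ f bs

swapᵇ : Bound k → Bound k
swapᵇ (s ≼ u) = u ≼ s

submodᵇ : Ex k × Ex k → Bound k
-- The intersection comes first because a rank below is matched with the first
-- available larger one above.
submodᵇ (a , b) = ϱ (a ⊓ b) ⊕ ϱ (a ⊔ b) ≼ ϱ a ⊕ ϱ b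

-- The sum of all the available bounds implies the conclusion if, after moving
-- the conclusion to the other side, what is left below is dominated by what is left
-- above, rank by rank.

checkᵉ : Estimate k → Bool
checkᵉ (fs ∣ bs by ss ⊩ g) =
  let all = swapᵇ g ∷ List.map submodᵇ ss ++ bs
      cs  = possible fs
  in balanced (entries cs (totalᵉ Bound.upper all)) (entries cs (totalᵉ Bound.lower all))
     ∧ (totalᶜ Bound.upper all ≤ᵇ totalᶜ Bound.lower all)

+-exchange : ∀ a b c → a + (b + c) ≡ b + (a + c)
+-exchange a b c = trans (sym (+-assoc a b c))
  (trans (cong (_+ c) (+-comm a b)) (+-assoc b a c))

module _ (M : Matroid n) (ρ : Vec (Subset n) k) where

  private
    ⟦_⟧ʳ : Ex k → ℕ
    ⟦ e ⟧ʳ = rk M (⟦ e ⟧ ρ)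

    Σʳ : List (Ex k) → ℕ
    Σʳ = List.foldr (λ e s → ⟦ e ⟧ʳ + s) 0

    Σᵇ : (Bound k → Lin k) → List (Bound k) → ℕ
    Σᵇ f = List.foldr (λ b s → ⟦_⟧ˡ M (f b) ρ + s) 0

    ranks-sound : ∀ s es → Σʳ (ranks s es) + const s ≡ ⟦_⟧ˡ M s ρ + Σʳ es
    ranks-sound (ϱ e) es   = ℕₚ.+-identityʳ _
    ranks-sound (# c) es   = +-comm _ c
    ranks-sound (s ⊕ u) es = begin
      Σʳ (ranks s (ranks u es)) + (const s + const u)
        ≡⟨ sym (+-assoc (Σʳ (ranks s (ranks u es))) (const s) _) ⟩
      (Σʳ (ranks s (ranks u es)) + const s) + const u
        ≡⟨ cong (_+ const u) (ranks-sound s (ranks u es)) ⟩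
      (⟦_⟧ˡ M s ρ + Σʳ (ranks u es)) + const u
        ≡⟨ +-assoc (⟦_⟧ˡ M s ρ) _ _ ⟩
      ⟦_⟧ˡ M s ρ + (Σʳ (ranks u es) + const u)
        ≡⟨ cong (⟦_⟧ˡ M s ρ +_) (ranks-sound u es) ⟩
      ⟦_⟧ˡ M s ρ + (⟦_⟧ˡ M u ρ + Σʳ es)
        ≡⟨ sym (+-assoc (⟦_⟧ˡ M s ρ) _ _) ⟩
      (⟦_⟧ˡ M s ρ + ⟦_⟧ˡ M u ρ) + Σʳ es ∎
      where open ≡-Reasoning

    totals-sound : ∀ f bs → Σʳ (totalᵉ f bs) + totalᶜ f bs ≡ Σᵇ f bs
    totals-sound f []       = refl
    totals-sound f (b ∷ bs) = begin
      Σʳ (ranks (f b) (totalᵉ f bs)) + (const (f b) + totalᶜ f bs)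
        ≡⟨ sym (+-assoc (Σʳ (ranks (f b) (totalᵉ f bs))) (const (f b)) _) ⟩
      (Σʳ (ranks (f b) (totalᵉ f bs)) + const (f b)) + totalᶜ f bs
        ≡⟨ cong (_+ totalᶜ f bs) (ranks-sound (f b) (totalᵉ f bs)) ⟩
      (⟦_⟧ˡ M (f b) ρ + Σʳ (totalᵉ f bs)) + totalᶜ f bs
        ≡⟨ +-assoc (⟦_⟧ˡ M (f b) ρ) _ _ ⟩
      ⟦_⟧ˡ M (f b) ρ + (Σʳ (totalᵉ f bs) + totalᶜ f bs)
        ≡⟨ cong (⟦_⟧ˡ M (f b) ρ +_) (totals-sound f bs) ⟩
      Σᵇ f (b ∷ bs) ∎
      where open ≡-Reasoning

    Σᵇ-mono : ∀ bs → All (λ b → ⟦_⟧ᵇ M b ρ) bs → Σᵇ Bound.lower bs ≤ Σᵇ Bound.upper bs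
    Σᵇ-mono [] []             = z≤n
    Σᵇ-mono (b ∷ bs) (p ∷ ps) = +-mono-≤ p (Σᵇ-mono bs ps)

    Σᵇ-submod : ∀ ss → All (λ b → ⟦_⟧ᵇ M b ρ) (List.map submodᵇ ss)
    Σᵇ-submod []             = []
    Σᵇ-submod ((a , b) ∷ ss) = rk-submod M (⟦ a ⟧ ρ) (⟦ b ⟧ ρ) ∷ Σᵇ-submod ss

    module _ {cs : List (Vec Bool k)} (every : ∀ i → cell ρ i ∈ˡ cs) where

      Σᵉ : List (Entry cs) → ℕ
      Σᵉ = List.foldr (λ e s → ⟦ ex e ⟧ʳ + s) 0

      Σᵉ-entries : ∀ es → Σᵉ (entries cs es) ≡ Σʳ es
      Σᵉ-entries []       = refl
      Σᵉ-entries (e ∷ es) = cong (⟦ e ⟧ʳ +_) (Σᵉ-entries es)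

      entry-≤ : (a b : Entry cs) → (tb a ⊆ᵇ tb b) ≡ true → ⟦ ex a ⟧ʳ ≤ ⟦ ex b ⟧ʳ
      entry-≤ (entry a _ refl) (entry b _ refl) p = rk-mono M (⊆-sound ρ cs every a b p)

      module _ (_≲_ : Table → Table → Bool)
               (≲⇒⊆ : ∀ a b → (a ≲ b) ≡ true → (a ⊆ᵇ b) ≡ true) where

        remove-sound : ∀ a R → proj₁ (remove _≲_ (tb a) R) ≡ true →
                       ⟦ ex a ⟧ʳ + Σᵉ (proj₂ (remove _≲_ (tb a) R)) ≤ Σᵉ R
        remove-sound a (e ∷ R) p with tb a ≲ tb e in eq
        ... | true  = +-monoˡ-≤ (Σᵉ R) (entry-≤ a e (≲⇒⊆ (tb a) (tb e) eq))
        ... | false = begin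
          ⟦ ex a ⟧ʳ + (⟦ ex e ⟧ʳ + Σᵉ R′) ≡⟨ +-exchange ⟦ ex a ⟧ʳ ⟦ ex e ⟧ʳ (Σᵉ R′) ⟩
          ⟦ ex e ⟧ʳ + (⟦ ex a ⟧ʳ + Σᵉ R′) ≤⟨ +-monoʳ-≤ ⟦ ex e ⟧ʳ (remove-sound a R p) ⟩
          ⟦ ex e ⟧ʳ + Σᵉ R ∎
          where
          open ℕₚ.≤-Reasoning
          R′ = proj₂ (remove _≲_ (tb a) R)

        cancel-sound : ∀ L R → Σᵉ L + Σᵉ (proj₂ (cancel _≲_ L R))
                               ≤ Σᵉ (proj₁ (cancel _≲_ L R)) + Σᵉ R
        cancel-sound []      R = ℕₚ.≤-refl
        cancel-sound (e ∷ L) R with remove _≲_ (tb e) R in eq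
        ... | true , R′ = begin
          (⟦ ex e ⟧ʳ + Σᵉ L) + Σᵉ R₂   ≡⟨ +-assoc ⟦ ex e ⟧ʳ _ _ ⟩
          ⟦ ex e ⟧ʳ + (Σᵉ L + Σᵉ R₂)   ≤⟨ +-monoʳ-≤ ⟦ ex e ⟧ʳ (cancel-sound L R′) ⟩
          ⟦ ex e ⟧ʳ + (Σᵉ L₂ + Σᵉ R′)  ≡⟨ +-exchange ⟦ ex e ⟧ʳ (Σᵉ L₂) _ ⟩
          Σᵉ L₂ + (⟦ ex e ⟧ʳ + Σᵉ R′)  ≤⟨ +-monoʳ-≤ (Σᵉ L₂) removed ⟩
          Σᵉ L₂ + Σᵉ R                 ∎
          where
          open ℕₚ.≤-Reasoning
          L₂ = proj₁ (cancel _≲_ L R′)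
          R₂ = proj₂ (cancel _≲_ L R′)
          removed : ⟦ ex e ⟧ʳ + Σᵉ R′ ≤ Σᵉ R
          removed = subst (λ p → ⟦ ex e ⟧ʳ + Σᵉ (proj₂ p) ≤ Σᵉ R) eq
            (remove-sound e R (cong proj₁ eq))
        ... | false , R′ = begin
          (⟦ ex e ⟧ʳ + Σᵉ L) + Σᵉ R₂   ≡⟨ +-assoc ⟦ ex e ⟧ʳ _ _ ⟩
          ⟦ ex e ⟧ʳ + (Σᵉ L + Σᵉ R₂)   ≤⟨ +-monoʳ-≤ ⟦ ex e ⟧ʳ (cancel-sound L R) ⟩
          ⟦ ex e ⟧ʳ + (Σᵉ L₂ + Σᵉ R)   ≡⟨ sym (+-assoc ⟦ ex e ⟧ʳ (Σᵉ L₂) _) ⟩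
          (⟦ ex e ⟧ʳ + Σᵉ L₂) + Σᵉ R   ∎
          where
          open ℕₚ.≤-Reasoning
          L₂ = proj₁ (cancel _≲_ L R)
          R₂ = proj₂ (cancel _≲_ L R)

      empty-sound : (a : Entry cs) → empty (tb a) ≡ true → ⟦ ex a ⟧ʳ ≡ 0
      empty-sound (entry a _ refl) p = ℕₚ.n≤0⇒n≡0 (≤-trans
        (rk-mono M (⊆-sound ρ _ every a ○
          (subst (λ t → (table cs a ⊆ᵇ t) ≡ true) (falses cs) p)))
        (≤-reflexive (rk-⊥ M)))
        where
        falses : ∀ cs → List.map (λ _ → false) (table cs a) ≡ table cs ○
        falses []       = refl
        falses (c ∷ cs) = cong (false ∷_) (falses cs)

      allEmpty-sound : ∀ L → allEmpty L ≡ true → Σᵉ L ≡ 0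
      allEmpty-sound []      p = refl
      allEmpty-sound (e ∷ L) p = cong₂ _+_ (empty-sound e (proj₁ (∧-true p)))
        (allEmpty-sound L (proj₂ (∧-true p)))

      balanced-sound : ∀ L R → balanced L R ≡ true → Σᵉ L ≤ Σᵉ R
      balanced-sound L R p =
        +-cancelʳ-≤ (Σᵉ R₁) _ _ (begin
          Σᵉ L + Σᵉ R₁                   ≤⟨ cancel-sound _=ᵇ_ (λ _ _ → proj₁ ∘ ∧-true) L R ⟩
          Σᵉ L₁ + Σᵉ R                   ≤⟨ +-monoˡ-≤ (Σᵉ R) (ℕₚ.m≤m+n (Σᵉ L₁) (Σᵉ R₂)) ⟩
          (Σᵉ L₁ + Σᵉ R₂) + Σᵉ R         ≤⟨ +-monoˡ-≤ (Σᵉ R) (cancel-sound _⊆ᵇ_ (λ _ _ → id) L₁ R₁) ⟩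
          (Σᵉ L₂ + Σᵉ R₁) + Σᵉ R         ≡⟨ cong (λ z → (z + Σᵉ R₁) + Σᵉ R) (allEmpty-sound L₂ p) ⟩
          Σᵉ R₁ + Σᵉ R                   ≡⟨ +-comm (Σᵉ R₁) _ ⟩
          Σᵉ R + Σᵉ R₁                   ∎)
        where
        open ℕₚ.≤-Reasoning
        L₁ = proj₁ (cancel _=ᵇ_ L R)
        R₁ = proj₂ (cancel _=ᵇ_ L R)
        L₂ = proj₁ (cancel _⊆ᵇ_ L₁ R₁)
        R₂ = proj₂ (cancel _⊆ᵇ_ L₁ R₁)

  -- The conclusion enters reversed: its lower side joins the upper sides of the other bounds, and
  -- its upper side joins their lower sides. The check compares these two totals, and cancelling the
  -- lower sides of the other bounds leaves the conclusion.
  estimate-sound : (p : Estimate k) → let open Estimate p in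
                   checkᵉ p ≡ true → All (λ f → ⟦ f ⟧ᶠ ρ) facts →
                   All (λ b → ⟦_⟧ᵇ M b ρ) bounds → ⟦_⟧ᵇ M concl ρ
  estimate-sound (fs ∣ bs by ss ⊩ g) check facts bounds =
    +-cancelʳ-≤ (Σᵇ Bound.lower rest) _ _ (begin
      ⟦_⟧ˡ M (Bound.lower g) ρ + Σᵇ Bound.lower rest
        ≤⟨ +-monoʳ-≤ (⟦_⟧ˡ M (Bound.lower g) ρ)
             (Σᵇ-mono rest (Allₚ.++⁺ (Σᵇ-submod ss) bounds)) ⟩
      Σᵇ Bound.upper every-bound
        ≡⟨ sym (totals-sound Bound.upper every-bound) ⟩
      Σʳ L + totalᶜ Bound.upper every-bound
        ≤⟨ +-mono-≤ totals-≤ (ℕₚ.≤ᵇ⇒≤ (totalᶜ Bound.upper every-bound) _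
             (subst T (sym (proj₂ checks)) tt)) ⟩
      Σʳ R + totalᶜ Bound.lower every-bound
        ≡⟨ totals-sound Bound.lower every-bound ⟩
      ⟦_⟧ˡ M (Bound.upper g) ρ + Σᵇ Bound.lower rest ∎)
    where
    open ℕₚ.≤-Reasoning
    rest every-bound : List (Bound k)
    rest        = List.map submodᵇ ss ++ bs
    every-bound = swapᵇ g ∷ rest
    cs = possible fs
    L R : List (Ex k)
    L = totalᵉ Bound.upper every-bound
    R = totalᵉ Bound.lower every-bound
    checks = ∧-true {balanced (entries cs L) (entries cs R)} check
    every : ∀ i → cell ρ i ∈ˡ cs
    every = ∈-possible ρ fs facts
    totals-≤ : Σʳ L ≤ Σʳ R
    totals-≤ = subst₂ _≤_ (Σᵉ-entries every L) (Σᵉ-entries every R)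
      (balanced-sound every (entries cs L) (entries cs R) (proj₁ checks))

  estimate : (P : N-ary k (Ex k) (Estimate k)) →
             let p = saturate k {Estimate k} P ; open Estimate p in
             checkᵉ p ≡ true → All (λ f → ⟦ f ⟧ᶠ ρ) facts →
             All (λ b → ⟦_⟧ᵇ M b ρ) bounds → ⟦_⟧ᵇ M concl ρ
  estimate P = estimate-sound (saturate k P)

-- Singletons, small cardinalities and witnesses.

∈! : {x : Fin n} {p : Subset n} → x ∈ p → ⁅ x ⁆ ⊆ p
∈! {x = x} {p} x∈p y∈ = subst (_∈ p) (sym (x∈⁅y⁆⇒x≡y x y∈)) x∈p

∉! : {x : Fin n} {p : Subset n} → x ∉ p → ⁅ x ⁆ ⊆ ∁ p
∉! x∉p = ∈! (x∉p⇒x∈∁p x∉p)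

≢! : {x y : Fin n} → x ≢ y → ⁅ x ⁆ ⊆ ∁ ⁅ y ⁆
≢! x≢y = ∉! (x≢y⇒x∉⁅y⁆ x≢y)

⁅⁆⊆⇒∈ : {x : Fin n} {p : Subset n} → ⁅ x ⁆ ⊆ p → x ∈ p
⁅⁆⊆⇒∈ {x = x} s = s (x∈⁅x⁆ x)

∈--⁺ : {p : Subset n} {x y : Fin n} → x ∈ p → x ≢ y → x ∈ p - y
∈--⁺ x∈p x≢y = ∈-─⁺ x∈p (x≢y⇒x∉⁅y⁆ x≢y)

Pair : Subset n → Set
Pair p = ∃₂ λ a b → a ≢ b × a ∈ p × b ∈ p

PairBesides : Fin n → Subset n → Set
PairBesides a p = ∃₂ λ b c → a ≢ b × a ≢ c × b ≢ c × b ∈ p × c ∈ p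

subset-induction : (P : Subset n → Set) → P ⊥ →
                   (∀ D e → e ∈ D → P (D - e) → P D) → ∀ D → P D
subset-induction P base step D = go ∣ D ∣ D ℕₚ.≤-refl
  where
  go : ∀ s D → ∣ D ∣ ≤ s → P D
  go s D D≤s with nonempty? D
  ... | no ¬ne = subst P (sym (Empty-unique ¬ne)) base
  go zero D D≤s | yes (e , e∈D) =
    contradiction (≤-trans (x∈p⇒∣p-x∣<∣p∣ e∈D) D≤s) λ ()
  go (suc s) D D≤s | yes (e , e∈D) =
    step D e e∈D (go s (D - e) (ℕ.s≤s⁻¹ (≤-trans (x∈p⇒∣p-x∣<∣p∣ e∈D) D≤s)))

0<∣∣ : {p : Subset n} {a : Fin n} → a ∈ p → 1 ≤ ∣ p ∣
0<∣∣ {p = p} {a} a∈p = ≤-trans (s≤s z≤n) (x∈p⇒∣p-x∣<∣p∣ a∈p)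

1<∣∣ : {p : Subset n} {a b : Fin n} → a ≢ b → a ∈ p → b ∈ p → 2 ≤ ∣ p ∣
1<∣∣ {p = p} {a} {b} a≢b a∈p b∈p =
  ≤-trans (s≤s (0<∣∣ (∈--⁺ b∈p (a≢b ∘ sym)))) (x∈p⇒∣p-x∣<∣p∣ a∈p)

2<∣∣ : {p : Subset n} {a b c : Fin n} → a ≢ b → a ≢ c → b ≢ c →
       a ∈ p → b ∈ p → c ∈ p → 3 ≤ ∣ p ∣
2<∣∣ {p = p} {a} {b} {c} a≢b a≢c b≢c a∈p b∈p c∈p =
  ≤-trans (s≤s (1<∣∣ b≢c (∈--⁺ b∈p (a≢b ∘ sym))
                            (∈--⁺ c∈p (a≢c ∘ sym))))
             (x∈p⇒∣p-x∣<∣p∣ a∈p)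

0<∣∣⁻ : (p : Subset n) → 1 ≤ ∣ p ∣ → Nonempty p
0<∣∣⁻ {n} p 1≤ with nonempty? p
... | yes ne = ne
... | no ¬ne = contradiction (subst (λ q → 1 ≤ ∣ q ∣) (Empty-unique ¬ne) 1≤)
                             (λ 1≤0 → contradiction (subst (1 ≤_) (∣⊥∣≡0 n) 1≤0) λ ())

∣p∣≤1+∣p-x∣ : (p : Subset n) (x : Fin n) → ∣ p ∣ ≤ suc ∣ p - x ∣
∣p∣≤1+∣p-x∣ p x = begin
  ∣ p ∣               ≤⟨ p⊆q⇒∣p∣≤∣q∣ (⊆∪─ p ⁅ x ⁆) ⟩
  ∣ ⁅ x ⁆ ∪ (p - x) ∣ ≤⟨ ℕₚ.m≤m+n _ _ ⟩
  ∣ ⁅ x ⁆ ∪ (p - x) ∣ + ∣ ⁅ x ⁆ ∩ (p - x) ∣ ≡⟨ ∣∪∣+∣∩∣ ⁅ x ⁆ (p - x) ⟩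
  ∣ ⁅ x ⁆ ∣ + ∣ p - x ∣ ≡⟨ cong (_+ ∣ p - x ∣) (∣⁅x⁆∣≡1 x) ⟩
  suc ∣ p - x ∣ ∎
  where open ℕₚ.≤-Reasoning

∈-─⁻ : {p q : Subset n} {x : Fin n} → x ∈ p ─ q → x ∈ p × x ∉ q
∈-─⁻ {p = p} {q} x∈ = p─q⊆p p q x∈ , x∈p─q⇒x∉q p q x∈

∈--⁻ : {p : Subset n} {x y : Fin n} → x ∈ p - y → x ∈ p × y ≢ x
∈--⁻ {y = y} x∈ = proj₁ (∈-─⁻ x∈) , λ { refl → proj₂ (∈-─⁻ x∈) (x∈⁅x⁆ y) }

1<∣∣⁻ : (p : Subset n) → 2 ≤ ∣ p ∣ → Pair p
1<∣∣⁻ p 2≤ with 0<∣∣⁻ p (≤-trans (s≤s z≤n) 2≤)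
... | a , a∈p with 0<∣∣⁻ (p - a) (ℕ.s≤s⁻¹ (≤-trans 2≤ (∣p∣≤1+∣p-x∣ p a)))
... | b , b∈ = a , b , proj₂ (∈--⁻ b∈) , a∈p , proj₁ (∈--⁻ b∈)

2<∣∣⁻ : (p : Subset n) → 3 ≤ ∣ p ∣ → ∀ a → a ∈ p → PairBesides a p
2<∣∣⁻ p 3≤ a a∈p with 1<∣∣⁻ (p - a) (ℕ.s≤s⁻¹ (≤-trans 3≤ (∣p∣≤1+∣p-x∣ p a)))
... | b , c , b≢c , b∈ , c∈ =
  b , c , proj₂ (∈--⁻ b∈) , proj₂ (∈--⁻ c∈) , b≢c , proj₁ (∈--⁻ b∈) , proj₁ (∈--⁻ c∈)

-- The rank function and 3-connectivity.

module Rank {n} (M : Matroid n) where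

  ρ : Subset n → ℕ
  ρ = rk M

  ρ-mono : ∀ {X Y} → X ⊆ Y → ρ X ≤ ρ Y
  ρ-mono = rk-mono M

  ρ-cong : ∀ {X Y} → X ⊆ Y → Y ⊆ X → ρ X ≡ ρ Y
  ρ-cong X⊆Y Y⊆X = cong ρ (⊆-antisym X⊆Y Y⊆X)

  ρ-⊆E : ∀ {X} → X ⊆ E M → ρ X ≡ r M X
  ρ-⊆E {X} X⊆E = cong (r M) (⊆-antisym (p∩q⊆p X (E M)) (λ z → x∈p∩q⁺ (z , X⊆E z)))

  ρ-⊤ : ρ ⊤ ≡ r M (E M)
  ρ-⊤ = cong (r M) (∩-identityˡ (E M))

  ρ-∁ : ∀ X → ρ (∁ X) ≡ r M (E M ─ X)
  ρ-∁ X = cong (r M) (⊆-antisym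
    (sets (X ∷ E M ∷ []) (λ X E → [] ⊢ ~ X ⊓ E ⊑ E ∖ X) refl [])
    (sets (X ∷ E M ∷ []) (λ X E → [] ⊢ E ∖ X ⊑ ~ X ⊓ E) refl []))

  ρ-⁅⁆ : ∀ e → ρ ⁅ e ⁆ ≤ 1
  ρ-⁅⁆ e = ≤-trans (rk-≤-∣∣ M ⁅ e ⁆)
    (≤-trans (∣p∩q∣≤∣p∣ ⁅ e ⁆ (E M)) (≤-reflexive (∣⁅x⁆∣≡1 e)))

  ρ-∪⁅⁆ : ∀ X e → ρ (X ∪ ⁅ e ⁆) ≤ ρ X + 1
  ρ-∪⁅⁆ X e = estimate M (X ∷ ⁅ e ⁆ ∷ [])
    (λ X e → [] ∣ ϱ e ≼ # 1 ∷ [] by (X , e) ∷ [] ⊩ ϱ (X ⊔ e) ≼ ϱ X ⊕ # 1)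
    refl [] (ρ-⁅⁆ e ∷ [])

  -- Submodularity lets the elements of `D` join one at a time, each being spanned by `S` already.
  ρ-absorb : ∀ S D → (∀ {e} → e ∈ D → ρ (S ∪ ⁅ e ⁆) ≤ ρ S) → ρ (S ∪ D) ≤ ρ S
  ρ-absorb S = subset-induction (λ D → (∀ {e} → e ∈ D → ρ (S ∪ ⁅ e ⁆) ≤ ρ S) → ρ (S ∪ D) ≤ ρ S)
    (λ _ → ≤-reflexive (cong ρ (∪-identityʳ S)))
    (λ D e e∈D ih spanned → estimate M (S ∷ D ∷ ⁅ e ⁆ ∷ [])
      (λ S D e → e ⊑ D ∷ []
        ∣ ϱ (S ⊔ e) ≼ ϱ S ∷ ϱ (S ⊔ (D ∖ e)) ≼ ϱ S ∷ []
        by (S ⊔ e , S ⊔ (D ∖ e)) ∷ [] ⊩ ϱ (S ⊔ D) ≼ ϱ S)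
      refl (∈! e∈D ∷ []) (spanned e∈D ∷ ih (spanned ∘ p─q⊆p D ⁅ e ⁆) ∷ []))

  0<ρ⇒∃ : ∀ S → 1 ≤ ρ S → ∃ λ a → a ∈ S × a ∈ E M
  0<ρ⇒∃ S 1≤ with 0<∣∣⁻ (S ∩ E M) (≤-trans 1≤ (rk-≤-∣∣ M S))
  ... | a , a∈ = a , x∈p∩q⁻ S (E M) a∈

  Two : Subset n → Set
  Two S = ∃₂ λ a b → a ≢ b × (a ∈ S × a ∈ E M) × (b ∈ S × b ∈ E M)

  two-mono : ∀ {S S′} → S ⊆ S′ → Two S → Two S′
  two-mono s (a , b , a≢b , (a∈S , a∈E) , (b∈S , b∈E)) = a , b , a≢b , (s a∈S , a∈E) , (s b∈S , b∈E)

  1<ρ⇒∃ : ∀ S → 2 ≤ ρ S → Two S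
  1<ρ⇒∃ S 2≤ with 1<∣∣⁻ (S ∩ E M) (≤-trans 2≤ (rk-≤-∣∣ M S))
  ... | a , b , a≢b , a∈ , b∈ = a , b , a≢b , x∈p∩q⁻ S (E M) a∈ , x∈p∩q⁻ S (E M) b∈

  -- At `j = 0` submodularity contradicts the hypothesis; for positive `j` the truncated subtraction
  -- is harmless.
  conn-< : ∀ {X} j → X ⊆ E M → ρ X + ρ (∁ X) < ρ ⊤ + j → conn M X < j
  conn-< {X} zero X⊆E lt = contradiction (ℕₚ.≤-<-trans (estimate M (X ∷ [])
    (λ X → [] ∣ [] by (X , ~ X) ∷ [] ⊩ ϱ ● ⊕ # 0 ≼ ϱ X ⊕ ϱ (~ X)) refl [] []) lt) (ℕₚ.n≮n _)
  conn-< {X} (suc j) X⊆E lt = ℕₚ.m<n+o⇒m∸n<o (r M X + r M (E M ─ X)) (r M (E M))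
    (subst₂ _<_ (cong₂ _+_ (ρ-⊆E X⊆E) (ρ-∁ X)) (cong (_+ suc j) ρ-⊤) lt)

  <-conn : ∀ {X} j → X ⊆ E M → conn M X < j → ρ X + ρ (∁ X) < ρ ⊤ + j
  <-conn {X} j X⊆E lt = subst₂ _<_ (sym (cong₂ _+_ (ρ-⊆E X⊆E) (ρ-∁ X)))
    (cong (_+ j) (sym ρ-⊤))
    (ℕₚ.≤-<-trans (ℕₚ.m≤n+m∸n _ (r M (E M))) (ℕₚ.+-monoʳ-< (r M (E M)) lt))

-- Sizes of the sides are replaced by explicit elements on each side, so that `S` may be any subset
-- and complements can be taken in `Fin n`. Elements off the ground set have rank 0 and do not count
-- as witnesses.
record ThreeConnected (M : Matroid n) : Set where
  open Rank M
  field
    conn₁ : ∀ S {a c} → a ∈ E M → c ∈ E M → a ∈ S → c ∉ S → ρ ⊤ + 1 ≤ ρ S + ρ (∁ S)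
    conn₂ : ∀ S {a b c d} → a ∈ E M → b ∈ E M → c ∈ E M → d ∈ E M →
            a ≢ b → c ≢ d → a ∈ S → b ∈ S → c ∉ S → d ∉ S →
            ρ ⊤ + 2 ≤ ρ S + ρ (∁ S)

module _ (M : Matroid n) where

  open Rank M

  private
    trim : ∀ S → ρ (S ∩ E M) + ρ (∁ (S ∩ E M)) ≡ ρ S + ρ (∁ S)
    trim S = cong₂ _+_ (cong (r M) (⊆-antisym
        (sets (S ∷ E M ∷ []) (λ S E → [] ⊢ (S ⊓ E) ⊓ E ⊑ S ⊓ E) refl [])
        (sets (S ∷ E M ∷ []) (λ S E → [] ⊢ S ⊓ E ⊑ (S ⊓ E) ⊓ E) refl [])))
      (cong (r M) (⊆-antisym
        (sets (S ∷ E M ∷ []) (λ S E → [] ⊢ ~ (S ⊓ E) ⊓ E ⊑ ~ S ⊓ E) refl [])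
        (sets (S ∷ E M ∷ []) (λ S E → [] ⊢ ~ S ⊓ E ⊑ ~ (S ⊓ E) ⊓ E) refl [])))

    outside∈ : ∀ {S c} → c ∈ E M → c ∉ S → c ∈ E M ─ (S ∩ E M)
    outside∈ {S} c∈E c∉S = ∈-─⁺ c∈E (c∉S ∘ proj₁ ∘ x∈p∩q⁻ S (E M))

  fromConnected : Connected 3 M → ThreeConnected M
  fromConnected M3 = record
    { conn₁ = λ S a∈E c∈E a∈S c∉S → ≮⇒≥ λ lt →
        M3 (s≤s z≤n) (s≤s (s≤s z≤n))
          (s≤s z≤n , p∩q⊆q S (E M) , conn-< 1 (p∩q⊆q S (E M)) (subst (_< ρ ⊤ + 1) (sym (trim S)) lt) ,
           0<∣∣ (x∈p∩q⁺ (a∈S , a∈E)) , 0<∣∣ (outside∈ c∈E c∉S))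
    ; conn₂ = λ S a∈E b∈E c∈E d∈E a≢b c≢d a∈S b∈S c∉S d∉S → ≮⇒≥ λ lt →
        M3 (s≤s z≤n) (s≤s (s≤s (s≤s z≤n)))
          (s≤s z≤n , p∩q⊆q S (E M) , conn-< 2 (p∩q⊆q S (E M)) (subst (_< ρ ⊤ + 2) (sym (trim S)) lt) ,
           1<∣∣ a≢b (x∈p∩q⁺ (a∈S , a∈E)) (x∈p∩q⁺ (b∈S , b∈E)) ,
           1<∣∣ c≢d (outside∈ c∈E c∉S) (outside∈ d∈E d∉S))
    }

  toConnected : ThreeConnected M → Connected 3 M
  toConnected M3 {zero} ()
  toConnected M3 {1} {X} _ _ (_ , X⊆E , lt , 1≤X , 1≤Y)
    with 0<∣∣⁻ X 1≤X | 0<∣∣⁻ (E M ─ X) 1≤Y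
  ... | a , a∈X | c , c∈Y = <⇒≱ (<-conn 1 X⊆E lt)
    (ThreeConnected.conn₁ M3 X (X⊆E a∈X) (proj₁ (∈-─⁻ c∈Y)) a∈X (proj₂ (∈-─⁻ c∈Y)))
  toConnected M3 {2} {X} _ _ (_ , X⊆E , lt , 2≤X , 2≤Y)
    with 1<∣∣⁻ X 2≤X | 1<∣∣⁻ (E M ─ X) 2≤Y
  ... | a , b , a≢b , a∈X , b∈X | c , d , c≢d , c∈Y , d∈Y = <⇒≱ (<-conn 2 X⊆E lt)
    (ThreeConnected.conn₂ M3 X (X⊆E a∈X) (X⊆E b∈X) (proj₁ (∈-─⁻ c∈Y)) (proj₁ (∈-─⁻ d∈Y))
      a≢b c≢d a∈X b∈X (proj₂ (∈-─⁻ c∈Y)) (proj₂ (∈-─⁻ d∈Y)))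
  toConnected M3 {suc (suc (suc k))} _ (s≤s (s≤s (s≤s ())))

  Sep : Set
  Sep = Σ[ k ∈ ℕ ] Σ[ X ∈ Subset _ ] 1 ≤ k × k < 3 × Separation M k X

  separation? : ∀ k X → Dec (Separation M k X)
  separation? k X = (1 ℕ.≤? k) ×-dec (X ⊆? E M) ×-dec (conn M X ℕ.<? k)
    ×-dec (k ℕ.≤? ∣ X ∣) ×-dec (k ℕ.≤? ∣ E M ─ X ∣)

  -- The argument is constructive: a failure of 3-connectivity has to deliver an actual separation,
  -- and a search through all subsets provides it.
  connected₃? : Connected 3 M ⊎ Sep
  connected₃? = decide (anySubset? (separation? 1)) (anySubset? (separation? 2))
    where
    neither : ¬ ∃ (Separation M 1) → ¬ ∃ (Separation M 2) → Connected 3 M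
    neither ¬1 ¬2 {0} ()
    neither ¬1 ¬2 {1} {X} _ _ s = ¬1 (X , s)
    neither ¬1 ¬2 {2} {X} _ _ s = ¬2 (X , s)
    neither ¬1 ¬2 {suc (suc (suc _))} _ (s≤s (s≤s (s≤s ())))
    decide : Dec (∃ (Separation M 1)) → Dec (∃ (Separation M 2)) → Connected 3 M ⊎ Sep
    decide (yes (X , s)) _            = inj₂ (1 , X , s≤s z≤n , s≤s (s≤s z≤n) , s)
    decide (no _)        (yes (X , s)) = inj₂ (2 , X , s≤s z≤n , s≤s (s≤s (s≤s z≤n)) , s)
    decide (no ¬1)       (no ¬2)       = inj₁ (λ {k} {X} → neither ¬1 ¬2 {k} {X})

rk-/ : (M : Matroid n) (K S : Subset n) → rk (M / K) S + rk M K ≡ rk M (S ∪ K)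
rk-/ M K S = trans (cong (λ z → r M z ∸ rk M K + rk M K) eq)
  (ℕₚ.m∸n+n≡m (rk-mono M (q⊆p∪q S K)))
  where
  eq : (S ∩ (E M ─ K)) ∪ (K ∩ E M) ≡ (S ∪ K) ∩ E M
  eq = ⊆-antisym
    (sets (S ∷ K ∷ E M ∷ []) (λ S K E → [] ⊢ (S ⊓ (E ∖ K)) ⊔ (K ⊓ E) ⊑ (S ⊔ K) ⊓ E) refl [])
    (sets (S ∷ K ∷ E M ∷ []) (λ S K E → [] ⊢ (S ⊔ K) ⊓ E ⊑ (S ⊓ (E ∖ K)) ⊔ (K ⊓ E)) refl [])

rk-╲ : (M : Matroid n) (D S : Subset n) → rk (M ╲ D) S ≡ rk M (S ─ D)
rk-╲ M D S = cong (r M) (⊆-antisym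
  (sets (S ∷ D ∷ E M ∷ []) (λ S D E → [] ⊢ S ⊓ (E ∖ D) ⊑ (S ∖ D) ⊓ E) refl [])
  (sets (S ∷ D ∷ E M ∷ []) (λ S D E → [] ⊢ (S ∖ D) ⊓ E ⊑ S ⊓ (E ∖ D)) refl []))

∈-comprehension⁺ : {P : Fin n → Set} (P? : ∀ e → Dec (P e)) {e : Fin n} → P e → e ∈ comprehension P?
∈-comprehension⁺ P? {e} p = lookup⇒[]= e _ (trans (lookup∘tabulate (does ∘ P?) e) (dec-true (P? e) p))

∈-comprehension⁻ : {P : Fin n → Set} (P? : ∀ e → Dec (P e)) {e : Fin n} → e ∈ comprehension P? → P e
∈-comprehension⁻ P? {e} e∈ with P? e | trans (sym (lookup∘tabulate (does ∘ P?) e)) ([]=⇒lookup e∈)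
... | yes p | _  = p
... | no _  | ()

PairOff : Fin n → Fin n → Subset n → Set
PairOff a b p = ∃₂ λ c d → c ≢ d × c ∈ p × d ∈ p × a ≢ c × a ≢ d × b ≢ c × b ≢ d

others : (p : Subset n) → 4 ≤ ∣ p ∣ → ∀ a b → PairOff a b p
others p 4≤ a b =
  let c , d , c≢d , c∈ , d∈ = 1<∣∣⁻ ((p - a) - b) (ℕ.s≤s⁻¹ (ℕ.s≤s⁻¹ (≤-trans 4≤
        (≤-trans (∣p∣≤1+∣p-x∣ p a) (s≤s (∣p∣≤1+∣p-x∣ (p - a) b))))))
      c∈′ , b≢c = ∈--⁻ c∈ ; d∈′ , b≢d = ∈--⁻ d∈
      c∈p , a≢c = ∈--⁻ c∈′ ; d∈p , a≢d = ∈--⁻ d∈′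
  in  c , d , c≢d , c∈p , d∈p , a≢c , a≢d , b≢c , b≢d

∉-pair : {a b c : Fin n} → a ≢ c → b ≢ c → c ∉ ⁅ a ⁆ ∪ ⁅ b ⁆
∉-pair {a = a} {b} a≢c b≢c c∈ with x∈p∪q⁻ ⁅ a ⁆ ⁅ b ⁆ c∈
... | inj₁ c∈a = a≢c (sym (x∈⁅y⁆⇒x≡y a c∈a))
... | inj₂ c∈b = b≢c (sym (x∈⁅y⁆⇒x≡y b c∈b))

-- With at least four elements a singleton or a pair leaves two elements outside, so the
-- connectivity bounds exclude loops, coloops, parallel pairs and series pairs.
module Simple (M : Matroid n) (M3 : ThreeConnected M) (4≤∣E∣ : 4 ≤ ∣ E M ∣) where

  open Rank M
  open ThreeConnected M3

  0<ρ⁅⁆ : ∀ {e} → e ∈ E M → 1 ≤ ρ ⁅ e ⁆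
  0<ρ⁅⁆ {e} e∈E = let c , _ , _ , c∈E , _ , e≢c , _ = others (E M) 4≤∣E∣ e e in estimate M (⁅ e ⁆ ∷ [])
    (λ e → [] ∣ ϱ ● ⊕ # 1 ≼ ϱ e ⊕ ϱ (~ e) ∷ [] by [] ⊩ # 1 ≼ ϱ e)
    refl [] (conn₁ ⁅ e ⁆ e∈E c∈E (x∈⁅x⁆ e) (x≢y⇒x∉⁅y⁆ (e≢c ∘ sym)) ∷ [])

  ρ∁⁅⁆ : ∀ {e} → e ∈ E M → ρ ⊤ ≤ ρ (∁ ⁅ e ⁆)
  ρ∁⁅⁆ {e} e∈E = let c , _ , _ , c∈E , _ , e≢c , _ = others (E M) 4≤∣E∣ e e in estimate M (⁅ e ⁆ ∷ [])
    (λ e → [] ∣ ϱ ● ⊕ # 1 ≼ ϱ e ⊕ ϱ (~ e) ∷ ϱ e ≼ # 1 ∷ [] by [] ⊩ ϱ ● ≼ ϱ (~ e))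
    refl [] (conn₁ ⁅ e ⁆ e∈E c∈E (x∈⁅x⁆ e) (x≢y⇒x∉⁅y⁆ (e≢c ∘ sym)) ∷ ρ-⁅⁆ e ∷ [])

  pair-conn : ∀ {e f} → e ∈ E M → f ∈ E M → e ≢ f →
              ρ ⊤ + 2 ≤ ρ (⁅ e ⁆ ∪ ⁅ f ⁆) + ρ (∁ (⁅ e ⁆ ∪ ⁅ f ⁆))
  pair-conn {e} {f} e∈E f∈E e≢f =
    let c , d , c≢d , c∈E , d∈E , e≢c , e≢d , f≢c , f≢d = others (E M) 4≤∣E∣ e f in
    conn₂ (⁅ e ⁆ ∪ ⁅ f ⁆) e∈E f∈E c∈E d∈E e≢f c≢d
      (p⊆p∪q ⁅ f ⁆ (x∈⁅x⁆ e)) (q⊆p∪q ⁅ e ⁆ ⁅ f ⁆ (x∈⁅x⁆ f)) (∉-pair e≢c f≢c) (∉-pair e≢d f≢d)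

  1<ρ-pair : ∀ {e f} → e ∈ E M → f ∈ E M → e ≢ f → 2 ≤ ρ (⁅ e ⁆ ∪ ⁅ f ⁆)
  1<ρ-pair {e} {f} e∈E f∈E e≢f = estimate M (⁅ e ⁆ ∷ ⁅ f ⁆ ∷ [])
    (λ e f → [] ∣ ϱ ● ⊕ # 2 ≼ ϱ (e ⊔ f) ⊕ ϱ (~ (e ⊔ f)) ∷ [] by [] ⊩ # 2 ≼ ϱ (e ⊔ f))
    refl [] (pair-conn e∈E f∈E e≢f ∷ [])

  ρ∁-pair : ∀ {e f} → e ∈ E M → f ∈ E M → e ≢ f → ρ ⊤ ≤ ρ (∁ (⁅ e ⁆ ∪ ⁅ f ⁆))
  ρ∁-pair {e} {f} e∈E f∈E e≢f = estimate M (⁅ e ⁆ ∷ ⁅ f ⁆ ∷ [])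
    (λ e f → [] ∣ ϱ ● ⊕ # 2 ≼ ϱ (e ⊔ f) ⊕ ϱ (~ (e ⊔ f)) ∷ ϱ e ≼ # 1 ∷ ϱ f ≼ # 1 ∷ []
      by (e , f) ∷ [] ⊩ ϱ ● ≼ ϱ (~ (e ⊔ f)))
    refl [] (pair-conn e∈E f∈E e≢f ∷ ρ-⁅⁆ e ∷ ρ-⁅⁆ f ∷ [])

  1<ρ : ∀ {e f} S → e ∈ E M → f ∈ E M → e ≢ f → e ∈ S → f ∈ S → 2 ≤ ρ S
  1<ρ S e∈E f∈E e≢f e∈S f∈S = ≤-trans (1<ρ-pair e∈E f∈E e≢f) (ρ-mono (∪-⊆ (∈! e∈S) (∈! f∈S)))

-- Copies of a minor inside a matroid.

image : (Fin m → Fin n) → Subset m → Subset n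
image f Y = comprehension λ e → Finₚ.any? λ i → (i ∈? Y) ×-dec (f i ≟ᶠ e)

∈-image⁺ : (f : Fin m → Fin n) {Y : Subset m} {i : Fin m} → i ∈ Y → f i ∈ image f Y
∈-image⁺ f {Y} {i} i∈Y = ∈-comprehension⁺ (λ e → Finₚ.any? λ i → (i ∈? Y) ×-dec (f i ≟ᶠ e)) (i , i∈Y , refl)

∈-image⁻ : (f : Fin m → Fin n) (Y : Subset m) {e : Fin n} → e ∈ image f Y → ∃ λ i → i ∈ Y × f i ≡ e
∈-image⁻ f Y = ∈-comprehension⁻ (λ e → Finₚ.any? λ i → (i ∈? Y) ×-dec (f i ≟ᶠ e))

image-⊆ : (f : Fin m → Fin n) (Y : Subset m) {p : Subset n} → (∀ {i} → i ∈ Y → f i ∈ p) → image f Y ⊆ p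
image-⊆ f Y h e∈ with ∈-image⁻ f Y e∈
... | i , i∈Y , refl = h i∈Y

image-⁅⁆ : (f : Fin m → Fin n) (i : Fin m) → image f ⁅ i ⁆ ≡ ⁅ f i ⁆
image-⁅⁆ f i = ⊆-antisym
  (image-⊆ f ⁅ i ⁆ λ j∈ → subst (λ j → f j ∈ ⁅ f i ⁆) (sym (x∈⁅y⁆⇒x≡y i j∈)) (x∈⁅x⁆ (f i)))
  (∈! (∈-image⁺ f (x∈⁅x⁆ i)))

∃∈-≡ : {p : Subset n} {a b : ∃ λ x → x ∈ p} → proj₁ a ≡ proj₁ b → a ≡ b
∃∈-≡ {a = a , u} {.a , v} refl = cong (a ,_) ([]=-irrelevant u v)

-- A minor of M isomorphic to N: the elements outside C and the image of f are
-- the deleted ones.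

record Embedding (M : Matroid n) (N : Matroid m) : Set where
  field
    f     : Fin m → Fin n
    C     : Subset n
    C⊆E   : C ⊆ E M
    f∈E   : ∀ {i} → i ∈ E N → f i ∈ E M
    f∉C   : ∀ {i} → i ∈ E N → f i ∉ C
    f-inj : ∀ {i j} → i ∈ E N → j ∈ E N → f i ≡ f j → i ≡ j
    rank  : ∀ {Y} → Y ⊆ E N → rk M (image f Y ∪ C) ≡ r N Y + rk M C

module _ {M : Matroid n} {N : Matroid m} where

  -- This depends on the chosen copy of N, so a change of copy in the course of the descent has to
  -- carry it along.
  Small : Embedding M N → Subset n → Set
  Small e X = ∀ {i j} → i ∈ E N → j ∈ E N → f i ∈ X → f j ∈ X → i ≡ j
    where open Embedding e

  -- The element `d` is the value of `f` outside `E N`, where nothing is required of it.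
  hasMinor⇒embedding : Fin n → M HasMinor N → Embedding M N
  hasMinor⇒embedding d (C , D , C⊆E , D⊆E , disj , φ , iso) = record
    { f = f ; C = C ; C⊆E = C⊆E
    ; f∈E = λ i∈ → proj₁ (∈-─⁻ (proj₁ (∈-─⁻ (f∈ i∈))))
    ; f∉C = λ i∈ → proj₂ (∈-─⁻ (proj₁ (∈-─⁻ (f∈ i∈))))
    ; f-inj = λ i∈ j∈ eq → f-injective i∈ j∈ eq
    ; rank = λ {Y} Y⊆ → trans (sym (rk-/ M C (image f Y))) (cong (_+ rk M C) (rank-image Y⊆)) }
    where
    Q = M / C ╲ D
    fd : ∀ {i} → Dec (i ∈ E N) → Fin n
    fd {i} (yes p) = proj₁ (Inverse.from φ (i , p))
    fd (no _)      = d
    f : Fin _ → Fin _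
    f i = fd (i ∈? E N)
    f-from : ∀ {i} (p : i ∈ E N) → f i ≡ proj₁ (Inverse.from φ (i , p))
    f-from {i} p with i ∈? E N
    ... | yes p′ = cong (λ z → proj₁ (Inverse.from φ (i , z))) ([]=-irrelevant p′ p)
    ... | no ¬p  = contradiction p ¬p
    f∈ : ∀ {i} → i ∈ E N → f i ∈ E Q
    f∈ {i} p = subst (_∈ E Q) (sym (f-from p)) (proj₂ (Inverse.from φ (i , p)))
    to-f : ∀ {i} (p : i ∈ E N) (q : f i ∈ E Q) → proj₁ (Inverse.to φ (f i , q)) ≡ i
    to-f {i} p q = trans (cong (λ z → proj₁ (Inverse.to φ z)) (∃∈-≡ {a = _ , q} (f-from p)))
                         (cong proj₁ (Inverse.inverseˡ φ {i , p} refl))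
    f-injective : ∀ {i j} → i ∈ E N → j ∈ E N → f i ≡ f j → i ≡ j
    f-injective {i} {j} i∈ j∈ eq = trans (sym (to-f i∈ (f∈ i∈)))
      (trans (go (f∈ i∈) (f∈ j∈) eq) (to-f j∈ (f∈ j∈)))
      where
      go : ∀ {a b} (p : a ∈ E Q) (q : b ∈ E Q) → a ≡ b →
           proj₁ (Inverse.to φ (a , p)) ≡ proj₁ (Inverse.to φ (b , q))
      go p q refl = cong (λ z → proj₁ (Inverse.to φ (_ , z))) ([]=-irrelevant p q)
    rank-image : ∀ {Y} → Y ⊆ E N → rk (M / C) (image f Y) ≡ r N Y
    rank-image {Y} Y⊆ = trans (Rank.ρ-⊆E (M / C) (proj₁ ∘ ∈-─⁻ ∘ image⊆))
      (iso image⊆ Y⊆ λ e → mk⇔ (λ e∈ → fwd e (∈-image⁻ f Y e∈)) (λ e∈ → bwd e e∈))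
      where
      image⊆ : image f Y ⊆ E Q
      image⊆ = image-⊆ f Y (f∈ ∘ Y⊆)
      fwd : ∀ e → (∃ λ i → i ∈ Y × f i ≡ proj₁ e) → proj₁ (Inverse.to φ e) ∈ Y
      fwd (e , p) (i , i∈Y , refl) = subst (_∈ Y) (sym (to-f (Y⊆ i∈Y) p)) i∈Y
      bwd : ∀ e → proj₁ (Inverse.to φ e) ∈ Y → proj₁ e ∈ image f Y
      bwd e i∈Y = subst (_∈ image f Y)
        (trans (f-from (proj₂ (Inverse.to φ e))) (cong proj₁ (Inverse.inverseʳ φ {e} refl)))
        (∈-image⁺ f i∈Y)

  embedding⇒hasMinor : Embedding M N → M HasMinor N
  embedding⇒hasMinor e = C , D , C⊆E , (λ x∈ → proj₁ (∈-─⁻ (proj₁ (∈-─⁻ x∈)))) ,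
    (λ { (x , x∈) → let x∈C , x∈D = x∈p∩q⁻ C D x∈ in proj₂ (∈-─⁻ (proj₁ (∈-─⁻ x∈D))) x∈C }) ,
    mk↔ₛ′ to from to-from from-to , λ {X} {Y} X⊆ Y⊆ X⇔Y → iso X⊆ Y⊆ X⇔Y
    where
    open Embedding e
    F = image f (E N)
    D = E M ─ C ─ F
    Q = M / C ╲ D
    F⊆ : F ⊆ E Q
    F⊆ x∈F = ∈-─⁺ (image-⊆ f (E N) (λ i∈ → ∈-─⁺ (f∈E i∈) (f∉C i∈)) x∈F)
      (λ x∈D → proj₂ (∈-─⁻ x∈D) x∈F)
    ⊆F : E Q ⊆ F
    ⊆F = sets (E M ∷ C ∷ F ∷ [])
      (λ E C F → [] ⊢ (E ∖ C) ∖ ((E ∖ C) ∖ F) ⊑ F) refl []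
    to : Element Q → Element N
    to (x , x∈) = let i , i∈ , _ = ∈-image⁻ f (E N) (⊆F x∈) in i , i∈
    f-to : ∀ z → f (proj₁ (to z)) ≡ proj₁ z
    f-to (x , x∈) = proj₂ (proj₂ (∈-image⁻ f (E N) (⊆F x∈)))
    from : Element N → Element Q
    from (i , i∈) = f i , F⊆ (∈-image⁺ f i∈)
    to-from : ∀ z → to (from z) ≡ z
    to-from z = ∃∈-≡ (f-inj (proj₂ (to (from z))) (proj₂ z) (f-to (from z)))
    from-to : ∀ z → from (to z) ≡ z
    from-to z = ∃∈-≡ (f-to z)
    iso : ∀ {X Y} → X ⊆ E Q → Y ⊆ E N → (∀ z → proj₁ z ∈ X ⇔ proj₁ (to z) ∈ Y) → r Q X ≡ r N Y
    iso {X} {Y} X⊆ Y⊆ X⇔Y = ℕₚ.+-cancelʳ-≡ (rk M C) _ _ (begin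
      r (M / C) X + rk M C   ≡⟨ cong (_+ rk M C) (sym (Rank.ρ-⊆E (M / C) (proj₁ ∘ ∈-─⁻ ∘ X⊆))) ⟩
      rk (M / C) X + rk M C  ≡⟨ rk-/ M C X ⟩
      rk M (X ∪ C)           ≡⟨ cong (λ z → rk M (z ∪ C)) X≡ ⟩
      rk M (image f Y ∪ C)   ≡⟨ rank Y⊆ ⟩
      r N Y + rk M C ∎)
      where
      open ≡-Reasoning
      X≡ : X ≡ image f Y
      X≡ = ⊆-antisym
        (λ x∈X → subst (_∈ image f Y) (f-to (_ , X⊆ x∈X))
          (∈-image⁺ f (Equivalence.to (X⇔Y (_ , X⊆ x∈X)) x∈X)))
        (image-⊆ f Y (λ {i} i∈Y → Equivalence.from (X⇔Y (from (i , Y⊆ i∈Y)))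
          (subst (_∈ Y) (sym (cong proj₁ (to-from (i , Y⊆ i∈Y)))) i∈Y)))

lift-/ : {M : Matroid n} {N : Matroid m} {K : Subset n} → K ⊆ E M → Embedding (M / K) N →
         Σ[ e ∈ Embedding M N ] K ⊆ Embedding.C e
lift-/ {M = M} {N} {K} K⊆E e = record
  { f = f ; C = C ∪ K ; C⊆E = ∪-⊆ (proj₁ ∘ ∈-─⁻ ∘ C⊆E) K⊆E
  ; f∈E = proj₁ ∘ ∈-─⁻ ∘ f∈E
  ; f∉C = λ i∈ → [ f∉C i∈ , proj₂ (∈-─⁻ (f∈E i∈)) ]′ ∘ x∈p∪q⁻ C K
  ; f-inj = f-inj
  ; rank = λ {Y} Y⊆ → begin
      rk M (image f Y ∪ (C ∪ K))             ≡⟨ cong (rk M) (sym (∪-assoc (image f Y) C K)) ⟩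
      rk M ((image f Y ∪ C) ∪ K)             ≡⟨ sym (rk-/ M K (image f Y ∪ C)) ⟩
      rk (M / K) (image f Y ∪ C) + rk M K    ≡⟨ cong (_+ rk M K) (rank Y⊆) ⟩
      (r N Y + rk (M / K) C) + rk M K        ≡⟨ +-assoc (r N Y) _ _ ⟩
      r N Y + (rk (M / K) C + rk M K)        ≡⟨ cong (r N Y +_) (rk-/ M K C) ⟩
      r N Y + rk M (C ∪ K) ∎
  } , q⊆p∪q C K
  where
  open Embedding e
  open ≡-Reasoning

lower-/ : {M : Matroid n} {N : Matroid m} {K : Subset n} (e : Embedding M N) →
          K ⊆ Embedding.C e → Embedding (M / K) N
lower-/ {M = M} {N} {K} e K⊆C = record
  { f = f ; C = C ─ K
  ; C⊆E = λ x∈ → ∈-─⁺ (C⊆E (proj₁ (∈-─⁻ x∈))) (proj₂ (∈-─⁻ x∈))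
  ; f∈E = λ i∈ → ∈-─⁺ (f∈E i∈) (f∉C i∈ ∘ K⊆C)
  ; f∉C = λ i∈ → f∉C i∈ ∘ proj₁ ∘ ∈-─⁻
  ; f-inj = f-inj
  ; rank = λ {Y} Y⊆ → ℕₚ.+-cancelʳ-≡ (rk M K) _ _ (begin
      rk (M / K) (image f Y ∪ (C ─ K)) + rk M K ≡⟨ rk-/ M K _ ⟩
      rk M ((image f Y ∪ (C ─ K)) ∪ K)          ≡⟨ Rank.ρ-cong M
          (sets (image f Y ∷ C ∷ K ∷ []) (λ F C K → K ⊑ C ∷ [] ⊢ (F ⊔ (C ∖ K)) ⊔ K ⊑ F ⊔ C) refl (K⊆C ∷ []))
          (sets (image f Y ∷ C ∷ K ∷ []) (λ F C K → K ⊑ C ∷ [] ⊢ F ⊔ C ⊑ (F ⊔ (C ∖ K)) ⊔ K) refl (K⊆C ∷ [])) ⟩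
      rk M (image f Y ∪ C)                      ≡⟨ rank Y⊆ ⟩
      r N Y + rk M C                            ≡⟨ cong (r N Y +_) (Rank.ρ-cong M
          (sets (C ∷ K ∷ []) (λ C K → [] ⊢ C ⊑ (C ∖ K) ⊔ K) refl [])
          (sets (C ∷ K ∷ []) (λ C K → K ⊑ C ∷ [] ⊢ (C ∖ K) ⊔ K ⊑ C) refl (K⊆C ∷ []))) ⟩
      r N Y + rk M ((C ─ K) ∪ K)                ≡⟨ cong (r N Y +_) (sym (rk-/ M K (C ─ K))) ⟩
      r N Y + (rk (M / K) (C ─ K) + rk M K)     ≡⟨ sym (+-assoc (r N Y) _ _) ⟩
      (r N Y + rk (M / K) (C ─ K)) + rk M K ∎)
  }
  where
  open Embedding e
  open ≡-Reasoning

-- Exchanging parts of a minor across a 2-separation.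

FlipPoint : (Subset n → Set) → Subset n → Subset n → Set
FlipPoint P X A₀ = ∃₂ λ A p → A₀ ⊆ A × A ⊆ X × p ∈ X × p ∉ A × P A × ¬ P (A ∪ ⁅ p ⁆)

-- A discrete intermediate value argument: elements of `X` join `A₀` one by one until `P` first
-- fails. The number of elements still to be added serves as fuel.
flip-point : {P : Subset n → Set} (P? : ∀ A → Dec (P A)) (X A₀ : Subset n) → A₀ ⊆ X → P A₀ → ¬ P X → FlipPoint P X A₀
flip-point {P = P} P? X A₀ A₀⊆X PA₀ ¬PX = go ∣ X ─ A₀ ∣ A₀ ℕₚ.≤-refl id A₀⊆X PA₀
  where
  go : ∀ s A → ∣ X ─ A ∣ ≤ s → A₀ ⊆ A → A ⊆ X → P A → FlipPoint P X A₀
  go s A X─A≤s A₀⊆A A⊆X PA with nonempty? (X ─ A)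
  ... | no ¬ne = contradiction (subst P (⊆-antisym A⊆X X⊆A) PA) ¬PX
    where
    X⊆A : X ⊆ A
    X⊆A {z} z∈X with z ∈? A
    ... | yes z∈A = z∈A
    ... | no  z∉A = contradiction (z , ∈-─⁺ z∈X z∉A) ¬ne
  ... | yes (p , p∈) with P? (A ∪ ⁅ p ⁆) | s
  ... | no ¬PAp | _ = A , p , A₀⊆A , A⊆X , proj₁ (∈-─⁻ p∈) , proj₂ (∈-─⁻ p∈) , PA , ¬PAp
  ... | yes PAp | zero  = contradiction (≤-trans (0<∣∣ p∈) X─A≤s) λ ()
  ... | yes PAp | suc s = go s (A ∪ ⁅ p ⁆) smaller (p⊆p∪q ⁅ p ⁆ ∘ A₀⊆A)
    (∪-⊆ A⊆X (∈! (proj₁ (∈-─⁻ p∈)))) PAp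
    where
    smaller : ∣ X ─ (A ∪ ⁅ p ⁆) ∣ ≤ s
    smaller = ℕ.s≤s⁻¹ (≤-trans (s≤s (p⊆q⇒∣p∣≤∣q∣
        (sets (X ∷ A ∷ ⁅ p ⁆ ∷ []) (λ X A p → [] ⊢ X ∖ (A ⊔ p) ⊑ (X ∖ A) ∖ p) refl [])))
      (≤-trans (x∈p⇒∣p-x∣<∣p∣ p∈) X─A≤s))

-- Let (X , ∁ X) be a 2-separation of M / x, where x ∉ X.  The rank of A ∪ B, for
-- A ⊆ X and x ∈ B ⊆ ∁ X, depends on B only through whether A spans the
-- point common to both sides; A avoids that point if Apart A.

module TwoSum {n} (M : Matroid n) (X : Subset n) (x : Fin n) (x∉X : x ∉ X)
  (0<ρx : 1 ≤ rk M ⁅ x ⁆) (sep : rk M (X ∪ ⁅ x ⁆) + rk M (∁ X) ≤ rk M ⊤ + 2) where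

  open Rank M

  Z : Subset n
  Z = ∁ X

  -- In M / x this says that `A` and `Z` are skew, that is, of local connectivity 0: each of the
  -- ranks of `A ∪ ⁅ x ⁆`, `Z` and `A ∪ Z` is one more than the rank in M / x, whence the `+ 1`.
  -- `Meets` is local connectivity at least 1.
  Apart : Subset n → Set
  Apart A = ρ (A ∪ ⁅ x ⁆) + ρ Z ≤ ρ (A ∪ Z) + 1

  apart? : ∀ A → Dec (Apart A)
  apart? A = ρ (A ∪ ⁅ x ⁆) + ρ Z ℕ.≤? ρ (A ∪ Z) + 1

  Meets : Subset n → Set
  Meets A = ρ (A ∪ Z) + 2 ≤ ρ (A ∪ ⁅ x ⁆) + ρ Z

  ¬apart⇒meets : ∀ {A} → ¬ Apart A → Meets A
  ¬apart⇒meets {A} ¬a = ≤-trans (≤-reflexive (ℕₚ.+-suc (ρ (A ∪ Z)) 1)) (≰⇒> ¬a)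

  apart-mono : ∀ {A A′} → A ⊆ A′ → Apart A′ → Apart A
  apart-mono {A} {A′} A⊆A′ a = estimate M (A ∷ A′ ∷ X ∷ ⁅ x ⁆ ∷ [])
    (λ A A′ X x → A ⊑ A′ ∷ x ⊑ ~ X ∷ []
      ∣ ϱ (A′ ⊔ x) ⊕ ϱ (~ X) ≼ ϱ (A′ ⊔ ~ X) ⊕ # 1 ∷ [] by (A ⊔ ~ X , A′ ⊔ x) ∷ []
      ⊩ ϱ (A ⊔ x) ⊕ ϱ (~ X) ≼ ϱ (A ⊔ ~ X) ⊕ # 1)
    refl (A⊆A′ ∷ ∉! x∉X ∷ []) (a ∷ [])

  module _ {A A′ B B₀ : Subset n} (A⊆X : A ⊆ X) (A′⊆X : A′ ⊆ X)
           (B⊆Z : B ⊆ Z) (B₀⊆Z : B₀ ⊆ Z) (x∈B : x ∈ B) (x∈B₀ : x ∈ B₀) where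

    -- A set skew to `Z` in M / x is skew to every part of `Z`, so it contributes the same amount
    -- over `B` as over `B₀`. In the applications `B₀` is the contracted part of `Z`, and
    -- differences over it are ranks in the minor.
    exchange-apart : Apart A → Apart A′ → ρ (A′ ∪ B) + ρ (A ∪ B₀) ≤ ρ (A ∪ B) + ρ (A′ ∪ B₀)
    exchange-apart a a′ = estimate M (A ∷ A′ ∷ B ∷ B₀ ∷ X ∷ ⁅ x ⁆ ∷ [])
      (λ A A′ B B₀ X x → A ⊑ X ∷ A′ ⊑ X ∷ B ⊑ ~ X ∷ B₀ ⊑ ~ X ∷ x ⊑ B ∷ x ⊑ B₀ ∷ []
        ∣ # 1 ≼ ϱ x ∷ # 1 ≼ ϱ x
        ∷ ϱ (A ⊔ x) ⊕ ϱ (~ X) ≼ ϱ (A ⊔ ~ X) ⊕ # 1 ∷ ϱ (A′ ⊔ x) ⊕ ϱ (~ X) ≼ ϱ (A′ ⊔ ~ X) ⊕ # 1 ∷ []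
        by (A′ ⊔ x , B) ∷ (A ⊔ x , B₀) ∷ (A ⊔ B , ~ X) ∷ (A′ ⊔ B₀ , ~ X) ∷ []
        ⊩ ϱ (A′ ⊔ B) ⊕ ϱ (A ⊔ B₀) ≼ ϱ (A ⊔ B) ⊕ ϱ (A′ ⊔ B₀))
      refl (A⊆X ∷ A′⊆X ∷ B⊆Z ∷ B₀⊆Z ∷ ∈! x∈B ∷ ∈! x∈B₀ ∷ []) (0<ρx ∷ 0<ρx ∷ a ∷ a′ ∷ [])

    -- In M / x such a set acts on the subsets of `Z` as if the basepoint of the 2-sum were
    -- contracted, so all sets of this type give the same differences.
    exchange-meets : Meets A → Meets A′ → ρ (A′ ∪ B) + ρ (A ∪ B₀) ≤ ρ (A ∪ B) + ρ (A′ ∪ B₀)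
    exchange-meets a a′ = estimate M (A ∷ A′ ∷ B ∷ B₀ ∷ X ∷ ⁅ x ⁆ ∷ [])
      (λ A A′ B B₀ X x → A ⊑ X ∷ A′ ⊑ X ∷ B ⊑ ~ X ∷ B₀ ⊑ ~ X ∷ x ⊑ B ∷ x ⊑ B₀ ∷ []
        ∣ ϱ (A ⊔ ~ X) ⊕ # 2 ≼ ϱ (A ⊔ x) ⊕ ϱ (~ X) ∷ ϱ (A′ ⊔ ~ X) ⊕ # 2 ≼ ϱ (A′ ⊔ x) ⊕ ϱ (~ X)
        ∷ ϱ (X ⊔ x) ⊕ ϱ (~ X) ≼ ϱ ● ⊕ # 2 ∷ ϱ (X ⊔ x) ⊕ ϱ (~ X) ≼ ϱ ● ⊕ # 2 ∷ []
        by (A′ ⊔ ~ X , X ⊔ B) ∷ (A ⊔ B , X ⊔ x) ∷ (A ⊔ ~ X , X ⊔ B₀) ∷ (A′ ⊔ B₀ , X ⊔ x) ∷ []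
        ⊩ ϱ (A′ ⊔ B) ⊕ ϱ (A ⊔ B₀) ≼ ϱ (A ⊔ B) ⊕ ϱ (A′ ⊔ B₀))
      refl (A⊆X ∷ A′⊆X ∷ B⊆Z ∷ B₀⊆Z ∷ ∈! x∈B ∷ ∈! x∈B₀ ∷ []) (a ∷ a′ ∷ sep ∷ sep ∷ [])

    -- When `A` avoids the basepoint of the 2-sum and `A ∪ ⁅ p ⁆` spans it, contracting `A` makes
    -- `p` parallel to the basepoint. Two pairs `A , p` and `A′ , p′` of this kind are therefore
    -- interchangeable.
    exchange-flip : ∀ {p p′} → p ∈ X → p′ ∈ X → Apart A → Meets (A ∪ ⁅ p ⁆) →
                    Apart A′ → Meets (A′ ∪ ⁅ p′ ⁆) →
                    ρ ((A′ ∪ ⁅ p′ ⁆) ∪ B) + ρ (A ∪ B₀) ≤ ρ ((A ∪ ⁅ p ⁆) ∪ B) + ρ (A′ ∪ B₀)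
    exchange-flip {p} {p′} p∈X p′∈X a m a′ m′ = estimate M (A ∷ A′ ∷ B ∷ B₀ ∷ X ∷ ⁅ x ⁆ ∷ ⁅ p ⁆ ∷ ⁅ p′ ⁆ ∷ [])
      (λ A A′ B B₀ X x p p′ → A ⊑ X ∷ A′ ⊑ X ∷ B ⊑ ~ X ∷ B₀ ⊑ ~ X ∷ x ⊑ B ∷ x ⊑ B₀ ∷ p ⊑ X ∷ p′ ⊑ X ∷ []
        ∣ # 1 ≼ ϱ x ∷ ϱ p′ ≼ # 1 ∷ ϱ (X ⊔ x) ⊕ ϱ (~ X) ≼ ϱ ● ⊕ # 2
        ∷ ϱ (A ⊔ x) ⊕ ϱ (~ X) ≼ ϱ (A ⊔ ~ X) ⊕ # 1 ∷ ϱ (A′ ⊔ x) ⊕ ϱ (~ X) ≼ ϱ (A′ ⊔ ~ X) ⊕ # 1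
        ∷ ϱ ((A ⊔ p) ⊔ ~ X) ⊕ # 2 ≼ ϱ ((A ⊔ p) ⊔ x) ⊕ ϱ (~ X)
        ∷ ϱ ((A′ ⊔ p′) ⊔ ~ X) ⊕ # 2 ≼ ϱ ((A′ ⊔ p′) ⊔ x) ⊕ ϱ (~ X) ∷ []
        by ((A′ ⊔ p′) ⊔ ~ X , X ⊔ B) ∷ ((A ⊔ p) ⊔ B , X ⊔ x) ∷ (A ⊔ x , B₀) ∷ (A′ ⊔ B₀ , ~ X)
           ∷ (A′ ⊔ x , p′) ∷ []
        ⊩ ϱ ((A′ ⊔ p′) ⊔ B) ⊕ ϱ (A ⊔ B₀) ≼ ϱ ((A ⊔ p) ⊔ B) ⊕ ϱ (A′ ⊔ B₀))
      refl (A⊆X ∷ A′⊆X ∷ B⊆Z ∷ B₀⊆Z ∷ ∈! x∈B ∷ ∈! x∈B₀ ∷ ∈! p∈X ∷ ∈! p′∈X ∷ [])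
      (0<ρx ∷ ρ-⁅⁆ p′ ∷ sep ∷ a ∷ a′ ∷ m ∷ m′ ∷ [])

  -- An element p of X with A ∪ p of the same type as A would be a coloop of the minor.

  no-coloop : ∀ {A B p} → A ⊆ X → B ⊆ Z → x ∈ B → p ∈ X →
              ρ ((A ∪ ⁅ p ⁆) ∪ B) ≤ ρ (A ∪ B) → 1 + ρ (A ∪ ⁅ x ⁆) ≤ ρ ((A ∪ ⁅ p ⁆) ∪ ⁅ x ⁆) →
              Apart A × ¬ Apart (A ∪ ⁅ p ⁆)
  no-coloop {A} {B} {p} A⊆X B⊆Z x∈B p∈X col indep with apart? (A ∪ ⁅ p ⁆) | apart? A
  ... | no ¬ap | yes a = a , ¬ap
  ... | yes ap | _ = contradiction (estimate M (A ∷ B ∷ X ∷ ⁅ x ⁆ ∷ ⁅ p ⁆ ∷ [])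
    (λ A B X x p → A ⊑ X ∷ B ⊑ ~ X ∷ x ⊑ B ∷ p ⊑ X ∷ []
      ∣ # 1 ≼ ϱ x ∷ ϱ ((A ⊔ p) ⊔ x) ⊕ ϱ (~ X) ≼ ϱ ((A ⊔ p) ⊔ ~ X) ⊕ # 1
      ∷ ϱ ((A ⊔ p) ⊔ B) ≼ ϱ (A ⊔ B) ∷ # 1 ⊕ ϱ (A ⊔ x) ≼ ϱ ((A ⊔ p) ⊔ x) ∷ []
      by ((A ⊔ p) ⊔ B , ~ X) ∷ (A ⊔ x , B) ∷ [] ⊩ # 1 ≼ # 0)
    refl (A⊆X ∷ B⊆Z ∷ ∈! x∈B ∷ ∈! p∈X ∷ []) (0<ρx ∷ ap ∷ col ∷ indep ∷ [])) λ ()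
  ... | no ¬ap | no ¬a = contradiction (estimate M (A ∷ B ∷ X ∷ ⁅ x ⁆ ∷ ⁅ p ⁆ ∷ [])
    (λ A B X x p → A ⊑ X ∷ B ⊑ ~ X ∷ x ⊑ B ∷ p ⊑ X ∷ []
      ∣ ϱ (A ⊔ ~ X) ⊕ # 2 ≼ ϱ (A ⊔ x) ⊕ ϱ (~ X) ∷ ϱ (X ⊔ x) ⊕ ϱ (~ X) ≼ ϱ ● ⊕ # 2
      ∷ ϱ ((A ⊔ p) ⊔ B) ≼ ϱ (A ⊔ B) ∷ # 1 ⊕ ϱ (A ⊔ x) ≼ ϱ ((A ⊔ p) ⊔ x) ∷ []
      by ((A ⊔ p) ⊔ B , X ⊔ x) ∷ (A ⊔ ~ X , X ⊔ B) ∷ [] ⊩ # 1 ≼ # 0)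
    refl (A⊆X ∷ B⊆Z ∷ ∈! x∈B ∷ ∈! p∈X ∷ []) (¬apart⇒meets ¬a ∷ sep ∷ col ∷ indep ∷ [])) λ ()

module MinorSides {n m} (M : Matroid n) (N : Matroid m)
  (N3 : ThreeConnected N) (4≤∣EN∣ : 4 ≤ ∣ E N ∣) where

  open Rank M
  private
    module N = Rank N
    module Nˢ = Simple N N3 4≤∣EN∣

  module _ (e : Embedding M N) where

    open Embedding e

    rank-∩ : ∀ Y → ρ (image f (Y ∩ E N) ∪ C) ≡ N.ρ Y + ρ C
    rank-∩ Y = rank (p∩q⊆q Y (E N))

    unspanned : ∀ {i} → i ∈ E N → 1 + ρ C ≤ ρ (⁅ f i ⁆ ∪ C)
    unspanned {i} i∈ = begin
      1 + ρ C                  ≤⟨ +-monoˡ-≤ (ρ C) (Nˢ.0<ρ⁅⁆ i∈) ⟩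
      N.ρ ⁅ i ⁆ + ρ C          ≡⟨ cong (_+ ρ C) (N.ρ-⊆E (∈! i∈)) ⟩
      r N ⁅ i ⁆ + ρ C          ≡⟨ sym (rank (∈! i∈)) ⟩
      ρ (image f ⁅ i ⁆ ∪ C)    ≡⟨ cong (λ z → ρ (z ∪ C)) (image-⁅⁆ f i) ⟩
      ρ (⁅ f i ⁆ ∪ C) ∎
      where open ℕₚ.≤-Reasoning

    -- What `C` spans is a loop of M / C, and N has no loops; so contracting it as well loses no
    -- element of N and changes no rank.
    enlarge : ∀ {D} → D ⊆ E M → ρ (C ∪ D) ≤ ρ C →
              Σ[ e′ ∈ Embedding M N ] C ∪ D ⊆ Embedding.C e′
    enlarge {D} D⊆E spanned = record
      { f = f ; C = C ∪ D ; C⊆E = ∪-⊆ C⊆E D⊆E ; f∈E = f∈E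
      ; f∉C = λ {i} i∈ → [ f∉C i∈ , (λ fi∈D → <⇒≱ (unspanned i∈) (≤-trans
          (ρ-mono (∪-⊆ (q⊆p∪q C D ∘ ∈! fi∈D) (p⊆p∪q D))) spanned)) ]′ ∘ x∈p∪q⁻ C D
      ; f-inj = f-inj
      ; rank = λ {Y} Y⊆ → trans (≤-antisym
          (estimate M (image f Y ∷ C ∷ D ∷ [])
            (λ F C D → [] ∣ ϱ (C ⊔ D) ≼ ϱ C ∷ [] by (F ⊔ C , C ⊔ D) ∷ [] ⊩ ϱ (F ⊔ (C ⊔ D)) ≼ ϱ (F ⊔ C))
            refl [] (spanned ∷ []))
          (ρ-mono (∪-mono id (p⊆p∪q D))))
          (trans (rank Y⊆) (cong (r N Y +_) (≤-antisym (ρ-mono (p⊆p∪q D)) spanned)))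
      } , id

    -- Connectivity does not increase in minors, and N has no 2-separations.

    small-side : ∀ {x} X → x ∈ C → x ∉ X → 1 ≤ ρ ⁅ x ⁆ → ρ (X ∪ ⁅ x ⁆) + ρ (∁ X) ≤ ρ ⊤ + 2 →
                 Small e X ⊎ Small e (∁ X)
    small-side {x} X x∈C x∉X 0<ρx sep = cases (2 ℕ.≤? ∣ S ∣) (2 ℕ.≤? ∣ E N ─ S ∣)
      where
      inX? : ∀ i → Dec (i ∈ E N × f i ∈ X)
      inX? i = (i ∈? E N) ×-dec (f i ∈? X)
      S = comprehension inX?
      P = image f (S ∩ E N)
      Q = image f (∁ S ∩ E N)
      T′ = image f (⊤ ∩ E N)
      P⊆X : P ⊆ X
      P⊆X = image-⊆ f (S ∩ E N) (proj₂ ∘ ∈-comprehension⁻ inX? ∘ proj₁ ∘ x∈p∩q⁻ S (E N))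
      Q⊆∁X : Q ⊆ ∁ X
      Q⊆∁X = image-⊆ f (∁ S ∩ E N) λ i∈ → let i∉S , i∈E = x∈p∩q⁻ (∁ S) (E N) i∈ in
        x∉p⇒x∈∁p λ fi∈X → x∈∁p⇒x∉p i∉S (∈-comprehension⁺ inX? (i∈E , fi∈X))
      P∪Q⊆T : P ∪ Q ⊆ T′
      P∪Q⊆T = ∪-⊆ (image-⊆ f (S ∩ E N) (∈-image⁺ f ∘ x∈p∩q⁺ ∘ (λ z → ∈⊤ , z) ∘ p∩q⊆q S (E N)))
                  (image-⊆ f (∁ S ∩ E N) (∈-image⁺ f ∘ x∈p∩q⁺ ∘ (λ z → ∈⊤ , z) ∘ p∩q⊆q (∁ S) (E N)))
      bound : ρ (P ∪ C) + ρ (Q ∪ C) ≤ (ρ (T′ ∪ C) + ρ C) + 1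
      bound = estimate M (X ∷ P ∷ Q ∷ T′ ∷ C ∷ ⁅ x ⁆ ∷ [])
        (λ X P Q T C x → P ⊑ X ∷ Q ⊑ ~ X ∷ P ⊔ Q ⊑ T ∷ x ⊑ C ∷ x ⊑ ~ X ∷ []
          ∣ ϱ (X ⊔ x) ⊕ ϱ (~ X) ≼ ϱ ● ⊕ # 2 ∷ # 1 ≼ ϱ x ∷ []
          by (X ⊔ C , P ⊔ Q ⊔ C) ∷ (~ X ⊔ C , X ⊔ C ⊔ Q) ∷ (X ⊔ x , C) ∷ (~ X , (C ⊓ X) ⊔ x) ∷ []
          ⊩ ϱ (P ⊔ C) ⊕ ϱ (Q ⊔ C) ≼ (ϱ (T ⊔ C) ⊕ ϱ C) ⊕ # 1)
        refl (P⊆X ∷ Q⊆∁X ∷ P∪Q⊆T ∷ ∈! x∈C ∷ ∉! x∉X ∷ []) (sep ∷ 0<ρx ∷ [])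
      sepN : N.ρ S + N.ρ (∁ S) ≤ N.ρ ⊤ + 1
      sepN = +-cancelʳ-≤ (ρ C + ρ C) _ _ (begin
        (N.ρ S + N.ρ (∁ S)) + (ρ C + ρ C)  ≡⟨ +-swap (N.ρ S) _ (ρ C) _ ⟩
        (N.ρ S + ρ C) + (N.ρ (∁ S) + ρ C)  ≡⟨ cong₂ _+_ (sym (rank-∩ S)) (sym (rank-∩ (∁ S))) ⟩
        ρ (P ∪ C) + ρ (Q ∪ C)              ≤⟨ bound ⟩
        (ρ (T′ ∪ C) + ρ C) + 1             ≡⟨ cong (λ z → (z + ρ C) + 1) (rank-∩ ⊤) ⟩
        ((N.ρ ⊤ + ρ C) + ρ C) + 1          ≡⟨ cong (_+ 1) (+-assoc (N.ρ ⊤) _ _) ⟩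
        (N.ρ ⊤ + (ρ C + ρ C)) + 1          ≡⟨ +-assoc (N.ρ ⊤) _ 1 ⟩
        N.ρ ⊤ + ((ρ C + ρ C) + 1)          ≡⟨ cong (N.ρ ⊤ +_) (+-comm _ 1) ⟩
        N.ρ ⊤ + (1 + (ρ C + ρ C))          ≡⟨ sym (+-assoc (N.ρ ⊤) 1 _) ⟩
        (N.ρ ⊤ + 1) + (ρ C + ρ C) ∎)
        where open ℕₚ.≤-Reasoning
      cases : Dec (2 ≤ ∣ S ∣) → Dec (2 ≤ ∣ E N ─ S ∣) → Small e X ⊎ Small e (∁ X)
      cases (no S≱2) _ = inj₁ λ {i} {j} i∈ j∈ fi∈ fj∈ → case i ≟ᶠ j of λ where
        (yes i≡j) → i≡j
        (no i≢j)  → contradiction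
          (1<∣∣ i≢j (∈-comprehension⁺ inX? (i∈ , fi∈)) (∈-comprehension⁺ inX? (j∈ , fj∈))) S≱2
      cases (yes _) (no T≱2) = inj₂ λ {i} {j} i∈ j∈ fi∈ fj∈ → case i ≟ᶠ j of λ where
        (yes i≡j) → i≡j
        (no i≢j)  → contradiction (1<∣∣ i≢j
          (∈-─⁺ i∈ (x∈∁p⇒x∉p fi∈ ∘ proj₂ ∘ ∈-comprehension⁻ inX?))
          (∈-─⁺ j∈ (x∈∁p⇒x∉p fj∈ ∘ proj₂ ∘ ∈-comprehension⁻ inX?))) T≱2
      cases (yes S≥2) (yes T≥2) =
        let a , b , a≢b , a∈ , b∈ = 1<∣∣⁻ S S≥2
            c , d , c≢d , c∈ , d∈ = 1<∣∣⁻ (E N ─ S) T≥2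
            inE = λ {i} (i∈ : i ∈ S) → proj₁ (∈-comprehension⁻ inX? i∈)
        in contradiction (ThreeConnected.conn₂ N3 S (inE a∈) (inE b∈)
             (proj₁ (∈-─⁻ c∈)) (proj₁ (∈-─⁻ d∈)) a≢b c≢d a∈ b∈
             (proj₂ (∈-─⁻ c∈)) (proj₂ (∈-─⁻ d∈)))
             (<⇒≱ (ℕₚ.≤-<-trans sepN (ℕₚ.+-monoʳ-< (N.ρ ⊤) (ℕₚ.n<1+n 1))))

    module _ {X : Subset n} {x y : Fin n} (X⊆E : X ⊆ E M) (x∈C : x ∈ C) (x∉X : x ∉ X)
             (0<ρx : 1 ≤ ρ ⁅ x ⁆) (sep : ρ (X ∪ ⁅ x ⁆) + ρ (∁ X) ≤ ρ ⊤ + 2)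
             (small : Small e X) (y∈X : y ∈ X) (y∉cl : 1 + ρ (∁ X) ≤ ρ (∁ X ∪ ⁅ y ⁆)) where

      open TwoSum M X x x∉X 0<ρx sep

      private
        Cʸ A : Subset n
        Cʸ = C ∩ Z
        A  = C ∩ X

        A⊆X : A ⊆ X
        A⊆X = p∩q⊆q C X

        x∈Cʸ : x ∈ Cʸ
        x∈Cʸ = x∈p∩q⁺ (x∈C , x∉p⇒x∈∁p x∉X)

        C≡ : A ∪ Cʸ ≡ C
        C≡ = ⊆-antisym
          (sets (C ∷ X ∷ []) (λ C X → [] ⊢ (C ⊓ X) ⊔ (C ⊓ ~ X) ⊑ C) refl [])
          (sets (C ∷ X ∷ []) (λ C X → [] ⊢ C ⊑ (C ⊓ X) ⊔ (C ⊓ ~ X)) refl [])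

        shuffle : ∀ F A → F ∪ (A ∪ Cʸ) ≡ A ∪ (F ∪ Cʸ)
        shuffle F A = ⊆-antisym
          (sets (F ∷ A ∷ Cʸ ∷ []) (λ F A C → [] ⊢ F ⊔ (A ⊔ C) ⊑ A ⊔ (F ⊔ C)) refl [])
          (sets (F ∷ A ∷ Cʸ ∷ []) (λ F A C → [] ⊢ A ⊔ (F ⊔ C) ⊑ F ⊔ (A ⊔ C)) refl [])

        apart-y : Apart ⁅ y ⁆
        apart-y = estimate M (X ∷ ⁅ x ⁆ ∷ ⁅ y ⁆ ∷ [])
          (λ X x y → [] ∣ ϱ x ≼ # 1 ∷ ϱ y ≼ # 1 ∷ # 1 ⊕ ϱ (~ X) ≼ ϱ (~ X ⊔ y) ∷ [] by (x , y) ∷ []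
            ⊩ ϱ (y ⊔ x) ⊕ ϱ (~ X) ≼ ϱ (y ⊔ ~ X) ⊕ # 1)
          refl [] (ρ-⁅⁆ x ∷ ρ-⁅⁆ y ∷ y∉cl ∷ [])

        rebase : ∀ {a b c d k} → a + b ≡ c + d → c ≡ k + b → a ≡ k + d
        rebase {a} {b} {c} {d} {k} eq refl = ℕₚ.+-cancelʳ-≡ b a (k + d) (begin
          a + b       ≡⟨ eq ⟩
          (k + b) + d ≡⟨ +-assoc k b d ⟩
          k + (b + d) ≡⟨ cong (k +_) (+-comm b d) ⟩
          k + (d + b) ≡⟨ sym (+-assoc k d b) ⟩
          (k + d) + b ∎)
          where open ≡-Reasoning

        Contracted : Set
        Contracted = Σ[ e′ ∈ Embedding M N ] x ∈ Embedding.C e′ × y ∈ Embedding.C e′ × Small e′ X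

        -- Without elements of N in `X`, the set `C ∩ X` matters only through its type and can be
        -- exchanged for a set of the same type that contains `y`: `⁅ y ⁆` itself if the type is
        -- apart, and otherwise `A` with `y` added.
        avoiding : (∀ {i} → i ∈ E N → f i ∉ X) →
                   Contracted
        avoiding f∉X = choose (apart? A)
          where
          contract : ∀ A′ → y ∈ A′ → A′ ⊆ X →
            (∀ B B₀ → B ⊆ Z → B₀ ⊆ Z → x ∈ B → x ∈ B₀ → ρ (A′ ∪ B) + ρ (A ∪ B₀) ≡ ρ (A ∪ B) + ρ (A′ ∪ B₀)) →
            Contracted
          contract A′ y∈A′ A′⊆X exch = record
            { f = f ; C = A′ ∪ Cʸ ; C⊆E = ∪-⊆ (X⊆E ∘ A′⊆X) (C⊆E ∘ p∩q⊆p C Z) ; f∈E = f∈E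
            ; f∉C = λ i∈ → [ f∉X i∈ ∘ A′⊆X , f∉C i∈ ∘ p∩q⊆p C Z ]′ ∘ x∈p∪q⁻ A′ Cʸ
            ; f-inj = f-inj
            ; rank = λ {Y} Y⊆ → let F⊆Z = image-⊆ f Y (x∉p⇒x∈∁p ∘ f∉X ∘ Y⊆) in
                trans (cong ρ (shuffle (image f Y) A′))
                  (rebase (exch (image f Y ∪ Cʸ) Cʸ (∪-⊆ F⊆Z (p∩q⊆q C Z)) (p∩q⊆q C Z)
                             (q⊆p∪q (image f Y) Cʸ x∈Cʸ) x∈Cʸ)
                    (trans (cong ρ (trans (sym (shuffle (image f Y) A)) (cong (image f Y ∪_) C≡)))
                      (trans (rank Y⊆) (cong (λ z → r N Y + ρ z) (sym C≡)))))
            } , q⊆p∪q A′ Cʸ x∈Cʸ , p⊆p∪q Cʸ y∈A′ , λ i∈ _ fi∈X → contradiction fi∈X (f∉X i∈)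
          choose : Dec (Apart A) →
            Contracted
          choose (yes a) = contract ⁅ y ⁆ (x∈⁅x⁆ y) (∈! y∈X) λ B B₀ B⊆ B₀⊆ x∈B x∈B₀ → ≤-antisym
            (exchange-apart A⊆X (∈! y∈X) B⊆ B₀⊆ x∈B x∈B₀ a apart-y)
            (exchange-apart (∈! y∈X) A⊆X B⊆ B₀⊆ x∈B x∈B₀ apart-y a)
          choose (no ¬a) = contract (A ∪ ⁅ y ⁆) (q⊆p∪q A ⁅ y ⁆ (x∈⁅x⁆ y)) Ay⊆X λ B B₀ B⊆ B₀⊆ x∈B x∈B₀ → ≤-antisym
            (exchange-meets A⊆X Ay⊆X B⊆ B₀⊆ x∈B x∈B₀ ma my)
            (exchange-meets Ay⊆X A⊆X B⊆ B₀⊆ x∈B x∈B₀ my ma)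
            where
            Ay⊆X = ∪-⊆ A⊆X (∈! y∈X)
            ma = ¬apart⇒meets ¬a
            my = ¬apart⇒meets (¬a ∘ apart-mono (p⊆p∪q ⁅ y ⁆))

        -- The only element p of N in X is replaced by the element p′ at which sets
        -- growing from {y} inside X first span the point common to X and Z.

        replacing : ∀ {i₀} → i₀ ∈ E N → f i₀ ∈ X →
                    Contracted
        replacing {i₀} i₀∈ p∈X = record
            { f = f′ ; C = A′ ∪ Cʸ ; C⊆E = ∪-⊆ (X⊆E ∘ A′⊆X) (C⊆E ∘ p∩q⊆p C Z)
            ; f∈E = λ {i} i∈ → f′∈E i i∈ (i ≟ᶠ i₀)
            ; f∉C = λ {i} i∈ → f′∉C i i∈ (i ≟ᶠ i₀)
            ; f-inj = λ {i} {j} i∈ j∈ → f′-inj i j i∈ j∈ (i ≟ᶠ i₀) (j ≟ᶠ i₀)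
            ; rank = λ {Y} Y⊆ → rank′ Y Y⊆ (i₀ ∈? Y)
            } , q⊆p∪q A′ Cʸ x∈Cʸ , p⊆p∪q Cʸ (y⊆A′ (x∈⁅x⁆ y)) ,
            λ {i} {j} i∈ j∈ fi∈ fj∈ → trans (only i i∈ (i ≟ᶠ i₀) fi∈) (sym (only j j∈ (j ≟ᶠ i₀) fj∈))
          where
          p = f i₀
          f∈Z : ∀ {i} → i ∈ E N → i ≢ i₀ → f i ∈ Z
          f∈Z i∈ i≢ = x∉p⇒x∈∁p λ fi∈X → i≢ (small i∈ i₀∈ fi∈X p∈X)
          rest⊆Z : ∀ {Y} → Y ⊆ E N → image f (Y - i₀) ⊆ Z
          rest⊆Z {Y} Y⊆ = image-⊆ f (Y - i₀) λ i∈ →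
            f∈Z (Y⊆ (proj₁ (∈--⁻ i∈))) (proj₂ (∈--⁻ i∈) ∘ sym)

          -- N has no coloops, so `p` is spanned once the rest of N and `C` are present; N has no
          -- loops, so `C` does not span `p`. These are the last two hypotheses of `no-coloop`.
          B₁ = image f (E N - i₀) ∪ Cʸ
          co : ρ ((A ∪ ⁅ p ⁆) ∪ B₁) ≤ ρ (A ∪ B₁)
          co = begin
            ρ ((A ∪ ⁅ p ⁆) ∪ B₁)
              ≤⟨ ρ-mono (sets (A ∷ ⁅ p ⁆ ∷ image f (E N - i₀) ∷ Cʸ ∷ C ∷ image f (E N) ∷ [])
                   (λ A p F′ Cy C F → A ⊔ Cy ⊑ C ∷ p ⊑ F ∷ F′ ⊑ F ∷ []
                     ⊢ (A ⊔ p) ⊔ (F′ ⊔ Cy) ⊑ F ⊔ C) refl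
                   ((λ {z} → subst (z ∈_) C≡) ∷ ∈! (∈-image⁺ f i₀∈) ∷
                    image-⊆ f (E N - i₀) (∈-image⁺ f ∘ proj₁ ∘ ∈--⁻) ∷ [])) ⟩
            ρ (image f (E N) ∪ C)              ≡⟨ rank id ⟩
            r N (E N) + ρ C                    ≡⟨ cong (_+ ρ C) (sym N.ρ-⊤) ⟩
            N.ρ ⊤ + ρ C                        ≤⟨ +-monoˡ-≤ (ρ C) (Nˢ.ρ∁⁅⁆ i₀∈) ⟩
            N.ρ (∁ ⁅ i₀ ⁆) + ρ C               ≡⟨ cong (_+ ρ C) (N.ρ-∁ ⁅ i₀ ⁆) ⟩
            r N (E N - i₀) + ρ C               ≡⟨ sym (rank (p─q⊆p (E N) ⁅ i₀ ⁆)) ⟩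
            ρ (image f (E N - i₀) ∪ C)         ≡⟨ cong (λ z → ρ (image f (E N - i₀) ∪ z)) (sym C≡) ⟩
            ρ (image f (E N - i₀) ∪ (A ∪ Cʸ))  ≡⟨ cong ρ (shuffle _ A) ⟩
            ρ (A ∪ B₁) ∎
            where open ℕₚ.≤-Reasoning
          indep : 1 + ρ (A ∪ ⁅ x ⁆) ≤ ρ ((A ∪ ⁅ p ⁆) ∪ ⁅ x ⁆)
          indep = estimate M (A ∷ ⁅ x ⁆ ∷ ⁅ p ⁆ ∷ C ∷ [])
            (λ A x p C → x ⊑ C ∷ A ⊑ C ∷ [] ∣ # 1 ⊕ ϱ C ≼ ϱ (p ⊔ C) ∷ [] by ((A ⊔ p) ⊔ x , C) ∷ []
              ⊩ # 1 ⊕ ϱ (A ⊔ x) ≼ ϱ ((A ⊔ p) ⊔ x))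
            refl (∈! x∈C ∷ p∩q⊆p C X ∷ []) (unspanned i₀∈ ∷ [])
          types = no-coloop A⊆X (∪-⊆ (rest⊆Z id) (p∩q⊆q C Z)) (q⊆p∪q (image f (E N - i₀)) Cʸ x∈Cʸ) p∈X co indep
          apart = proj₁ types
          meets = ¬apart⇒meets (proj₂ types)
          flip! = flip-point apart? X ⁅ y ⁆ (∈! y∈X) apart-y
                   (proj₂ types ∘ apart-mono (∪-⊆ A⊆X (∈! p∈X)))
          A′ = proj₁ flip!
          p′ = proj₁ (proj₂ flip!)
          props = proj₂ (proj₂ flip!)
          y⊆A′ : ⁅ y ⁆ ⊆ A′
          y⊆A′ = proj₁ props
          A′⊆X : A′ ⊆ X
          A′⊆X = proj₁ (proj₂ props)
          p′∈X : p′ ∈ X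
          p′∈X = proj₁ (proj₂ (proj₂ props))
          p′∉A′ : p′ ∉ A′
          p′∉A′ = proj₁ (proj₂ (proj₂ (proj₂ props)))
          apart′ : Apart A′
          apart′ = proj₁ (proj₂ (proj₂ (proj₂ (proj₂ props))))
          meets′ : Meets (A′ ∪ ⁅ p′ ⁆)
          meets′ = ¬apart⇒meets (proj₂ (proj₂ (proj₂ (proj₂ (proj₂ props)))))

          pick : ∀ i → Dec (i ≡ i₀) → Fin n
          pick i (yes _) = p′
          pick i (no _)  = f i
          f′ : Fin m → Fin n
          f′ i = pick i (i ≟ᶠ i₀)
          pick-≢ : ∀ {i} (d : Dec (i ≡ i₀)) → i ≢ i₀ → pick i d ≡ f i
          pick-≢ (yes eq) i≢ = contradiction eq i≢
          pick-≢ (no _)   i≢ = refl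
          pick-i₀ : (d : Dec (i₀ ≡ i₀)) → pick i₀ d ≡ p′
          pick-i₀ (yes _) = refl
          pick-i₀ (no ne) = contradiction refl ne
          f′-≢ : ∀ {i} → i ≢ i₀ → f′ i ≡ f i
          f′-≢ {i} = pick-≢ (i ≟ᶠ i₀)
          f′-i₀ : f′ i₀ ≡ p′
          f′-i₀ = pick-i₀ (i₀ ≟ᶠ i₀)
          f′∈E : ∀ i → i ∈ E N → (d : Dec (i ≡ i₀)) → pick i d ∈ E M
          f′∈E i i∈ (yes _) = X⊆E p′∈X
          f′∈E i i∈ (no _)  = f∈E i∈
          f′∉C : ∀ i → i ∈ E N → (d : Dec (i ≡ i₀)) → pick i d ∉ A′ ∪ Cʸ
          f′∉C i i∈ (yes _) = [ p′∉A′ , (λ z → x∈∁p⇒x∉p (p∩q⊆q C Z z) p′∈X) ]′ ∘ x∈p∪q⁻ A′ Cʸ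
          f′∉C i i∈ (no i≢) = [ x∈∁p⇒x∉p (f∈Z i∈ i≢) ∘ A′⊆X , f∉C i∈ ∘ p∩q⊆p C Z ]′ ∘ x∈p∪q⁻ A′ Cʸ
          f′-inj : ∀ i j → i ∈ E N → j ∈ E N → (d : Dec (i ≡ i₀)) (d′ : Dec (j ≡ i₀)) →
                   pick i d ≡ pick j d′ → i ≡ j
          f′-inj i j i∈ j∈ (yes p) (yes q) eq = trans p (sym q)
          f′-inj i j i∈ j∈ (yes _) (no j≢) eq =
            contradiction (subst (_∈ X) eq p′∈X) (x∈∁p⇒x∉p (f∈Z j∈ j≢))
          f′-inj i j i∈ j∈ (no i≢) (yes _) eq =
            contradiction (subst (_∈ X) (sym eq) p′∈X) (x∈∁p⇒x∉p (f∈Z i∈ i≢))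
          f′-inj i j i∈ j∈ (no _) (no _) eq = f-inj i∈ j∈ eq
          only : ∀ i → i ∈ E N → (d : Dec (i ≡ i₀)) → pick i d ∈ X → i ≡ i₀
          only i i∈ (yes eq) _   = eq
          only i i∈ (no i≢)  fi∈ = contradiction fi∈ (x∈∁p⇒x∉p (f∈Z i∈ i≢))

          image-drop : ∀ {Y} → i₀ ∉ Y → image f′ Y ≡ image f (Y - i₀)
          image-drop {Y} i₀∉Y = ⊆-antisym
            (image-⊆ f′ Y λ {i} i∈ → let i≢ = λ { refl → i₀∉Y i∈ } in
              subst (_∈ image f (Y - i₀)) (sym (f′-≢ i≢))
                (∈-image⁺ f (∈--⁺ i∈ i≢)))
            (image-⊆ f (Y - i₀) λ {i} i∈ → let i∈Y , ≢i = ∈--⁻ i∈ in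
              subst (_∈ image f′ Y) (f′-≢ (≢i ∘ sym)) (∈-image⁺ f′ i∈Y))
          image-swap : ∀ {Y} → i₀ ∈ Y → image f′ Y ≡ ⁅ p′ ⁆ ∪ image f (Y - i₀)
          image-swap {Y} i₀∈Y = ⊆-antisym
            (image-⊆ f′ Y λ {i} i∈ → case i ≟ᶠ i₀ of λ where
              (yes refl) → subst (_∈ ⁅ p′ ⁆ ∪ image f (Y - i₀)) (sym f′-i₀) (p⊆p∪q _ (x∈⁅x⁆ p′))
              (no i≢) → subst (_∈ ⁅ p′ ⁆ ∪ image f (Y - i₀)) (sym (f′-≢ i≢))
                (q⊆p∪q ⁅ p′ ⁆ _ (∈-image⁺ f (∈--⁺ i∈ i≢))))
            (∪-⊆ (∈! (subst (_∈ image f′ Y) f′-i₀ (∈-image⁺ f′ i₀∈Y)))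
              (image-⊆ f (Y - i₀) λ {i} i∈ → let i∈Y , ≢i = ∈--⁻ i∈ in
                subst (_∈ image f′ Y) (f′-≢ (≢i ∘ sym)) (∈-image⁺ f′ i∈Y)))
          image-f : ∀ {Y} → i₀ ∈ Y → image f Y ≡ ⁅ p ⁆ ∪ image f (Y - i₀)
          image-f {Y} i₀∈Y = ⊆-antisym
            (image-⊆ f Y λ {i} i∈ → case i ≟ᶠ i₀ of λ where
              (yes refl) → p⊆p∪q _ (x∈⁅x⁆ p)
              (no i≢) → q⊆p∪q ⁅ p ⁆ _ (∈-image⁺ f (∈--⁺ i∈ i≢)))
            (∪-⊆ (∈! (∈-image⁺ f i₀∈Y)) (image-⊆ f (Y - i₀) (∈-image⁺ f ∘ proj₁ ∘ ∈--⁻)))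
          shuffle₂ : ∀ q F A → (⁅ q ⁆ ∪ F) ∪ (A ∪ Cʸ) ≡ (A ∪ ⁅ q ⁆) ∪ (F ∪ Cʸ)
          shuffle₂ q F A = ⊆-antisym
            (sets (⁅ q ⁆ ∷ F ∷ A ∷ Cʸ ∷ []) (λ q F A C → [] ⊢ (q ⊔ F) ⊔ (A ⊔ C) ⊑ (A ⊔ q) ⊔ (F ⊔ C)) refl [])
            (sets (⁅ q ⁆ ∷ F ∷ A ∷ Cʸ ∷ []) (λ q F A C → [] ⊢ (A ⊔ q) ⊔ (F ⊔ C) ⊑ (q ⊔ F) ⊔ (A ⊔ C)) refl [])
          rank′ : ∀ Y → Y ⊆ E N → Dec (i₀ ∈ Y) → ρ (image f′ Y ∪ (A′ ∪ Cʸ)) ≡ r N Y + ρ (A′ ∪ Cʸ)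
          rank′ Y Y⊆ (no i₀∉) = trans (cong (λ z → ρ (z ∪ (A′ ∪ Cʸ))) (image-drop i₀∉))
            (trans (cong ρ (shuffle F A′)) (rebase (≤-antisym
                (exchange-apart A⊆X A′⊆X B⊆Z (p∩q⊆q C Z) x∈B x∈Cʸ apart apart′)
                (exchange-apart A′⊆X A⊆X B⊆Z (p∩q⊆q C Z) x∈B x∈Cʸ apart′ apart))
              (trans (cong ρ (trans (sym (shuffle F A)) (cong (F ∪_) C≡)))
                (trans (cong (λ z → ρ (z ∪ C)) (sym Y≡))
                  (trans (rank Y⊆) (cong (λ z → r N Y + ρ z) (sym C≡)))))))
            where
            F = image f (Y - i₀)
            B⊆Z : F ∪ Cʸ ⊆ Z
            B⊆Z = ∪-⊆ (rest⊆Z Y⊆) (p∩q⊆q C Z)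
            x∈B : x ∈ F ∪ Cʸ
            x∈B = q⊆p∪q F Cʸ x∈Cʸ
            Y≡ : image f Y ≡ F
            Y≡ = ⊆-antisym
              (image-⊆ f Y λ i∈ → ∈-image⁺ f (∈-─⁺ i∈ (x≢y⇒x∉⁅y⁆ λ { refl → i₀∉ i∈ })))
              (image-⊆ f (Y - i₀) (∈-image⁺ f ∘ proj₁ ∘ ∈--⁻))
          rank′ Y Y⊆ (yes i₀∈Y) = trans (cong (λ z → ρ (z ∪ (A′ ∪ Cʸ))) (image-swap i₀∈Y))
            (trans (cong ρ (shuffle₂ p′ F A′)) (rebase (≤-antisym
                (exchange-flip A⊆X A′⊆X B⊆Z (p∩q⊆q C Z) x∈B x∈Cʸ p∈X p′∈X apart meets apart′ meets′)
                (exchange-flip A′⊆X A⊆X B⊆Z (p∩q⊆q C Z) x∈B x∈Cʸ p′∈X p∈X apart′ meets′ apart meets))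
              (trans (cong ρ (trans (sym (shuffle₂ p F A)) (cong ((⁅ p ⁆ ∪ F) ∪_) C≡)))
                (trans (cong (λ z → ρ (z ∪ C)) (sym (image-f i₀∈Y)))
                  (trans (rank Y⊆) (cong (λ z → r N Y + ρ z) (sym C≡)))))))
            where
            F = image f (Y - i₀)
            B⊆Z : F ∪ Cʸ ⊆ Z
            B⊆Z = ∪-⊆ (rest⊆Z Y⊆) (p∩q⊆q C Z)
            x∈B : x ∈ F ∪ Cʸ
            x∈B = q⊆p∪q F Cʸ x∈Cʸ

      -- In the new copy `X` still holds at most one element of N, so the descent can go on at `y`
      -- within the same `X`.
      contract-unspanned : Σ[ e′ ∈ Embedding M N ] x ∈ Embedding.C e′ × y ∈ Embedding.C e′ × Small e′ X
      contract-unspanned with Finₚ.any? (λ i → (i ∈? E N) ×-dec (f i ∈? X))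
      ... | yes (i₀ , i₀∈ , p∈X) = replacing i₀∈ p∈X
      ... | no ∄ = avoiding λ {i} i∈ fi∈X → ∄ (i , i∈ , fi∈X)

-- A vertical 3-partition (X , {x} , ∁ (X ∪ {x})) of a 3-connected matroid.

record Vertical (M : Matroid n) (x : Fin n) (X : Subset n) : Set where
  private
    Y : Subset n
    Y = ∁ (X ∪ ⁅ x ⁆)
  field
    x∈E   : x ∈ E M
    x∉X   : x ∉ X
    sep   : rk M X + rk M Y ≤ rk M ⊤ + 2
    spanˣ : rk M (X ∪ ⁅ x ⁆) ≤ rk M X
    spanʸ : rk M (Y ∪ ⁅ x ⁆) ≤ rk M Y
    3≤ˣ   : 3 ≤ rk M X
    3≤ʸ   : 3 ≤ rk M Y

-- A normal form: whatever the other side spans has been moved there. It also forces `X` into the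
-- ground set, since elements outside have rank 0.
Closed : Matroid n → Fin n → Subset n → Set
Closed M x X = ∀ {e} → e ∈ X → 1 + rk M (∁ (X ∪ ⁅ x ⁆)) ≤ rk M (∁ (X ∪ ⁅ x ⁆) ∪ ⁅ e ⁆)

-- Vertical 3-partitions and their normal form.

module Partitions {n} (M : Matroid n) (M3 : ThreeConnected M) (4≤∣E∣ : 4 ≤ ∣ E M ∣) where

  open Rank M
  open ThreeConnected M3
  open Simple M M3 4≤∣E∣

  ∁-∁∪ : (X Y : Subset n) → ∁ (∁ (X ∪ Y) ∪ Y) ⊆ X
  ∁-∁∪ X Y = sets (X ∷ Y ∷ []) (λ X Y → [] ⊢ ~ (~ (X ⊔ Y) ⊔ Y) ⊑ X) refl []

  swap-sides : ∀ {x X} → Vertical M x X → Vertical M x (∁ (X ∪ ⁅ x ⁆))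
  swap-sides {x} {X} v = record
    { x∈E = x∈E
    ; x∉X = x∈p⇒x∉∁p (q⊆p∪q X ⁅ x ⁆ (x∈⁅x⁆ x))
    ; sep = ≤-trans (+-monoʳ-≤ (ρ (∁ (X ∪ ⁅ x ⁆))) (≤-reflexive X≡))
                       (≤-trans (≤-reflexive (+-comm _ (ρ X))) sep)
    ; spanˣ = spanʸ
    ; spanʸ = subst (λ z → ρ (z ∪ ⁅ x ⁆) ≤ ρ z) (sym eq) spanˣ
    ; 3≤ˣ = 3≤ʸ
    ; 3≤ʸ = subst (λ z → 3 ≤ ρ z) (sym eq) 3≤ˣ
    }
    where
    open Vertical v
    eq : ∁ (∁ (X ∪ ⁅ x ⁆) ∪ ⁅ x ⁆) ≡ X
    eq = ⊆-antisym (∁-∁∪ X ⁅ x ⁆)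
      (sets (X ∷ ⁅ x ⁆ ∷ []) (λ X x → x ⊑ ~ X ∷ [] ⊢ X ⊑ ~ (~ (X ⊔ x) ⊔ x)) refl (∉! x∉X ∷ []))
    X≡ : ρ (∁ (∁ (X ∪ ⁅ x ⁆) ∪ ⁅ x ⁆)) ≡ ρ X
    X≡ = cong ρ eq

  unspanned? : ∀ T e → Dec (1 + ρ T ≤ ρ (T ∪ ⁅ e ⁆))
  unspanned? T e = 1 + ρ T ℕ.≤? ρ (T ∪ ⁅ e ⁆)

  -- The part of the ground set outside the closure of `T`.
  beyond : Subset n → Subset n
  beyond T = comprehension (unspanned? T)

  ∁beyond : ∀ T → ρ (T ∪ ∁ (beyond T)) ≤ ρ T
  ∁beyond T = ρ-absorb T (∁ (beyond T)) λ e∈ →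
    ≮⇒≥ (x∈∁p⇒x∉p e∈ ∘ ∈-comprehension⁺ (unspanned? T))

  ∁beyond′ : ∀ T → ρ (∁ (beyond T)) ≤ ρ T
  ∁beyond′ T = ≤-trans (ρ-mono (q⊆p∪q T (∁ (beyond T)))) (∁beyond T)

  ⊆∁beyond : ∀ T → T ⊆ ∁ (beyond T)
  ⊆∁beyond T e∈T = x∉p⇒x∈∁p λ e∈ → <⇒≱ (∈-comprehension⁻ (unspanned? T) e∈)
    (ρ-mono (∪-⊆ id (∈! e∈T)))

  -- Two elements of `beyond T` are needed for `conn₂`, and they are found in two rounds: one exists
  -- because `T` is not spanning, and then `conn₁` raises the rank of `beyond T` to 2.
  beyond-conn : ∀ T {c d} → c ∈ E M → d ∈ E M → c ≢ d → c ∈ T → d ∈ T → 1 + ρ T ≤ ρ ⊤ →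
                ρ ⊤ + 2 ≤ ρ (beyond T) + ρ T
  beyond-conn T {c} {d} c∈E d∈E c≢d c∈T d∈T nonsp = step (0<ρ⇒∃ U 1≤U)
    where
    U : Subset n
    U = beyond T
    c∉U : c ∉ U
    c∉U = x∈∁p⇒x∉p (⊆∁beyond T c∈T)
    1≤U : 1 ≤ ρ U
    1≤U = estimate M (T ∷ U ∷ [])
      (λ T U → [] ∣ # 1 ⊕ ϱ T ≼ ϱ ● ∷ ϱ (~ U) ≼ ϱ T ∷ [] by (U , ~ U) ∷ [] ⊩ # 1 ≼ ϱ U)
      refl [] (nonsp ∷ ∁beyond′ T ∷ [])
    2≤U : ρ ⊤ + 1 ≤ ρ U + ρ (∁ U) → 2 ≤ ρ U
    2≤U connected = estimate M (T ∷ U ∷ [])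
      (λ T U → [] ∣ # 1 ⊕ ϱ T ≼ ϱ ● ∷ ϱ (~ U) ≼ ϱ T ∷ ϱ ● ⊕ # 1 ≼ ϱ U ⊕ ϱ (~ U) ∷ [] by [] ⊩ # 2 ≼ ϱ U)
      refl [] (nonsp ∷ ∁beyond′ T ∷ connected ∷ [])
    finish : Two U → ρ ⊤ + 2 ≤ ρ U + ρ T
    finish (a , b , a≢b , (a∈U , a∈E) , (b∈U , b∈E)) =
      ≤-trans (conn₂ U a∈E b∈E c∈E d∈E a≢b c≢d a∈U b∈U c∉U (x∈∁p⇒x∉p (⊆∁beyond T d∈T)))
        (+-monoʳ-≤ (ρ U) (∁beyond′ T))
    step : (∃ λ a → a ∈ U × a ∈ E M) → ρ ⊤ + 2 ≤ ρ U + ρ T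
    step (a , a∈U , a∈E) = finish (1<ρ⇒∃ U (2≤U (conn₁ U a∈E c∈E a∈U c∉U)))

  -- The bound on `ρ S + ρ T` and the connectivity of `beyond T` leave no slack, so `beyond T` has
  -- the rank of `S` and spans `x`. The same count for the complement of `beyond T` and `x` shows
  -- that it spans `x` too.
  beyond-vertical : ∀ {x} S T → x ∈ E M → x ∈ S → x ∈ T → ρ S + ρ T ≤ ρ ⊤ + 2 → 3 ≤ ρ S → 3 ≤ ρ T →
                    ρ (S ∪ beyond T) ≤ ρ S → Vertical M x (beyond T) × Closed M x (beyond T)
  beyond-vertical {x} S T x∈E x∈S x∈T sepST 3≤S 3≤T spanS = record
    { x∈E = x∈E ; x∉X = x∉U
    ; sep = estimate M (S ∷ T ∷ U ∷ ⁅ x ⁆ ∷ [])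
        (λ S T U x → [] ∣ ϱ S ⊕ ϱ T ≼ ϱ ● ⊕ # 2 ∷ ϱ (~ U) ≼ ϱ T ∷ ϱ (S ⊔ U) ≼ ϱ S ∷ [] by []
          ⊩ ϱ U ⊕ ϱ (~ (U ⊔ x)) ≼ ϱ ● ⊕ # 2)
        refl [] (sepST ∷ ∁beyond′ T ∷ spanS ∷ [])
    ; spanˣ = estimate M (S ∷ T ∷ U ∷ ⁅ x ⁆ ∷ [])
        (λ S T U x → x ⊑ S ∷ [] ∣ ϱ S ⊕ ϱ T ≼ ϱ ● ⊕ # 2 ∷ ϱ (S ⊔ U) ≼ ϱ S ∷ ϱ ● ⊕ # 2 ≼ ϱ U ⊕ ϱ T ∷ [] by []
          ⊩ ϱ (U ⊔ x) ≼ ϱ U)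
        refl (∈! x∈S ∷ []) (sepST ∷ spanS ∷ connU ∷ [])
    ; spanʸ = spanY
    ; 3≤ˣ = estimate M (S ∷ T ∷ U ∷ [])
        (λ S T U → [] ∣ # 3 ≼ ϱ S ∷ ϱ S ⊕ ϱ T ≼ ϱ ● ⊕ # 2 ∷ ϱ ● ⊕ # 2 ≼ ϱ U ⊕ ϱ T ∷ [] by [] ⊩ # 3 ≼ ϱ U)
        refl [] (3≤S ∷ sepST ∷ connU ∷ [])
    ; 3≤ʸ = ≤-trans 3≤T (≤-trans (ρ-mono T⊆Yx) spanY)
    } , λ {e} e∈U → estimate M (T ∷ U ∷ ⁅ x ⁆ ∷ ⁅ e ⁆ ∷ [])
        (λ T U x e → T ⊑ ~ U ∷ e ⊑ U ∷ x ⊑ ~ U ∷ []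
          ∣ # 1 ⊕ ϱ T ≼ ϱ (T ⊔ e) ∷ ϱ (~ (U ⊔ x) ⊔ x) ≼ ϱ (~ (U ⊔ x)) ∷ ϱ (~ U) ≼ ϱ T ∷ []
          by (~ (U ⊔ x) ⊔ e , ~ U) ∷ []
          ⊩ # 1 ⊕ ϱ (~ (U ⊔ x)) ≼ ϱ (~ (U ⊔ x) ⊔ e))
        refl (⊆∁beyond T ∷ ∈! e∈U ∷ ∉! x∉U ∷ [])
        (∈-comprehension⁻ (unspanned? T) e∈U ∷ spanY ∷ ∁beyond′ T ∷ [])
    where
    U Y : Subset n
    U = beyond T
    Y = ∁ (U ∪ ⁅ x ⁆)
    x∉U : x ∉ U
    x∉U = x∈∁p⇒x∉p (⊆∁beyond T x∈T)
    nonsp : 1 + ρ T ≤ ρ ⊤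
    nonsp = estimate M (S ∷ T ∷ []) (λ S T → [] ∣ ϱ S ⊕ ϱ T ≼ ϱ ● ⊕ # 2 ∷ # 3 ≼ ϱ S ∷ [] by [] ⊩ # 1 ⊕ ϱ T ≼ ϱ ●)
      refl [] (sepST ∷ 3≤S ∷ [])
    connU : ρ ⊤ + 2 ≤ ρ U + ρ T
    connU = go (1<ρ⇒∃ T (≤-trans (ℕₚ.n≤1+n 2) 3≤T))
      where
      go : Two T → ρ ⊤ + 2 ≤ ρ U + ρ T
      go (c , d , c≢d , (c∈T , c∈E) , (d∈T , d∈E)) = beyond-conn T c∈E d∈E c≢d c∈T d∈T nonsp
    T⊆Yx : T ⊆ Y ∪ ⁅ x ⁆
    T⊆Yx = sets (T ∷ U ∷ ⁅ x ⁆ ∷ []) (λ T U x → T ⊑ ~ U ∷ [] ⊢ T ⊑ ~ (U ⊔ x) ⊔ x) refl (⊆∁beyond T ∷ [])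
    2≤Y : 2 ≤ ρ Y
    2≤Y = estimate M (T ∷ U ∷ ⁅ x ⁆ ∷ [])
      (λ T U x → T ⊑ ~ U ∷ [] ∣ # 3 ≼ ϱ T ∷ ϱ x ≼ # 1 ∷ [] by (~ (U ⊔ x) , x) ∷ [] ⊩ # 2 ≼ ϱ (~ (U ⊔ x)))
      refl (⊆∁beyond T ∷ []) (3≤T ∷ ρ-⁅⁆ x ∷ [])
    1≤U : 1 ≤ ρ U
    1≤U = estimate M (S ∷ T ∷ U ∷ [])
      (λ S T U → [] ∣ # 1 ⊕ ϱ T ≼ ϱ ● ∷ ϱ ● ⊕ # 2 ≼ ϱ U ⊕ ϱ T ∷ [] by [] ⊩ # 1 ≼ ϱ U)
      refl [] (nonsp ∷ connU ∷ [])
    connY : ρ ⊤ + 2 ≤ ρ Y + ρ (∁ Y)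
    connY = go (1<ρ⇒∃ Y 2≤Y) (0<ρ⇒∃ U 1≤U)
      where
      go : Two Y → (∃ λ u → u ∈ U × u ∈ E M) →
           ρ ⊤ + 2 ≤ ρ Y + ρ (∁ Y)
      go (a , b , a≢b , (a∈Y , a∈E) , (b∈Y , b∈E)) (u , u∈U , u∈E) =
        conn₂ Y a∈E b∈E x∈E u∈E a≢b (λ { refl → x∉U u∈U }) a∈Y b∈Y
          (x∈p⇒x∉∁p (q⊆p∪q U ⁅ x ⁆ (x∈⁅x⁆ x))) (x∈p⇒x∉∁p (p⊆p∪q ⁅ x ⁆ u∈U))
    spanY : ρ (Y ∪ ⁅ x ⁆) ≤ ρ Y
    spanY = estimate M (S ∷ T ∷ U ∷ ⁅ x ⁆ ∷ [])
      (λ S T U x → x ⊑ S ∷ x ⊑ ~ U ∷ T ⊑ ~ U ∷ []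
        ∣ ϱ S ⊕ ϱ T ≼ ϱ ● ⊕ # 2 ∷ ϱ (S ⊔ U) ≼ ϱ S ∷ ϱ ● ⊕ # 2 ≼ ϱ (~ (U ⊔ x)) ⊕ ϱ (~ ~ (U ⊔ x)) ∷ ϱ (~ U) ≼ ϱ T ∷ [] by []
        ⊩ ϱ (~ (U ⊔ x) ⊔ x) ≼ ϱ (~ (U ⊔ x)))
      refl (∈! x∈S ∷ ∉! x∉U ∷ ⊆∁beyond T ∷ []) (sepST ∷ spanS ∷ connY ∷ ∁beyond′ T ∷ [])

  close : ∀ {x X} → Vertical M x X → Σ[ X′ ∈ Subset n ] X′ ⊆ X × Vertical M x X′ × Closed M x X′
  close {x} {X} v = beyond W , U⊆X , beyond-vertical (X ∪ ⁅ x ⁆) W x∈E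
      (q⊆p∪q X ⁅ x ⁆ (x∈⁅x⁆ x)) (q⊆p∪q Y ⁅ x ⁆ (x∈⁅x⁆ x))
      (≤-trans (+-mono-≤ spanˣ spanʸ) sep)
      (≤-trans 3≤ˣ (ρ-mono (p⊆p∪q ⁅ x ⁆))) (≤-trans 3≤ʸ (ρ-mono (p⊆p∪q ⁅ x ⁆)))
      (ρ-mono (∪-⊆ id (p⊆p∪q ⁅ x ⁆ ∘ U⊆X)))
    where
    open Vertical v
    Y W : Subset n
    Y = ∁ (X ∪ ⁅ x ⁆)
    W = Y ∪ ⁅ x ⁆
    U⊆X : beyond W ⊆ X
    U⊆X = sets (X ∷ ⁅ x ⁆ ∷ beyond W ∷ [])
      (λ X x U → ~ (X ⊔ x) ⊔ x ⊑ ~ U ∷ [] ⊢ U ⊑ X) refl (⊆∁beyond W ∷ [])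

  closed⇒⊆E : ∀ {x X} → Closed M x X → X ⊆ E M
  closed⇒⊆E {x} {X} cl {e} e∈X = case e ∈? E M of λ where
    (yes e∈E) → e∈E
    (no e∉E)  → contradiction (≤-trans (cl e∈X) (≤-reflexive (cong (r M) (⊆-antisym
      (sets (∁ (X ∪ ⁅ x ⁆) ∷ ⁅ e ⁆ ∷ E M ∷ []) (λ Y e E → e ⊑ ~ E ∷ [] ⊢ (Y ⊔ e) ⊓ E ⊑ Y ⊓ E) refl (∉! e∉E ∷ []))
      (sets (∁ (X ∪ ⁅ x ⁆) ∷ ⁅ e ⁆ ∷ E M ∷ []) (λ Y e E → [] ⊢ Y ⊓ E ⊑ (Y ⊔ e) ⊓ E) refl [])))))
      (ℕₚ.n≮n _)

-- Simplification of a contraction.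

module Simplification {n} (Q : Matroid n) (loopless : ∀ {e} → e ∈ E Q → 1 ≤ rk Q ⁅ e ⁆) where

  open Rank Q

  redundant : Subset n
  redundant = comprehension (redundant? Q)

  E-si⁺ : ∀ {e} → e ∈ E Q → ¬ Redundant Q e → e ∈ E (si Q)
  E-si⁺ e∈E ¬red = ∈-─⁺ e∈E (¬red ∘ ∈-comprehension⁻ (redundant? Q))

  E-si⁻ : ∀ {e} → e ∈ E (si Q) → e ∈ E Q × ¬ Redundant Q e
  E-si⁻ e∈ = proj₁ (∈-─⁻ e∈) , proj₂ (∈-─⁻ e∈) ∘ ∈-comprehension⁺ (redundant? Q)

  Near : Fin n → Fin n → Set
  Near e g = ρ (⁅ e ⁆ ∪ ⁅ g ⁆) ≤ 1

  near-trans : ∀ {e f g} → f ∈ E Q → Near e f → Near f g → Near e g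
  near-trans {e} {f} {g} f∈E ef fg = estimate Q (⁅ e ⁆ ∷ ⁅ f ⁆ ∷ ⁅ g ⁆ ∷ [])
    (λ e f g → [] ∣ ϱ (e ⊔ f) ≼ # 1 ∷ ϱ (f ⊔ g) ≼ # 1 ∷ # 1 ≼ ϱ f ∷ [] by (e ⊔ f , f ⊔ g) ∷ []
      ⊩ ϱ (e ⊔ g) ≼ # 1)
    refl [] (ef ∷ fg ∷ loopless f∈E ∷ [])

  near-sym : ∀ {e f} → Near e f → Near f e
  near-sym {e} {f} = subst (_≤ 1) (cong ρ (∪-comm ⁅ e ⁆ ⁅ f ⁆))

  parallel⇒near : ∀ {e f} → Parallel Q e f → (e ∈ E Q × f ∈ E Q) × Near e f
  parallel⇒near {e} {f} (e≢f , (ef⊆E , dep) , _) =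
    (ef⊆E (p⊆p∪q ⁅ f ⁆ (x∈⁅x⁆ e)) , ef⊆E (q⊆p∪q ⁅ e ⁆ ⁅ f ⁆ (x∈⁅x⁆ f))) ,
    ℕ.s≤s⁻¹ (ℕₚ.≤∧≢⇒< ≤2 λ eq → dep (trans (sym (ρ-⊆E ef⊆E)) (trans eq (sym ∣ef∣))))
    where
    disjoint : ∣ ⁅ e ⁆ ∩ ⁅ f ⁆ ∣ ≡ 0
    disjoint = trans (cong ∣_∣ (Empty-unique λ { (z , z∈) → let z∈e , z∈f = x∈p∩q⁻ ⁅ e ⁆ ⁅ f ⁆ z∈ in
      e≢f (trans (sym (x∈⁅y⁆⇒x≡y e z∈e)) (x∈⁅y⁆⇒x≡y f z∈f)) })) (∣⊥∣≡0 n)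
    ∣ef∣ : ∣ ⁅ e ⁆ ∪ ⁅ f ⁆ ∣ ≡ 2
    ∣ef∣ = trans (sym (ℕₚ.+-identityʳ _)) (trans (cong (∣ ⁅ e ⁆ ∪ ⁅ f ⁆ ∣ +_) (sym disjoint))
      (trans (∣∪∣+∣∩∣ ⁅ e ⁆ ⁅ f ⁆) (cong₂ _+_ (∣⁅x⁆∣≡1 e) (∣⁅x⁆∣≡1 f))))
    ≤2 : ρ (⁅ e ⁆ ∪ ⁅ f ⁆) ≤ 2
    ≤2 = estimate Q (⁅ e ⁆ ∷ ⁅ f ⁆ ∷ []) (λ e f → [] ∣ ϱ e ≼ # 1 ∷ ϱ f ≼ # 1 ∷ [] by (e , f) ∷ [] ⊩ ϱ (e ⊔ f) ≼ # 2)
      refl [] (ρ-⁅⁆ e ∷ ρ-⁅⁆ f ∷ [])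

  independent-⊂ : ∀ {e f X} → e ∈ E Q → f ∈ E Q → e ≢ f → X ⊂ ⁅ e ⁆ ∪ ⁅ f ⁆ → Independent Q X
  independent-⊂ {e} {f} {X} e∈E f∈E e≢f (X⊆ , z , z∈ , z∉X) = X⊆E , trans (sym (ρ-⊆E X⊆E))
    (≤-antisym (≤-trans (rk-≤-∣∣ Q X) (∣p∩q∣≤∣p∣ X (E Q))) (∣X∣≤ (nonempty? X)))
    where
    X⊆E : X ⊆ E Q
    X⊆E = ∪-⊆ (∈! e∈E) (∈! f∈E) ∘ X⊆
    missing : ∀ {w} → w ∈ X → (w ≡ e × z ≡ f) ⊎ (w ≡ f × z ≡ e)
    missing {w} w∈X with x∈p∪q⁻ ⁅ e ⁆ ⁅ f ⁆ (X⊆ w∈X) | x∈p∪q⁻ ⁅ e ⁆ ⁅ f ⁆ z∈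
    ... | inj₁ w∈e | inj₂ z∈f = inj₁ (x∈⁅y⁆⇒x≡y e w∈e , x∈⁅y⁆⇒x≡y f z∈f)
    ... | inj₂ w∈f | inj₁ z∈e = inj₂ (x∈⁅y⁆⇒x≡y f w∈f , x∈⁅y⁆⇒x≡y e z∈e)
    ... | inj₁ w∈e | inj₁ z∈e = contradiction (subst (_∈ X) (trans (x∈⁅y⁆⇒x≡y e w∈e) (sym (x∈⁅y⁆⇒x≡y e z∈e))) w∈X) z∉X
    ... | inj₂ w∈f | inj₂ z∈f = contradiction (subst (_∈ X) (trans (x∈⁅y⁆⇒x≡y f w∈f) (sym (x∈⁅y⁆⇒x≡y f z∈f))) w∈X) z∉X
    same : ∀ {v w} → v ∈ X → w ∈ X → v ≡ w
    same v∈X w∈X with missing v∈X | missing w∈X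
    ... | inj₁ (p , _) | inj₁ (q , _) = trans p (sym q)
    ... | inj₂ (p , _) | inj₂ (q , _) = trans p (sym q)
    ... | inj₁ (_ , p) | inj₂ (_ , q) = contradiction (trans (sym q) p) e≢f
    ... | inj₂ (_ , p) | inj₁ (_ , q) = contradiction (trans (sym p) q) e≢f
    ∣X∣≤ : Dec (Nonempty X) → ∣ X ∣ ≤ ρ X
    ∣X∣≤ (no ¬ne) = ≤-trans (≤-reflexive (trans (cong ∣_∣ (Empty-unique ¬ne)) (∣⊥∣≡0 n))) z≤n
    ∣X∣≤ (yes (w , w∈X)) = ≤-trans (≮⇒≥ λ 2≤ → let a , b , a≢b , a∈ , b∈ = 1<∣∣⁻ X 2≤ in a≢b (same a∈ b∈))
      (≤-trans (loopless (X⊆E w∈X)) (ρ-mono (∈! w∈X)))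

  near⇒parallel : ∀ {e f} → e ∈ E Q → f ∈ E Q → e ≢ f → Near e f → Parallel Q e f
  near⇒parallel {e} {f} e∈E f∈E e≢f ef = e≢f , (ef⊆E , λ eq → <⇒≱
      (≤-trans (1<∣∣ e≢f (p⊆p∪q ⁅ f ⁆ (x∈⁅x⁆ e)) (q⊆p∪q ⁅ e ⁆ ⁅ f ⁆ (x∈⁅x⁆ f)))
        (≤-reflexive (trans (sym eq) (sym (ρ-⊆E ef⊆E))))) ef) ,
      independent-⊂ e∈E f∈E e≢f
    where
    ef⊆E : ⁅ e ⁆ ∪ ⁅ f ⁆ ⊆ E Q
    ef⊆E = ∪-⊆ (∈! e∈E) (∈! f∈E)

  si-simple : ∀ {e f} → e ∈ E (si Q) → f ∈ E (si Q) → e ≢ f → 2 ≤ ρ (⁅ e ⁆ ∪ ⁅ f ⁆)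
  si-simple {e} {f} e∈ f∈ e≢f = ≰⇒> λ ef → case Finₚ.<-cmp e f of λ where
    (tri< e<f _ _) → proj₂ (E-si⁻ f∈) (inj₂ (e , e<f ,
      near⇒parallel (proj₁ (E-si⁻ e∈)) (proj₁ (E-si⁻ f∈)) e≢f ef))
    (tri≈ _ e≡f _) → e≢f e≡f
    (tri> _ _ f<e) → proj₂ (E-si⁻ e∈) (inj₂ (f , f<e ,
      near⇒parallel (proj₁ (E-si⁻ f∈)) (proj₁ (E-si⁻ e∈)) (e≢f ∘ sym) (near-sym {e} {f} ef)))

  Representative : Fin n → Set
  Representative e = ∃ λ g → g ∈ E (si Q) × Near e g

  -- A redundant element is parallel to one of smaller index, and the descent along indices ends at
  -- an element that `si` keeps.
  representative : ∀ {e} → e ∈ E Q → Representative e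
  representative {e} e∈E = go (suc (toℕ e)) e ℕₚ.≤-refl e∈E
    where
    go : ∀ s e → toℕ e < s → e ∈ E Q → Representative e
    go (suc s) e e<s e∈E = choose (redundant? Q e)
      where
      step : ∀ {f} → f Fin.< e → Parallel Q f e → Representative f → Representative e
      step {f} f<e par (g , g∈ , fg) =
        g , g∈ , near-trans (proj₁ (proj₁ (parallel⇒near par))) (near-sym {f} {e} (proj₂ (parallel⇒near par))) fg
      choose : Dec (Redundant Q e) → Representative e
      choose (no ¬red) = e , E-si⁺ e∈E ¬red , ≤-trans (≤-reflexive (cong ρ (∪-idem ⁅ e ⁆))) (ρ-⁅⁆ e)
      choose (yes (inj₁ ((e⊆E , dep) , _))) =
        contradiction (trans (sym (ρ-⊆E e⊆E)) (trans (≤-antisym (ρ-⁅⁆ e) (loopless e∈E)) (sym (∣⁅x⁆∣≡1 e)))) dep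
      choose (yes (inj₂ (f , f<e , par))) =
        step f<e par (go s f (ℕₚ.<-≤-trans f<e (ℕ.s≤s⁻¹ e<s)) (proj₁ (proj₁ (parallel⇒near par))))

  rk-si : ∀ {S} → S ⊆ E (si Q) → rk (si Q) S ≡ ρ S
  rk-si {S} S⊆ = trans (rk-╲ Q redundant S) (ρ-cong (p─q⊆p S redundant)
    (λ z∈ → ∈-─⁺ z∈ (proj₂ (∈-─⁻ {p = E Q} (S⊆ z∈)))))

  absorb-near : ∀ {e g} S → e ∈ E Q → e ∈ S → Near e g → ρ (S ∪ ⁅ g ⁆) ≤ ρ S
  absorb-near {e} {g} S e∈E e∈S eg = estimate Q (S ∷ ⁅ e ⁆ ∷ ⁅ g ⁆ ∷ [])
    (λ S e g → e ⊑ S ∷ [] ∣ ϱ (e ⊔ g) ≼ # 1 ∷ # 1 ≼ ϱ e ∷ [] by (S , e ⊔ g) ∷ [] ⊩ ϱ (S ⊔ g) ≼ ϱ S)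
    refl (∈! e∈S ∷ []) (eg ∷ loopless e∈E ∷ [])

  pick : ∀ {e} → Dec (e ∈ E Q) → Fin n
  pick (yes p)    = proj₁ (representative p)
  pick {e} (no _) = e

  rep : Fin n → Fin n
  rep e = pick (e ∈? E Q)

  rep-spec : ∀ {e} → e ∈ E Q → rep e ∈ E (si Q) × Near e (rep e)
  rep-spec {e} e∈E = go (e ∈? E Q)
    where
    go : (d : Dec (e ∈ E Q)) → pick d ∈ E (si Q) × Near e (pick d)
    go (yes p) = proj₂ (representative p)
    go (no ¬p) = contradiction e∈E ¬p

  ρ-image-rep : ∀ {S} → S ⊆ E Q → ρ (image rep S) ≡ ρ S
  ρ-image-rep {S} S⊆E = ≤-antisym
    (≤-trans (ρ-mono (q⊆p∪q S (image rep S))) (ρ-absorb S (image rep S) λ g∈ →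
      let e , e∈S , e↦g = ∈-image⁻ rep S g∈ in
      absorb-near S (S⊆E e∈S) e∈S (subst (Near e) e↦g (proj₂ (rep-spec (S⊆E e∈S))))))
    (≤-trans (ρ-mono (q⊆p∪q (image rep S) S)) (ρ-absorb (image rep S) S λ {e} e∈S →
      absorb-near {g = e} (image rep S) (proj₁ (E-si⁻ (proj₁ (rep-spec (S⊆E e∈S))))) (∈-image⁺ rep e∈S)
        (near-sym {e} (proj₂ (rep-spec (S⊆E e∈S))))))

  -- Every element of the copy of N moves to the representative of its parallel class, which changes
  -- no rank. Elements of N stay distinct because N is simple, and stay off the contracted set
  -- because N has no loops.
  si-embedding : {N : Matroid m} → ThreeConnected N → 4 ≤ ∣ E N ∣ → Embedding Q N → Embedding (si Q) N
  si-embedding {m} {N} N3 4≤ e = record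
    { f = rep ∘ f ; C = image rep C
    ; C⊆E = image-⊆ rep C (proj₁ ∘ rep-spec ∘ C⊆E)
    ; f∈E = proj₁ ∘ rep-spec ∘ f∈E
    ; f∉C = λ {i} i∈ rfi∈ → f-not-in i∈ (∈-image⁻ rep C rfi∈)
    ; f-inj = λ {i} {j} i∈ j∈ eq → f-injective i∈ j∈ eq (i ≟ᶠ j)
    ; rank = λ {Y} Y⊆ → begin
        rk (si Q) (image (rep ∘ f) Y ∪ image rep C)
          ≡⟨ rk-si (∪-⊆ (image-⊆ (rep ∘ f) Y (proj₁ ∘ rep-spec ∘ f∈E ∘ Y⊆)) (image-⊆ rep C (proj₁ ∘ rep-spec ∘ C⊆E))) ⟩
        ρ (image (rep ∘ f) Y ∪ image rep C)
          ≡⟨ cong ρ (images Y) ⟩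
        ρ (image rep (image f Y ∪ C))
          ≡⟨ ρ-image-rep (∪-⊆ (image-⊆ f Y (f∈E ∘ Y⊆)) C⊆E) ⟩
        ρ (image f Y ∪ C)
          ≡⟨ rank Y⊆ ⟩
        r N Y + ρ C
          ≡⟨ cong (r N Y +_) (sym (ρ-image-rep C⊆E)) ⟩
        r N Y + ρ (image rep C)
          ≡⟨ cong (r N Y +_) (sym (rk-si (image-⊆ rep C (proj₁ ∘ rep-spec ∘ C⊆E)))) ⟩
        r N Y + rk (si Q) (image rep C) ∎
    }
    where
    open Embedding e
    open ≡-Reasoning
    open MinorSides Q N N3 4≤
    module N = Rank N
    images : ∀ Y → image (rep ∘ f) Y ∪ image rep C ≡ image rep (image f Y ∪ C)
    images Y = ⊆-antisym
      (∪-⊆ (image-⊆ (rep ∘ f) Y (λ i∈ → ∈-image⁺ rep (p⊆p∪q C (∈-image⁺ f i∈))))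
           (image-⊆ rep C (∈-image⁺ rep ∘ q⊆p∪q (image f Y) C)))
      (image-⊆ rep (image f Y ∪ C) λ {z} z∈ → [ (λ z∈F → let i , i∈Y , fi≡z = ∈-image⁻ f Y z∈F in
          p⊆p∪q (image rep C) (subst (λ w → rep w ∈ image (rep ∘ f) Y) fi≡z (∈-image⁺ (rep ∘ f) i∈Y))) ,
        q⊆p∪q (image (rep ∘ f) Y) (image rep C) ∘ ∈-image⁺ rep ]′ (x∈p∪q⁻ (image f Y) C z∈))
    near-rep : ∀ {a b} → a ∈ E Q → b ∈ E Q → rep a ≡ rep b → Near a b
    near-rep {a} {b} a∈E b∈E eq = near-trans (proj₁ (E-si⁻ (proj₁ (rep-spec a∈E)))) (proj₂ (rep-spec a∈E))
      (near-sym {b} (subst (Near b) (sym eq) (proj₂ (rep-spec b∈E))))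
    f-not-in : ∀ {i} → i ∈ E N → ¬ (∃ λ c → c ∈ C × rep c ≡ rep (f i))
    f-not-in {i} i∈ (c , c∈C , eq) = <⇒≱ (unspanned e i∈)
      (≤-trans (≤-reflexive (cong ρ (∪-comm ⁅ f i ⁆ C)))
        (absorb-near C (C⊆E c∈C) c∈C (near-rep (C⊆E c∈C) (f∈E i∈) eq)))
    f-injective : ∀ {i j} → i ∈ E N → j ∈ E N → rep (f i) ≡ rep (f j) → Dec (i ≡ j) → i ≡ j
    f-injective i∈ j∈ eq (yes i≡j) = i≡j
    f-injective {i} {j} i∈ j∈ eq (no i≢j) = contradiction
      (+-cancelʳ-≤ (ρ C) 2 1 (≤-trans two one)) λ { (s≤s ()) }
      where
      ij⊆ : ⁅ i ⁆ ∪ ⁅ j ⁆ ⊆ E N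
      ij⊆ = ∪-⊆ (∈! i∈) (∈! j∈)
      two : 2 + ρ C ≤ ρ ((⁅ f i ⁆ ∪ ⁅ f j ⁆) ∪ C)
      two = ≤-trans (+-monoˡ-≤ (ρ C) (Simple.1<ρ-pair N N3 4≤ i∈ j∈ i≢j))
        (≤-trans (≤-reflexive (trans (cong (_+ ρ C) (N.ρ-⊆E ij⊆)) (sym (rank ij⊆))))
          (ρ-mono (∪-mono (image-⊆ f (⁅ i ⁆ ∪ ⁅ j ⁆) λ {k} k∈ →
            [ (λ k∈i → p⊆p∪q ⁅ f j ⁆ (subst (λ w → f k ∈ ⁅ f w ⁆) (x∈⁅y⁆⇒x≡y i k∈i) (x∈⁅x⁆ (f k)))) ,
              (λ k∈j → q⊆p∪q ⁅ f i ⁆ ⁅ f j ⁆ (subst (λ w → f k ∈ ⁅ f w ⁆) (x∈⁅y⁆⇒x≡y j k∈j) (x∈⁅x⁆ (f k)))) ]′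
              (x∈p∪q⁻ ⁅ i ⁆ ⁅ j ⁆ k∈)) id)))
      one : ρ ((⁅ f i ⁆ ∪ ⁅ f j ⁆) ∪ C) ≤ 1 + ρ C
      one = estimate Q (⁅ f i ⁆ ∷ ⁅ f j ⁆ ∷ C ∷ [])
        (λ a b C → [] ∣ ϱ (a ⊔ b) ≼ # 1 ∷ [] by (a ⊔ b , C) ∷ [] ⊩ ϱ ((a ⊔ b) ⊔ C) ≼ # 1 ⊕ ϱ C)
        refl [] (near-rep (f∈E i∈) (f∈E j∈) eq ∷ [])

module Contraction {n} (M : Matroid n) (M3 : ThreeConnected M) (4≤∣E∣ : 4 ≤ ∣ E M ∣)
  {x : Fin n} (x∈E : x ∈ E M) where

  open Rank M
  open ThreeConnected M3
  open Simple M M3 4≤∣E∣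
  open Partitions M M3 4≤∣E∣

  private
    Q : Matroid n
    Q = M / ⁅ x ⁆

  ρx≡1 : ρ ⁅ x ⁆ ≡ 1
  ρx≡1 = ≤-antisym (ρ-⁅⁆ x) (0<ρ⁅⁆ x∈E)

  rk-/x : ∀ S → rk Q S + 1 ≡ ρ (S ∪ ⁅ x ⁆)
  rk-/x S = trans (cong (rk Q S +_) (sym ρx≡1)) (rk-/ M ⁅ x ⁆ S)

  loopless : ∀ {e} → e ∈ E Q → 1 ≤ rk Q ⁅ e ⁆
  loopless {e} e∈ = +-cancelʳ-≤ 1 1 (rk Q ⁅ e ⁆)
    (≤-trans (1<ρ-pair (proj₁ (∈--⁻ e∈)) x∈E (proj₂ (∈--⁻ e∈) ∘ sym)) (≤-reflexive (sym (rk-/x ⁅ e ⁆))))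

  open Simplification Q loopless

  -- The elements removed by `si` are put back: what `Y ∪ ⁅ x ⁆` spans joins its side, and the
  -- remainder is spanned by `X ∪ ⁅ x ⁆`. Order 1 contradicts the 3-connectivity of M; at order 2,
  -- two nonparallel elements of M / x on each side give rank 3 together with `x`.
  separation⇒vertical : Sep (si Q) → ∃ λ X → Vertical M x X
  separation⇒vertical (k , X , 1≤k , k<3 , _ , X⊆ , conn< , k≤X , k≤Y) = by-order k 1≤k k<3 k≤X k≤Y sum≤
    where
    Y Xx Yx U : Subset n
    Y  = E (si Q) ─ X
    Xx = X ∪ ⁅ x ⁆
    Yx = Y ∪ ⁅ x ⁆
    U  = beyond Yx
    Y⊆ : Y ⊆ E (si Q)
    Y⊆ = p─q⊆p (E (si Q)) X
    sum< : rk Q X + rk Q Y < rk Q ⊤ + k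
    sum< = begin-strict
      rk Q X + rk Q Y               ≡⟨ cong₂ _+_ (sym (rk-si X⊆)) (sym (rk-si Y⊆)) ⟩
      rk (si Q) X + rk (si Q) Y     ≤⟨ +-monoʳ-≤ (rk (si Q) X) (rk-mono (si Q)
                                         (sets (X ∷ E (si Q) ∷ []) (λ X E → [] ⊢ E ∖ X ⊑ ~ X) refl [])) ⟩
      rk (si Q) X + rk (si Q) (∁ X) <⟨ Rank.<-conn (si Q) k X⊆ conn< ⟩
      rk (si Q) ⊤ + k               ≡⟨ cong (_+ k) (rk-╲ Q redundant ⊤) ⟩
      rk Q (⊤ ─ redundant) + k      ≤⟨ +-monoˡ-≤ k (rk-mono Q λ _ → ∈⊤) ⟩
      rk Q ⊤ + k ∎
      where open ℕₚ.≤-Reasoning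
    sum≤ : ρ Xx + ρ Yx ≤ ρ ⊤ + k
    sum≤ = begin
      ρ Xx + ρ Yx                          ≡⟨ cong₂ _+_ (sym (rk-/x X)) (sym (rk-/x Y)) ⟩
      (rk Q X + 1) + (rk Q Y + 1)          ≡⟨ +-swap (rk Q X) 1 (rk Q Y) 1 ⟩
      (rk Q X + rk Q Y) + 2                ≡⟨ ℕₚ.+-suc _ 1 ⟩
      suc (rk Q X + rk Q Y) + 1            ≤⟨ +-monoˡ-≤ 1 sum< ⟩
      (rk Q ⊤ + k) + 1                     ≡⟨ +-assoc (rk Q ⊤) k 1 ⟩
      rk Q ⊤ + (k + 1)                     ≡⟨ cong (rk Q ⊤ +_) (+-comm k 1) ⟩
      rk Q ⊤ + (1 + k)                     ≡⟨ sym (+-assoc (rk Q ⊤) 1 k) ⟩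
      (rk Q ⊤ + 1) + k                     ≡⟨ cong (_+ k) (rk-/x ⊤) ⟩
      ρ (⊤ ∪ ⁅ x ⁆) + k                    ≤⟨ +-monoˡ-≤ k (ρ-mono λ _ → ∈⊤) ⟩
      ρ ⊤ + k ∎
      where open ℕₚ.≤-Reasoning
    big₁ : ∀ {S} → S ⊆ E (si Q) → 1 ≤ ∣ S ∣ → 2 ≤ ρ (S ∪ ⁅ x ⁆)
    big₁ {S} S⊆ 1≤S = go (0<∣∣⁻ S 1≤S)
      where
      go : Nonempty S → 2 ≤ ρ (S ∪ ⁅ x ⁆)
      go (a , a∈S) = ≤-trans (+-monoˡ-≤ 1 (≤-trans (loopless (proj₁ (E-si⁻ (S⊆ a∈S)))) (rk-mono Q (∈! a∈S))))
        (≤-reflexive (rk-/x S))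
    big₂ : ∀ {S} → S ⊆ E (si Q) → 2 ≤ ∣ S ∣ → 3 ≤ ρ (S ∪ ⁅ x ⁆)
    big₂ {S} S⊆ 2≤S = go (1<∣∣⁻ S 2≤S)
      where
      go : Pair S → 3 ≤ ρ (S ∪ ⁅ x ⁆)
      go (a , b , a≢b , a∈S , b∈S) = ≤-trans
        (+-monoˡ-≤ 1 (≤-trans (si-simple (S⊆ a∈S) (S⊆ b∈S) a≢b) (rk-mono Q (∪-⊆ (∈! a∈S) (∈! b∈S)))))
        (≤-reflexive (rk-/x S))
    x∈Xx : x ∈ Xx
    x∈Xx = q⊆p∪q X ⁅ x ⁆ (x∈⁅x⁆ x)
    x∈Yx : x ∈ Yx
    x∈Yx = q⊆p∪q Y ⁅ x ⁆ (x∈⁅x⁆ x)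
    absorb-rep : ∀ {e g} S → g ∈ E Q → g ∈ S → x ∈ S → Near e g → ρ (S ∪ ⁅ e ⁆) ≤ ρ S
    absorb-rep {e} {g} S g∈ g∈S x∈S eg = estimate M (S ∷ ⁅ e ⁆ ∷ ⁅ g ⁆ ∷ ⁅ x ⁆ ∷ [])
      (λ S e g x → g ⊑ S ∷ x ⊑ S ∷ []
        ∣ ϱ ((e ⊔ g) ⊔ x) ≼ # 2 ∷ # 2 ≼ ϱ (g ⊔ x) ∷ [] by (S , (e ⊔ g) ⊔ x) ∷ [] ⊩ ϱ (S ⊔ e) ≼ ϱ S)
      refl (∈! g∈S ∷ ∈! x∈S ∷ [])
      (≤-trans (≤-reflexive (sym (rk-/x _))) (+-monoˡ-≤ 1 eg) ∷
       1<ρ-pair (proj₁ (∈--⁻ g∈)) x∈E (proj₂ (∈--⁻ g∈) ∘ sym) ∷ [])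
    -- An element beyond `Yx` has its representative in `X`, for a representative in `Y` would put
    -- it in the span of `Yx`.
    spanX : ρ (Xx ∪ U) ≤ ρ Xx
    spanX = ρ-absorb Xx U λ {e} e∈U → in-E e∈U (e ∈? E M)
      where
      with-rep : ∀ {e} → e ∈ U → Representative e → ρ (Xx ∪ ⁅ e ⁆) ≤ ρ Xx
      with-rep {e} e∈U (g , g∈ , eg) = side (g ∈? X)
        where
        side : Dec (g ∈ X) → ρ (Xx ∪ ⁅ e ⁆) ≤ ρ Xx
        side (yes g∈X) = absorb-rep Xx (proj₁ (E-si⁻ g∈)) (p⊆p∪q ⁅ x ⁆ g∈X) x∈Xx eg
        side (no g∉X)  = contradiction (∈-comprehension⁻ (unspanned? Yx) e∈U) (ℕₚ.≤⇒≯
          (absorb-rep Yx (proj₁ (E-si⁻ g∈)) (p⊆p∪q ⁅ x ⁆ (∈-─⁺ g∈ g∉X)) x∈Yx eg))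
      in-E : ∀ {e} → e ∈ U → Dec (e ∈ E M) → ρ (Xx ∪ ⁅ e ⁆) ≤ ρ Xx
      in-E {e} e∈U (yes e∈E) = with-rep e∈U (representative (∈-─⁺ e∈E
        λ e∈x → x∈p⇒x∉∁p e∈U (⊆∁beyond Yx (subst (_∈ Yx) (sym (x∈⁅y⁆⇒x≡y x e∈x)) x∈Yx))))
      in-E {e} e∈U (no e∉E) = ≤-reflexive (cong (r M) (⊆-antisym
        (sets (Xx ∷ ⁅ e ⁆ ∷ E M ∷ []) (λ X e E → e ⊑ ~ E ∷ [] ⊢ (X ⊔ e) ⊓ E ⊑ X ⊓ E) refl (∉! e∉E ∷ []))
        (sets (Xx ∷ ⁅ e ⁆ ∷ E M ∷ []) (λ X e E → [] ⊢ X ⊓ E ⊑ (X ⊔ e) ⊓ E) refl [])))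
    by-order : ∀ k → 1 ≤ k → k < 3 → k ≤ ∣ X ∣ → k ≤ ∣ Y ∣ → ρ Xx + ρ Yx ≤ ρ ⊤ + k → ∃ λ X → Vertical M x X
    by-order 1 _ _ 1≤X 1≤Y sum = go (0<∣∣⁻ Y 1≤Y)
      where
      go : Nonempty Y → ∃ λ X → Vertical M x X
      go (c , c∈Y) = contradiction (estimate M (Xx ∷ Yx ∷ U ∷ [])
        (λ X Y U → [] ∣ ϱ X ⊕ ϱ Y ≼ ϱ ● ⊕ # 1 ∷ ϱ (X ⊔ U) ≼ ϱ X ∷ ϱ ● ⊕ # 2 ≼ ϱ U ⊕ ϱ Y ∷ [] by [] ⊩ # 1 ≼ # 0)
        refl [] (sum ∷ spanX ∷ beyond-conn Yx (proj₁ c∈) x∈E (proj₂ c∈ ∘ sym) (p⊆p∪q ⁅ x ⁆ c∈Y) x∈Yx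
          (estimate M (Xx ∷ Yx ∷ [])
            (λ X Y → [] ∣ ϱ X ⊕ ϱ Y ≼ ϱ ● ⊕ # 1 ∷ # 2 ≼ ϱ X ∷ [] by [] ⊩ # 1 ⊕ ϱ Y ≼ ϱ ●)
            refl [] (sum ∷ big₁ X⊆ 1≤X ∷ [])) ∷ [])) λ ()
        where
        c∈ : c ∈ E M × x ≢ c
        c∈ = ∈--⁻ (proj₁ (E-si⁻ (Y⊆ c∈Y)))
    by-order 2 _ _ 2≤X 2≤Y sum = U , proj₁ (beyond-vertical Xx Yx x∈E x∈Xx x∈Yx sum (big₂ X⊆ 2≤X) (big₂ Y⊆ 2≤Y) spanX)
    by-order (suc (suc (suc _))) _ (s≤s (s≤s (s≤s ())))

  connected-or-vertical : Connected 3 (si Q) ⊎ ∃ λ X → Vertical M x X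
  connected-or-vertical = [ inj₁ , inj₂ ∘ separation⇒vertical ]′ (connected₃? (si Q))

  minor-of-si : {N : Matroid m} → ThreeConnected N → 4 ≤ ∣ E N ∣ →
                (e : Embedding M N) → x ∈ Embedding.C e → si Q HasMinor N
  minor-of-si N3 4≤ e x∈C = embedding⇒hasMinor (si-embedding N3 4≤ (lower-/ e (∈! x∈C)))

-- Hyperplane complements and uncrossing.

record HyperplaneComplement (M : Matroid n) (D : Subset n) : Set where
  field
    D⊆E  : D ⊆ E M
    nonspanning : 1 + rk M (∁ D) ≤ rk M ⊤
    spanning⁺   : ∀ {e} → e ∈ D → rk M ⊤ ≤ rk M (∁ D ∪ ⁅ e ⁆)

record CocircuitLine (M : Matroid n) (N : Matroid m) (C* : Subset n) : Set where
  field
    x z       : Fin n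
    L         : Subset n
    x∈C*      : x ∈ C*
    x∈L       : x ∈ L
    L⊆E       : L ⊆ E M
    ρL≤2      : rk M L ≤ 2
    flat      : ∀ {e} → e ∈ E M → e ∉ L → 3 ≤ rk M (L ∪ ⁅ e ⁆)
    3≤∣L∣     : 3 ≤ ∣ L ∣
    z∈E       : z ∈ E M
    z∉L       : z ∉ L
    cocircuit : HyperplaneComplement M ((L - x) ∪ ⁅ z ⁆)
    embedding : Embedding M N
    L⊆C       : L ⊆ Embedding.C embedding

module Verticals {n} (M : Matroid n) (M3 : ThreeConnected M) (4≤∣E∣ : 4 ≤ ∣ E M ∣) where

  open Rank M
  open ThreeConnected M3
  open Partitions M M3 4≤∣E∣

  conn-two : ∀ S → Two (∁ S) → 2 ≤ ρ S → ρ ⊤ + 2 ≤ ρ S + ρ (∁ S)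
  conn-two S (c , d , c≢d , (c∉S , c∈E) , (d∉S , d∈E)) 2≤S = go (1<ρ⇒∃ S 2≤S)
    where
    go : Two S → ρ ⊤ + 2 ≤ ρ S + ρ (∁ S)
    go (a , b , a≢b , (a∈S , a∈E) , (b∈S , b∈E)) =
      conn₂ S a∈E b∈E c∈E d∈E a≢b c≢d a∈S b∈S (x∈∁p⇒x∉p c∉S) (x∈∁p⇒x∉p d∉S)

  module VerticalFacts {x X} (v : Vertical M x X) where

    open Vertical v public

    Y : Subset n
    Y = ∁ (X ∪ ⁅ x ⁆)

    span∁ : ρ (∁ X) ≤ ρ Y
    span∁ = estimate M (X ∷ ⁅ x ⁆ ∷ [])
      (λ X x → [] ∣ ϱ (~ (X ⊔ x) ⊔ x) ≼ ϱ (~ (X ⊔ x)) ∷ [] by [] ⊩ ϱ (~ X) ≼ ϱ (~ (X ⊔ x))) refl [] (spanʸ ∷ [])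

    sepX : ρ X + ρ (∁ X) ≤ ρ ⊤ + 2
    sepX = ≤-trans (+-monoʳ-≤ (ρ X) span∁) sep

    sepXx : ρ (X ∪ ⁅ x ⁆) + ρ Y ≤ ρ ⊤ + 2
    sepXx = ≤-trans (+-monoˡ-≤ (ρ Y) spanˣ) sep

    sepXx∁X : ρ (X ∪ ⁅ x ⁆) + ρ (∁ X) ≤ ρ ⊤ + 2
    sepXx∁X = ≤-trans (+-monoʳ-≤ (ρ (X ∪ ⁅ x ⁆)) span∁) sepXx

    two-outside : Two (∁ X)
    two-outside = two-mono (sets (X ∷ ⁅ x ⁆ ∷ []) (λ X x → [] ⊢ ~ (X ⊔ x) ⊑ ~ X) refl [])
      (1<ρ⇒∃ Y (≤-trans (ℕₚ.n≤1+n 2) 3≤ʸ))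

    conn-X : ρ ⊤ + 2 ≤ ρ X + ρ (∁ X)
    conn-X = conn-two X two-outside (≤-trans (ℕₚ.n≤1+n 2) 3≤ˣ)

    unspanned-by-∁ : Closed M x X → ∀ {y} → y ∈ X → 1 + ρ (∁ X) ≤ ρ (∁ X ∪ ⁅ y ⁆)
    unspanned-by-∁ cl {y} y∈X = estimate M (X ∷ ⁅ x ⁆ ∷ ⁅ y ⁆ ∷ [])
      (λ X x y → [] ∣ ϱ (~ X) ≼ ϱ (~ (X ⊔ x)) ∷ # 1 ⊕ ϱ (~ (X ⊔ x)) ≼ ϱ (~ (X ⊔ x) ⊔ y) ∷ [] by []
        ⊩ # 1 ⊕ ϱ (~ X) ≼ ϱ (~ X ⊔ y)) refl [] (span∁ ∷ cl y∈X ∷ [])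

    module RankThree (cl : Closed M x X) (ρX≤3 : ρ X ≤ 3) where

      -- `ρ (∁ X)` is squeezed to one less than the rank of M: from above by `3 ≤ ρ X` and the
      -- separation, from below by `ρ X ≤ 3` and connectivity. Any element of `X` adds the missing
      -- one.
      hyperplaneComplement : HyperplaneComplement M X
      hyperplaneComplement = record
        { D⊆E = closed⇒⊆E cl
        ; nonspanning = estimate M (X ∷ [])
            (λ X → [] ∣ # 3 ≼ ϱ X ∷ ϱ X ⊕ ϱ (~ X) ≼ ϱ ● ⊕ # 2 ∷ [] by [] ⊩ # 1 ⊕ ϱ (~ X) ≼ ϱ ●)
            refl [] (3≤ˣ ∷ sepX ∷ [])
        ; spanning⁺ = λ {y} y∈X → estimate M (X ∷ ⁅ y ⁆ ∷ [])
            (λ X y → [] ∣ ϱ X ≼ # 3 ∷ ϱ ● ⊕ # 2 ≼ ϱ X ⊕ ϱ (~ X) ∷ # 1 ⊕ ϱ (~ X) ≼ ϱ (~ X ⊔ y) ∷ [] by []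
              ⊩ ϱ ● ≼ ϱ (~ X ⊔ y))
            refl [] (ρX≤3 ∷ conn-X ∷ unspanned-by-∁ cl y∈X ∷ []) }

module Uncrossing {n m} (M : Matroid n) (M3 : ThreeConnected M) (4≤∣E∣ : 4 ≤ ∣ E M ∣)
  (N : Matroid m) (N3 : ThreeConnected N) (4≤∣EN∣ : 4 ≤ ∣ E N ∣)
  (C* : Subset n) (hyp : HyperplaneComplement M C*) where

  open Rank M
  open Simple M M3 4≤∣E∣
  open Partitions M M3 4≤∣E∣
  open Verticals M M3 4≤∣E∣
  open MinorSides M N N3 4≤∣EN∣
  open HyperplaneComplement hyp

  Outcome : Set
  Outcome = (Σ[ x ∈ Fin n ] x ∈ C* × Connected 3 (si (M / ⁅ x ⁆)) ×
              Σ[ e ∈ Embedding M N ] x ∈ Embedding.C e)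
          ⊎ CocircuitLine M N C*

  -- The shape in which the descent along vertical 3-partitions ends.

  module FromLine {x X} (x∈C* : x ∈ C*) (v : Vertical M x X) (cl : Closed M x X)
    (e : Embedding M N) (x∈C : x ∈ Embedding.C e) (small : Small e X)
    {L z g g′} (x∈L : x ∈ L) (z∈X : z ∈ X) (z∉L : z ∉ L) (L⊆ : L ⊆ X ∪ ⁅ x ⁆) (X⊆ : X ⊆ L ∪ ⁅ z ⁆)
    (ρL≤2 : ρ L ≤ 2) (g∈L : g ∈ L) (g′∈L : g′ ∈ L) (g≢g′ : g ≢ g′) (g≢x : g ≢ x) (g′≢x : g′ ≢ x) where

    open VerticalFacts v

    X⊆E : X ⊆ E M
    X⊆E = closed⇒⊆E cl

    L⊆E : L ⊆ E M
    L⊆E = ∪-⊆ X⊆E (∈! x∈E) ∘ L⊆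

    g∈X : g ∈ X
    g∈X = [ id , (λ g∈x → contradiction (x∈⁅y⁆⇒x≡y x g∈x) g≢x) ]′ (x∈p∪q⁻ X ⁅ x ⁆ (L⊆ g∈L))

    ρX≤3 : ρ X ≤ 3
    ρX≤3 = estimate M (X ∷ L ∷ ⁅ z ⁆ ∷ [])
      (λ X L z → X ⊑ L ⊔ z ∷ [] ∣ ϱ L ≼ # 2 ∷ ϱ z ≼ # 1 ∷ [] by (L , z) ∷ [] ⊩ ϱ X ≼ # 3)
      refl (X⊆ ∷ []) (ρL≤2 ∷ ρ-⁅⁆ z ∷ [])

    X≡ : X ≡ (L - x) ∪ ⁅ z ⁆
    X≡ = ⊆-antisym
      (sets (X ∷ L ∷ ⁅ x ⁆ ∷ ⁅ z ⁆ ∷ []) (λ X L x z → X ⊑ L ⊔ z ∷ x ⊑ ~ X ∷ [] ⊢ X ⊑ (L ∖ x) ⊔ z)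
        refl (X⊆ ∷ ∉! x∉X ∷ []))
      (sets (X ∷ L ∷ ⁅ x ⁆ ∷ ⁅ z ⁆ ∷ []) (λ X L x z → L ⊑ X ⊔ x ∷ z ⊑ X ∷ [] ⊢ (L ∖ x) ⊔ z ⊑ X)
        refl (L⊆ ∷ ∈! z∈X ∷ []))

    -- If `f` is in `X`, it can only be `z`, and then `L ∪ ⁅ f ⁆` contains `X`, of rank at least 3.
    -- If `f` is off `X` and on the line, then `x` and `f`, both off `X`, span `g` in `X`, which
    -- `cl` forbids.
    flat : ∀ {f} → f ∈ E M → f ∉ L → 3 ≤ ρ (L ∪ ⁅ f ⁆)
    flat {f} f∈E f∉L = cases (f ∈? X)
      where
      cases : Dec (f ∈ X) → 3 ≤ ρ (L ∪ ⁅ f ⁆)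
      cases (yes f∈X) = ≤-trans 3≤ˣ (ρ-mono (subst (λ w → X ⊆ L ∪ ⁅ w ⁆) z≡f X⊆))
        where
        z≡f : z ≡ f
        z≡f = [ (λ f∈L → contradiction f∈L f∉L) , (λ f∈z → sym (x∈⁅y⁆⇒x≡y z f∈z)) ]′ (x∈p∪q⁻ L ⁅ z ⁆ (X⊆ f∈X))
      cases (no f∉X) = ≰⇒> λ ≤2 → 1+n≰n {0} (estimate M (X ∷ L ∷ ⁅ x ⁆ ∷ ⁅ f ⁆ ∷ ⁅ g ⁆ ∷ [])
        (λ X L x f g → f ⊑ ~ X ∷ x ⊑ ~ X ∷ x ⊑ L ∷ g ⊑ L ∷ []
          ∣ ϱ (L ⊔ f) ≼ # 2 ∷ # 2 ≼ ϱ (x ⊔ f) ∷ # 1 ⊕ ϱ (~ X) ≼ ϱ (~ X ⊔ g) ∷ []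
          by (L ⊔ f , ~ X) ∷ [] ⊩ # 1 ≼ # 0)
        refl (∉! f∉X ∷ ∉! x∉X ∷ ∈! x∈L ∷ ∈! g∈L ∷ [])
        (≤2 ∷ 1<ρ-pair x∈E f∈E (λ { refl → f∉L x∈L }) ∷ unspanned-by-∁ cl g∈X ∷ []))

    -- Once `x` and `g` are contracted, the rest of the line is spanned and `enlarge` adds it.
    contracted : Σ[ e′ ∈ Embedding M N ] L ⊆ Embedding.C e′
    contracted = go (contract-unspanned e X⊆E x∈C x∉X (0<ρ⁅⁆ x∈E) sepXx∁X small g∈X (unspanned-by-∁ cl g∈X))
      where
      go : (Σ[ e′ ∈ Embedding M N ] x ∈ Embedding.C e′ × g ∈ Embedding.C e′ × Small e′ X) →
           Σ[ e′ ∈ Embedding M N ] L ⊆ Embedding.C e′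
      go (e′ , x∈C′ , g∈C′ , _) =
        let e″ , C⊆ = enlarge e′ L⊆E (estimate M (Embedding.C e′ ∷ L ∷ ⁅ x ⁆ ∷ ⁅ g ⁆ ∷ [])
              (λ C L x g → x ⊑ C ∷ g ⊑ C ∷ x ⊑ L ∷ g ⊑ L ∷ []
                ∣ ϱ L ≼ # 2 ∷ # 2 ≼ ϱ (g ⊔ x) ∷ [] by (C , L) ∷ [] ⊩ ϱ (C ⊔ L) ≼ ϱ C)
              refl (∈! x∈C′ ∷ ∈! g∈C′ ∷ ∈! x∈L ∷ ∈! g∈L ∷ []) (ρL≤2 ∷ 1<ρ-pair (L⊆E g∈L) x∈E g≢x ∷ []))
        in e″ , C⊆ ∘ q⊆p∪q (Embedding.C e′) L

    cocircuitLine : CocircuitLine M N C*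
    cocircuitLine = record
      { x = x ; z = z ; L = L ; x∈C* = x∈C* ; x∈L = x∈L ; L⊆E = L⊆E ; ρL≤2 = ρL≤2 ; flat = flat
      ; 3≤∣L∣ = 2<∣∣ g≢g′ g≢x g′≢x g∈L g′∈L x∈L
      ; z∈E = X⊆E z∈X ; z∉L = z∉L
      ; cocircuit = subst (HyperplaneComplement M) X≡ (RankThree.hyperplaneComplement cl ρX≤3)
      ; embedding = proj₁ contracted ; L⊆C = proj₂ contracted }

  -- Four elements of N, at most one in each set, leave two outside both. They are the elements
  -- beyond a union of two sides that the connectivity bound asks for.
  two-of-N : (e : Embedding M N) {S T : Subset n} → Small e S → Small e T →
             ∃₂ λ c d → c ≢ d × (c ∈ E M × c ∉ Embedding.C e × c ∉ S × c ∉ T) ×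
                                (d ∈ E M × d ∉ Embedding.C e × d ∉ S × d ∉ T)
  two-of-N e {S} {T} smallS smallT = go (1<∣∣⁻ R 2≤R)
    where
    open Embedding e
    in? : ∀ S i → Dec (i ∈ E N × f i ∈ S)
    in? S i = (i ∈? E N) ×-dec (f i ∈? S)
    S′ T′ R : Subset m
    S′ = comprehension (in? S)
    T′ = comprehension (in? T)
    R  = E N ─ (S′ ∪ T′)
    ≤1 : ∀ S → Small e S → ∣ comprehension (in? S) ∣ ≤ 1
    ≤1 S small = ≮⇒≥ λ 2≤ → clash (1<∣∣⁻ _ 2≤)
      where
      clash : ¬ Pair (comprehension (in? S))
      clash (a , b , a≢b , a∈ , b∈) = let a∈E , fa∈ = ∈-comprehension⁻ (in? S) a∈
                                          b∈E , fb∈ = ∈-comprehension⁻ (in? S) b∈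
                                      in a≢b (small a∈E b∈E fa∈ fb∈)
    2≤R : 2 ≤ ∣ R ∣
    2≤R = ℕₚ.+-cancelˡ-≤ 2 2 ∣ R ∣ (begin
      4                              ≤⟨ 4≤∣EN∣ ⟩
      ∣ E N ∣                        ≤⟨ p⊆q⇒∣p∣≤∣q∣ (⊆∪─ (E N) (S′ ∪ T′)) ⟩
      ∣ (S′ ∪ T′) ∪ R ∣              ≤⟨ ∪-card (S′ ∪ T′) R ⟩
      ∣ S′ ∪ T′ ∣ + ∣ R ∣            ≤⟨ +-monoˡ-≤ ∣ R ∣ (∪-card S′ T′) ⟩
      (∣ S′ ∣ + ∣ T′ ∣) + ∣ R ∣      ≤⟨ +-monoˡ-≤ ∣ R ∣ (+-mono-≤ (≤1 S smallS) (≤1 T smallT)) ⟩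
      2 + ∣ R ∣ ∎)
      where
      open ℕₚ.≤-Reasoning
      ∪-card : (p q : Subset m) → ∣ p ∪ q ∣ ≤ ∣ p ∣ + ∣ q ∣
      ∪-card p q = ≤-trans (ℕₚ.m≤m+n _ ∣ p ∩ q ∣) (≤-reflexive (∣∪∣+∣∩∣ p q))
    not-in : ∀ {i} → i ∈ R → f i ∈ E M × f i ∉ C × f i ∉ S × f i ∉ T
    not-in i∈R = let i∈E , i∉ = ∈-─⁻ {p = E N} i∈R in f∈E i∈E , f∉C i∈E ,
      (λ fi∈S → i∉ (p⊆p∪q T′ (∈-comprehension⁺ (in? S) (i∈E , fi∈S)))) ,
      (λ fi∈T → i∉ (q⊆p∪q S′ T′ (∈-comprehension⁺ (in? T) (i∈E , fi∈T))))
    go : Pair R → _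
    go (a , b , a≢b , a∈R , b∈R) = f a , f b ,
      (λ eq → a≢b (f-inj (proj₁ (∈-─⁻ {p = E N} a∈R)) (proj₁ (∈-─⁻ {p = E N} b∈R)) eq)) , not-in a∈R , not-in b∈R

  -- Uncrossing a 3-separating set S with a vertical 3-partition at y ∈ S.

  module Part {y A} (v : Vertical M y A) {S : Subset n} (y∈S : y ∈ S)
    (sepS : ρ S + ρ (∁ S) ≤ ρ ⊤ + 2) (out : Two (∁ (S ∪ (A ∪ ⁅ y ⁆)))) where

    open VerticalFacts v renaming (x∈E to y∈E; x∉X to y∉A; sepXx to sepAy; Y to B)

    W : Subset n
    W = S ∩ A

    y∉W : y ∉ W
    y∉W = y∉A ∘ p∩q⊆q S A

    conn-∪ : ρ ⊤ + 2 ≤ ρ (S ∪ (A ∪ ⁅ y ⁆)) + ρ (∁ (S ∪ (A ∪ ⁅ y ⁆)))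
    conn-∪ = conn-two _ out (≤-trans (≤-trans (ℕₚ.n≤1+n 2) 3≤ˣ)
      (ρ-mono (sets (S ∷ A ∷ ⁅ y ⁆ ∷ []) (λ S A y → [] ⊢ A ⊑ S ⊔ (A ⊔ y)) refl [])))

    -- Submodularity of the connectivity function: the union of `S` and `A ∪ ⁅ y ⁆` has connectivity
    -- at least 2 by `conn-∪`, so the intersection, which is `W ∪ ⁅ y ⁆` because `y` is in `S`, has
    -- at most 2.
    sepWy : ρ (W ∪ ⁅ y ⁆) + ρ (∁ (W ∪ ⁅ y ⁆)) ≤ ρ ⊤ + 2
    sepWy = estimate M (S ∷ A ∷ ⁅ y ⁆ ∷ [])
      (λ S A y → y ⊑ S ∷ []
        ∣ ϱ S ⊕ ϱ (~ S) ≼ ϱ ● ⊕ # 2 ∷ ϱ (A ⊔ y) ⊕ ϱ (~ (A ⊔ y)) ≼ ϱ ● ⊕ # 2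
        ∷ ϱ ● ⊕ # 2 ≼ ϱ (S ⊔ (A ⊔ y)) ⊕ ϱ (~ (S ⊔ (A ⊔ y))) ∷ []
        by (S , A ⊔ y) ∷ (~ S , ~ (A ⊔ y)) ∷ []
        ⊩ ϱ ((S ⊓ A) ⊔ y) ⊕ ϱ (~ ((S ⊓ A) ⊔ y)) ≼ ϱ ● ⊕ # 2)
      refl (∈! y∈S ∷ []) (sepS ∷ sepAy ∷ conn-∪ ∷ [])

    span-rest : ρ (∁ (W ∪ ⁅ y ⁆) ∪ ⁅ y ⁆) ≤ ρ (∁ (W ∪ ⁅ y ⁆))
    span-rest = estimate M (S ∷ A ∷ ⁅ y ⁆ ∷ [])
      (λ S A y → y ⊑ ~ A ∷ [] ∣ ϱ (~ (A ⊔ y) ⊔ y) ≼ ϱ (~ (A ⊔ y)) ∷ []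
        by (~ ((S ⊓ A) ⊔ y) , ~ (A ⊔ y) ⊔ y) ∷ []
        ⊩ ϱ (~ ((S ⊓ A) ⊔ y) ⊔ y) ≼ ϱ (~ ((S ⊓ A) ⊔ y)))
      refl (∉! y∉A ∷ []) (spanʸ ∷ [])

    conn-W : 2 ≤ ρ W → ρ ⊤ + 2 ≤ ρ W + ρ (∁ W)
    conn-W = conn-two W (two-mono
      (sets (S ∷ A ∷ ⁅ y ⁆ ∷ []) (λ S A y → [] ⊢ ~ (S ⊔ (A ⊔ y)) ⊑ ~ (S ⊓ A)) refl []) out)

    -- Otherwise moving `y` to the other side, which spans it already, would bring the connectivity
    -- of `W` below 2.
    spanned : 2 ≤ ρ W → ρ (W ∪ ⁅ y ⁆) ≤ ρ W
    spanned 2≤W = estimate M (W ∷ ⁅ y ⁆ ∷ [])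
      (λ W y → y ⊑ ~ W ∷ []
        ∣ ϱ (W ⊔ y) ⊕ ϱ (~ (W ⊔ y)) ≼ ϱ ● ⊕ # 2 ∷ ϱ (~ (W ⊔ y) ⊔ y) ≼ ϱ (~ (W ⊔ y))
        ∷ ϱ ● ⊕ # 2 ≼ ϱ W ⊕ ϱ (~ W) ∷ [] by [] ⊩ ϱ (W ⊔ y) ≼ ϱ W)
      refl (∉! y∉W ∷ []) (sepWy ∷ span-rest ∷ conn-W 2≤W ∷ [])

    vertical : 3 ≤ ρ W → Vertical M y W
    vertical 3≤W = record
      { x∈E = y∈E ; x∉X = y∉W
      ; sep = ≤-trans (+-monoˡ-≤ (ρ (∁ (W ∪ ⁅ y ⁆))) (ρ-mono (p⊆p∪q ⁅ y ⁆))) sepWy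
      ; spanˣ = spanned (≤-trans (ℕₚ.n≤1+n 2) 3≤W)
      ; spanʸ = span-rest ; 3≤ˣ = 3≤W
      ; 3≤ʸ = ≤-trans 3≤ʸ (ρ-mono
          (sets (S ∷ A ∷ ⁅ y ⁆ ∷ []) (λ S A y → [] ⊢ ~ (A ⊔ y) ⊑ ~ ((S ⊓ A) ⊔ y)) refl []))
      }

    line : ρ W ≤ 2 → ρ (W ∪ ⁅ y ⁆) ≤ 2
    line W≤2 = cases (2 ℕ.≤? ρ W)
      where
      cases : Dec (2 ≤ ρ W) → ρ (W ∪ ⁅ y ⁆) ≤ 2
      cases (yes 2≤W) = ≤-trans (spanned 2≤W) W≤2
      cases (no  2≰W) = ≤-trans (ρ-∪⁅⁆ W y) (+-monoˡ-≤ 1 (ℕ.s≤s⁻¹ (≰⇒> 2≰W)))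

-- Descent to a smaller vertical 3-partition.

module Search {n m} (M : Matroid n) (M3 : ThreeConnected M) (4≤∣E∣ : 4 ≤ ∣ E M ∣)
  (N : Matroid m) (N3 : ThreeConnected N) (4≤∣EN∣ : 4 ≤ ∣ E N ∣)
  (C* : Subset n) (hyp : HyperplaneComplement M C*) where

  open Rank M
  open Simple M M3 4≤∣E∣
  open Partitions M M3 4≤∣E∣
  open MinorSides M N N3 4≤∣EN∣
  open Verticals M M3 4≤∣E∣
  open Uncrossing M M3 4≤∣E∣ N N3 4≤∣EN∣ C* hyp
  open HyperplaneComplement hyp

  -- The induction hypothesis. It quantifies over `x` and over the copy of N, because the descent
  -- passes to another element of `C*`, for which the copy has to be changed.
  Searchable : ℕ → Set
  Searchable s = ∀ {x X} → ∣ X ∣ < s → x ∈ C* → Vertical M x X → Closed M x X →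
                 (e : Embedding M N) → x ∈ Embedding.C e → Small e X → Outcome

  -- X ∪ {x} is covered by a line through x, y and g, and a line through y and h.

  record TwoLines (x y : Fin n) (X : Subset n) : Set where
    field
      A     : Subset n
      x∈A   : x ∈ A
      y∉A   : y ∉ A
      line₁ : ρ (((X ∪ ⁅ x ⁆) ∩ A) ∪ ⁅ y ⁆) ≤ 2
      line₂ : ρ (X ─ A) ≤ 2
      g h   : Fin n
      g∈X   : g ∈ X
      g∈A   : g ∈ A
      h∈X   : h ∈ X
      h∉A   : h ∉ A
      h≢y   : h ≢ y

  module Step {s x X} (search : Searchable s) (X≤s : ∣ X ∣ ≤ s) (v : Vertical M x X) (cl : Closed M x X)
    {y} (y∈X : y ∈ X) (y∈C* : y ∈ C*) (e : Embedding M N)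
    (x∈C : x ∈ Embedding.C e) (y∈C : y ∈ Embedding.C e) (small : Small e X) where

    open VerticalFacts v

    Xx : Subset n
    Xx = X ∪ ⁅ x ⁆

    sepXx′ : ρ Xx + ρ (∁ Xx) ≤ ρ ⊤ + 2
    sepXx′ = sepXx

    y∈E : y ∈ E M
    y∈E = closed⇒⊆E cl y∈X

    x≢y : x ≢ y
    x≢y refl = x∉X y∈X

    descend : ∀ {W} → ∣ W ∣ < ∣ X ∣ → Vertical M y W → Small e W → Outcome
    descend {W} W<X vW smallW = go (close vW)
      where
      go : (Σ[ W′ ∈ Subset n ] W′ ⊆ W × Vertical M y W′ × Closed M y W′) → Outcome
      go (W′ , W′⊆W , v′ , cl′) = search (ℕₚ.≤-<-trans (p⊆q⇒∣p∣≤∣q∣ W′⊆W) (ℕₚ.<-≤-trans W<X X≤s))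
        y∈C* v′ cl′ e y∈C (λ i∈ j∈ fi∈ fj∈ → smallW i∈ j∈ (W′⊆W fi∈) (W′⊆W fj∈))

    module WithPart {A} (vA : Vertical M y A) where

      y∉A : y ∉ A
      y∉A = Vertical.x∉X vA

      ∣X∩A∣<∣X∣ : ∣ X ∩ A ∣ < ∣ X ∣
      ∣X∩A∣<∣X∣ = p⊂q⇒∣p∣<∣q∣ (p∩q⊆p X A , y , y∈X , y∉A ∘ p∩q⊆q X A)

      -- `x` may enter when `y` leaves, which would be no gain; losing `h` as well makes the
      -- inequality strict.
      ∣Xx∩A∣<∣X∣ : ∀ {h} → h ∈ X → h ∉ A → h ≢ y → ∣ Xx ∩ A ∣ < ∣ X ∣
      ∣Xx∩A∣<∣X∣ {h} h∈X h∉A h≢y = ℕ.s≤s⁻¹ (begin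
        suc (suc ∣ Xx ∩ A ∣)                        ≤⟨ s≤s (s≤s (∣p∣≤1+∣p-x∣ (Xx ∩ A) x)) ⟩
        suc (suc (suc ∣ (Xx ∩ A) - x ∣))            ≤⟨ s≤s (s≤s (s≤s (p⊆q⇒∣p∣≤∣q∣
            (sets (X ∷ A ∷ ⁅ x ⁆ ∷ ⁅ y ⁆ ∷ ⁅ h ⁆ ∷ [])
              (λ X A x y h → y ⊑ ~ A ∷ h ⊑ ~ A ∷ [] ⊢ ((X ⊔ x) ⊓ A) ∖ x ⊑ (X ∖ y) ∖ h)
              refl (∉! y∉A ∷ ∉! h∉A ∷ []))))) ⟩
        suc (suc (suc ∣ (X - y) - h ∣))             ≤⟨ s≤s (s≤s (x∈p⇒∣p-x∣<∣p∣
                                                          (∈--⁺ h∈X h≢y))) ⟩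
        suc (suc ∣ X - y ∣)                         ≤⟨ s≤s (x∈p⇒∣p-x∣<∣p∣ y∈X) ⟩
        suc ∣ X ∣ ∎)
        where open ℕₚ.≤-Reasoning

      small-Xx : Small e (Xx ∩ A)
      small-Xx i∈ j∈ fi∈ fj∈ = small i∈ j∈ (strip i∈ fi∈) (strip j∈ fj∈)
        where
        open Embedding e
        strip : ∀ {i} → i ∈ E N → f i ∈ Xx ∩ A → f i ∈ X
        strip {i} i∈ fi∈ = [ id , (λ fi∈x → contradiction (subst (_∈ C) (sym (x∈⁅y⁆⇒x≡y x fi∈x)) x∈C) (f∉C i∈)) ]′
          (x∈p∪q⁻ X ⁅ x ⁆ (p∩q⊆p Xx A fi∈))

      -- X ∩ A is a smaller set to search in, unless it lies on a line.

      part : Two (∁ (X ∪ (A ∪ ⁅ y ⁆))) → Outcome ⊎ ρ (X ∩ A) ≤ 2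
      part out = cases (3 ℕ.≤? ρ (X ∩ A))
        where
        open Part vA y∈X sepX out
        cases : Dec (3 ≤ ρ (X ∩ A)) → Outcome ⊎ ρ (X ∩ A) ≤ 2
        cases (yes 3≤) = inj₁ (descend ∣X∩A∣<∣X∣ (vertical 3≤)
          (λ i∈ j∈ fi∈ fj∈ → small i∈ j∈ (p∩q⊆p X A fi∈) (p∩q⊆p X A fj∈)))
        cases (no 3≰) = inj₂ (ℕ.s≤s⁻¹ (≰⇒> 3≰))

      part-x : Two (∁ (Xx ∪ (A ∪ ⁅ y ⁆))) → ∀ {h} → h ∈ X → h ∉ A → h ≢ y →
               Outcome ⊎ ρ ((Xx ∩ A) ∪ ⁅ y ⁆) ≤ 2
      part-x out h∈X h∉A h≢y = cases (3 ℕ.≤? ρ (Xx ∩ A))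
        where
        open Part vA (p⊆p∪q ⁅ x ⁆ y∈X) sepXx′ out
        cases : Dec (3 ≤ ρ (Xx ∩ A)) → Outcome ⊎ ρ ((Xx ∩ A) ∪ ⁅ y ⁆) ≤ 2
        cases (yes 3≤) = inj₁ (descend (∣Xx∩A∣<∣X∣ h∈X h∉A h≢y) (vertical 3≤) small-Xx)
        cases (no 3≰)  = inj₂ (line (ℕ.s≤s⁻¹ (≰⇒> 3≰)))

      beyond-part : Two (∁ (X ∪ (A ∪ ⁅ y ⁆))) → ρ (X ∩ A) ≤ 2 → ∃ λ h → h ∈ X × h ∉ A × h ≢ y
      beyond-part out X∩A≤2 = cases (nonempty? ((X ─ A) - y))
        where
        open Part vA y∈X sepX out
        cases : Dec (Nonempty ((X ─ A) - y)) → ∃ λ h → h ∈ X × h ∉ A × h ≢ y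
        cases (yes (h , h∈)) = h , proj₁ (∈-─⁻ (proj₁ (∈--⁻ h∈))) , proj₂ (∈-─⁻ (proj₁ (∈--⁻ h∈))) , proj₂ (∈--⁻ h∈) ∘ sym
        cases (no none) = contradiction (≤-trans 3≤ˣ (≤-trans (ρ-mono cover) (line X∩A≤2))) (ℕₚ.n≮n 2)
          where
          cover : X ⊆ (X ∩ A) ∪ ⁅ y ⁆
          cover = sets (X ∷ A ∷ ⁅ y ⁆ ∷ [])
            (λ X A y → (X ∖ A) ∖ y ⊑ ○ ∷ [] ⊢ X ⊑ (X ⊓ A) ⊔ y)
            refl ((λ z∈ → contradiction (_ , z∈) none) ∷ [])

    two-lines : ∀ {A} → Vertical M y A → x ∈ A → Two (∁ (Xx ∪ (A ∪ ⁅ y ⁆))) →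
                ρ (X ∩ A) ≤ 2 → ρ (X ─ A) ≤ 2 → (∃ λ g → g ∈ X × g ∈ A) → Outcome ⊎ TwoLines x y X
    two-lines {A} vA x∈A out X∩A≤2 X─A≤2 (g , g∈X , g∈A) =
      go (beyond-part (two-mono (sets (X ∷ ⁅ x ⁆ ∷ A ∷ ⁅ y ⁆ ∷ [])
            (λ X x A y → [] ⊢ ~ ((X ⊔ x) ⊔ (A ⊔ y)) ⊑ ~ (X ⊔ (A ⊔ y))) refl []) out) X∩A≤2)
      where
      open WithPart vA
      go : (∃ λ h → h ∈ X × h ∉ A × h ≢ y) → Outcome ⊎ TwoLines x y X
      go (h , h∈X , h∉A , h≢y) = [ inj₁ , (λ line → inj₂ record
        { A = A ; x∈A = x∈A ; y∉A = y∉A ; line₁ = line ; line₂ = X─A≤2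
        ; g = g ; h = h ; g∈X = g∈X ; g∈A = g∈A ; h∈X = h∈X ; h∉A = h∉A ; h≢y = h≢y }) ]′
        (part-x out h∈X h∉A h≢y)

    module _ {A} (vA : Vertical M y A) (clA : Closed M y A) (smallA : Small e A) where

      private
        B : Subset n
        B = ∁ (A ∪ ⁅ y ⁆)

        vB : Vertical M y B
        vB = swap-sides vA

        module PA = WithPart vA
        module PB = WithPart vB

        y∉A : y ∉ A
        y∉A = PA.y∉A

        A⊆E : A ⊆ E M
        A⊆E = closed⇒⊆E clA

        outA : Two (∁ (Xx ∪ (A ∪ ⁅ y ⁆)))
        outA = go (two-of-N e small smallA)
          where
          open Embedding e using (C)
          avoid : ∀ {c} → c ∉ C → c ∉ X → c ∉ A → c ∈ ∁ (Xx ∪ (A ∪ ⁅ y ⁆))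
          avoid {c} c∉C c∉X c∉A = ⁅⁆⊆⇒∈ (sets (X ∷ ⁅ x ⁆ ∷ A ∷ ⁅ y ⁆ ∷ C ∷ ⁅ c ⁆ ∷ [])
            (λ X x A y C c → c ⊑ ~ C ∷ c ⊑ ~ X ∷ c ⊑ ~ A ∷ x ⊑ C ∷ y ⊑ C ∷ [] ⊢ c ⊑ ~ ((X ⊔ x) ⊔ (A ⊔ y)))
            refl (∉! c∉C ∷ ∉! c∉X ∷ ∉! c∉A ∷ ∈! x∈C ∷ ∈! y∈C ∷ []))
          go : (∃₂ λ c d → c ≢ d × (c ∈ E M × c ∉ C × c ∉ X × c ∉ A) × (d ∈ E M × d ∉ C × d ∉ X × d ∉ A)) →
               Two (∁ (Xx ∪ (A ∪ ⁅ y ⁆)))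
          go (c , d , c≢d , (c∈E , c∉C , c∉X , c∉A) , (d∈E , d∉C , d∉X , d∉A)) =
            c , d , c≢d , (avoid c∉C c∉X c∉A , c∈E) , (avoid d∉C d∉X d∉A , d∈E)

        outA′ : Two (∁ (X ∪ (A ∪ ⁅ y ⁆)))
        outA′ = two-mono (sets (X ∷ ⁅ x ⁆ ∷ A ∷ ⁅ y ⁆ ∷ [])
          (λ X x A y → [] ⊢ ~ ((X ⊔ x) ⊔ (A ⊔ y)) ⊑ ~ (X ⊔ (A ⊔ y))) refl []) outA

        X─A≡ : X ─ A ⊆ (X ∩ B) ∪ ⁅ y ⁆
        X─A≡ = sets (X ∷ A ∷ ⁅ y ⁆ ∷ []) (λ X A y → [] ⊢ X ∖ A ⊑ (X ⊓ ~ (A ⊔ y)) ⊔ y) refl []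

        X─B≡ : X ─ B ⊆ (X ∩ A) ∪ ⁅ y ⁆
        X─B≡ = sets (X ∷ A ∷ ⁅ y ⁆ ∷ []) (λ X A y → [] ⊢ X ∖ ~ (A ⊔ y) ⊑ (X ⊓ A) ⊔ y) refl []

        -- If A has only one element outside X, then y and A have the shape of FromLine.

        pointed : ρ (X ∩ A) ≤ 2 → ∣ A ─ X ∣ ≤ 1 → Outcome
        pointed X∩A≤2 A─X≤1 = go₁ (nonempty? (A ─ X))
          where
          open Part vA y∈X sepX outA′ using (line)
          go₁ : Dec (Nonempty (A ─ X)) → Outcome
          go₁ (no none) = contradiction (≤-trans (Vertical.3≤ˣ vA) (≤-trans (ρ-mono A⊆) X∩A≤2)) (ℕₚ.n≮n 2)
            where
            A⊆ : A ⊆ X ∩ A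
            A⊆ = sets (X ∷ A ∷ []) (λ X A → A ∖ X ⊑ ○ ∷ [] ⊢ A ⊑ X ⊓ A)
                   refl ((λ z∈ → contradiction (_ , z∈) none) ∷ [])
          go₁ (yes (a , a∈)) = inj₂ (go₂ (1<ρ⇒∃ (X ∩ A) 2≤))
            where
            a∈A : a ∈ A
            a∈A = proj₁ (∈-─⁻ a∈)
            a∉X : a ∉ X
            a∉X = proj₂ (∈-─⁻ a∈)
            A─X⊆ : A ─ X ⊆ ⁅ a ⁆
            A─X⊆ {b} b∈ = case b ≟ᶠ a of λ where
              (yes refl) → x∈⁅x⁆ a
              (no b≢a) → contradiction (1<∣∣ b≢a b∈ a∈) (ℕₚ.≤⇒≯ A─X≤1)
            2≤ : 2 ≤ ρ (X ∩ A)
            2≤ = estimate M (X ∷ A ∷ ⁅ a ⁆ ∷ [])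
              (λ X A a → A ∖ X ⊑ a ∷ [] ∣ # 3 ≼ ϱ A ∷ ϱ a ≼ # 1 ∷ [] by (X ⊓ A , a) ∷ [] ⊩ # 2 ≼ ϱ (X ⊓ A))
              refl (A─X⊆ ∷ []) (Vertical.3≤ˣ vA ∷ ρ-⁅⁆ a ∷ [])
            go₂ : Two (X ∩ A) → CocircuitLine M N C*
            go₂ (g , g′ , g≢g′ , (g∈ , _) , (g′∈ , _)) =
              FromLine.cocircuitLine y∈C* vA clA e y∈C smallA {L = (X ∩ A) ∪ ⁅ y ⁆} {z = a}
                (q⊆p∪q (X ∩ A) ⁅ y ⁆ (x∈⁅x⁆ y)) a∈A
                ([ a∉X ∘ p∩q⊆p X A , (λ a∈y → y∉A (subst (_∈ A) (x∈⁅y⁆⇒x≡y y a∈y) a∈A)) ]′ ∘ x∈p∪q⁻ (X ∩ A) ⁅ y ⁆)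
                (sets (X ∷ A ∷ ⁅ y ⁆ ∷ []) (λ X A y → [] ⊢ (X ⊓ A) ⊔ y ⊑ A ⊔ y) refl [])
                (sets (X ∷ A ∷ ⁅ y ⁆ ∷ ⁅ a ⁆ ∷ []) (λ X A y a → A ∖ X ⊑ a ∷ [] ⊢ A ⊑ ((X ⊓ A) ⊔ y) ⊔ a)
                  refl (A─X⊆ ∷ []))
                (line X∩A≤2) (p⊆p∪q ⁅ y ⁆ g∈) (p⊆p∪q ⁅ y ⁆ g′∈) g≢g′
                (λ { refl → y∉A (p∩q⊆q X A g∈) }) (λ { refl → y∉A (p∩q⊆q X A g′∈) })

        in-other : ∀ {g} → g ∈ X → g ∉ A → g ≢ y → g ∈ B
        in-other g∈X g∉A g≢y = x∉p⇒x∈∁p ([ g∉A , g≢y ∘ x∈⁅y⁆⇒x≡y y ]′ ∘ x∈p∪q⁻ A ⁅ y ⁆)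

        -- Two elements of `A` off `X` lie outside the union of `X` with the other side `B`, so `B`
        -- can be uncrossed as well. Then `X ∩ A` and `X ∩ B` both lie on lines through `y`, and the
        -- side that contains `x` becomes the `A` of `TwoLines`.
        crossing : ρ (X ∩ A) ≤ 2 → Two (A ─ X) → Outcome ⊎ TwoLines x y X
        crossing X∩A≤2 outside-X = [ inj₁ , linesB ]′ (PB.part outB′)
          where
          outB′ : Two (∁ (X ∪ (B ∪ ⁅ y ⁆)))
          outB′ = two-mono (sets (X ∷ A ∷ ⁅ y ⁆ ∷ []) (λ X A y → y ⊑ X ⊓ ~ A ∷ [] ⊢ A ∖ X ⊑ ~ (X ⊔ (~ (A ⊔ y) ⊔ y)))
            refl ((λ z → x∈p∩q⁺ (∈! y∈X z , ∉! y∉A z)) ∷ [])) outside-X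
          linesB : ρ (X ∩ B) ≤ 2 → Outcome ⊎ TwoLines x y X
          linesB X∩B≤2 = side (x ∈? A)
            where
            X─A≤2 : ρ (X ─ A) ≤ 2
            X─A≤2 = ≤-trans (ρ-mono X─A≡) (Part.line vB y∈X sepX outB′ X∩B≤2)
            X─B≤2 : ρ (X ─ B) ≤ 2
            X─B≤2 = ≤-trans (ρ-mono X─B≡) (Part.line vA y∈X sepX outA′ X∩A≤2)
            in-A : (∃ λ g → g ∈ X × g ∉ B × g ≢ y) → ∃ λ g → g ∈ X × g ∈ A
            in-A (g , g∈X , g∉B , g≢y) = case g ∈? A of λ where
              (yes g∈A) → g , g∈X , g∈A
              (no g∉A)  → contradiction (in-other g∈X g∉A g≢y) g∉B
            in-B : (∃ λ g → g ∈ X × g ∉ A × g ≢ y) → ∃ λ g → g ∈ X × g ∈ B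
            in-B (g , g∈X , g∉A , g≢y) = g , g∈X , in-other g∈X g∉A g≢y
            side : Dec (x ∈ A) → Outcome ⊎ TwoLines x y X
            side (yes x∈A) = two-lines vA x∈A outA X∩A≤2 X─A≤2 (in-A (PB.beyond-part outB′ X∩B≤2))
            side (no x∉A)  = two-lines vB (x∉p⇒x∈∁p ([ x∉A , x≢y ∘ x∈⁅y⁆⇒x≡y y ]′ ∘ x∈p∪q⁻ A ⁅ y ⁆))
              (two-mono (sets (X ∷ A ∷ ⁅ x ⁆ ∷ ⁅ y ⁆ ∷ [])
                  (λ X A x y → x ⊑ ~ A ∷ y ⊑ X ⊓ ~ A ∷ [] ⊢ A ∖ X ⊑ ~ ((X ⊔ x) ⊔ (~ (A ⊔ y) ⊔ y)))
                  refl (∉! x∉A ∷ (λ z → x∈p∩q⁺ (∈! y∈X z , ∉! y∉A z)) ∷ [])) outside-X)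
              X∩B≤2 X─B≤2 (in-B (PA.beyond-part outA′ X∩A≤2))

      uncross : Outcome ⊎ TwoLines x y X
      uncross = [ inj₁ , (λ X∩A≤2 → cases X∩A≤2 (2 ℕ.≤? ∣ A ─ X ∣)) ]′ (PA.part outA′)
        where
        cases : ρ (X ∩ A) ≤ 2 → Dec (2 ≤ ∣ A ─ X ∣) → Outcome ⊎ TwoLines x y X
        cases X∩A≤2 (no 2≰) = inj₁ (pointed X∩A≤2 (ℕ.s≤s⁻¹ (≰⇒> 2≰)))
        cases X∩A≤2 (yes 2≤) = crossing X∩A≤2 (enlarged (1<∣∣⁻ (A ─ X) 2≤))
          where
          enlarged : Pair (A ─ X) → Two (A ─ X)
          enlarged (a , b , a≢b , a∈ , b∈) =
            a , b , a≢b , (a∈ , A⊆E (proj₁ (∈-─⁻ a∈))) , (b∈ , A⊆E (proj₁ (∈-─⁻ b∈)))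

-- Two crossing lines and the end of the descent.

module FindLine {n m} (M : Matroid n) (M3 : ThreeConnected M) (4≤∣E∣ : 4 ≤ ∣ E M ∣)
  (N : Matroid m) (N3 : ThreeConnected N) (4≤∣EN∣ : 4 ≤ ∣ E N ∣)
  (C* : Subset n) (hyp : HyperplaneComplement M C*) where

  open Rank M
  open Simple M M3 4≤∣E∣
  open Partitions M M3 4≤∣E∣
  open MinorSides M N N3 4≤∣EN∣
  open Verticals M M3 4≤∣E∣
  open Uncrossing M M3 4≤∣E∣ N N3 4≤∣EN∣ C* hyp
  open Search M M3 4≤∣E∣ N N3 4≤∣EN∣ C* hyp
  open HyperplaneComplement hyp

  -- Since N has no 2-separation, one of the sides holds at most one element of N. If it is the
  -- second side, the sides are exchanged before passing to the normal form.
  small-closed-side : ∀ {x X} → Vertical M x X → (e : Embedding M N) → x ∈ Embedding.C e →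
    Σ[ X′ ∈ Subset n ] Vertical M x X′ × Closed M x X′ × Small e X′
  small-closed-side {x} {X} v e x∈C = [ shrink v , (λ small → shrink (swap-sides v) (λ i∈ j∈ fi∈ fj∈ →
      small i∈ j∈ (∁⊆ fi∈) (∁⊆ fj∈))) ]′ (small-side e X x∈C x∉X (0<ρ⁅⁆ x∈E) sepXx∁X)
    where
    open VerticalFacts v
    ∁⊆ : ∁ (X ∪ ⁅ x ⁆) ⊆ ∁ X
    ∁⊆ = sets (X ∷ ⁅ x ⁆ ∷ []) (λ X x → [] ⊢ ~ (X ⊔ x) ⊑ ~ X) refl []
    shrink : ∀ {W} → Vertical M x W → Small e W → Σ[ X′ ∈ Subset n ] Vertical M x X′ × Closed M x X′ × Small e X′
    shrink {W} vW small = go (close vW)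
      where
      go : (Σ[ W′ ∈ Subset n ] W′ ⊆ W × Vertical M x W′ × Closed M x W′) →
           Σ[ X′ ∈ Subset n ] Vertical M x X′ × Closed M x X′ × Small e X′
      go (W′ , W′⊆W , v′ , cl′) = W′ , v′ , cl′ , λ i∈ j∈ fi∈ fj∈ → small i∈ j∈ (W′⊆W fi∈) (W′⊆W fj∈)

  outcome-or-vertical : ∀ {x} → x ∈ C* → (e : Embedding M N) → x ∈ Embedding.C e →
    Outcome ⊎ (Σ[ X ∈ Subset n ] Vertical M x X × Closed M x X × Small e X)
  outcome-or-vertical {x} x∈C* e x∈C =
    [ (λ conn → inj₁ (inj₁ (x , x∈C* , conn , e , x∈C))) ,
      (λ { (X , v) → inj₂ (small-closed-side v e x∈C) }) ]′
    (Contraction.connected-or-vertical M M3 4≤∣E∣ (D⊆E x∈C*))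

  module At {s x X} (search : Searchable s) (X≤s : ∣ X ∣ ≤ s) (x∈C* : x ∈ C*) (v : Vertical M x X) (cl : Closed M x X)
    (e : Embedding M N) (x∈C : x ∈ Embedding.C e) (small : Small e X) where

    open VerticalFacts v

    X⊆E : X ⊆ E M
    X⊆E = closed⇒⊆E cl

    lines : ∀ {y} → y ∈ X → y ∈ C* → Outcome ⊎ TwoLines x y X
    lines {y} y∈X y∈C* =
      go (contract-unspanned e X⊆E x∈C x∉X (0<ρ⁅⁆ x∈E) sepXx∁X small y∈X (unspanned-by-∁ cl y∈X))
      where
      go : (Σ[ e′ ∈ Embedding M N ] x ∈ Embedding.C e′ × y ∈ Embedding.C e′ × Small e′ X) → Outcome ⊎ TwoLines x y X
      go (e′ , x∈C′ , y∈C′ , small′) = [ inj₁ , (λ { (A , vA , clA , smallA) →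
        Step.uncross search X≤s v cl y∈X y∈C* e′ x∈C′ y∈C′ small′ vA clA smallA }) ]′
        (outcome-or-vertical y∈C* e′ y∈C′)

    -- C* meets X since x is spanned by X but not by the complement of C*.

    meets-C* : Nonempty (X ∩ C*)
    meets-C* = case nonempty? (X ∩ C*) of λ where
      (yes ne)  → ne
      (no none) → contradiction (estimate M (X ∷ C* ∷ ⁅ x ⁆ ∷ [])
        (λ X C x → X ⊓ C ⊑ ○ ∷ []
          ∣ ϱ (X ⊔ x) ≼ ϱ X ∷ # 1 ⊕ ϱ (~ C) ≼ ϱ ● ∷ ϱ ● ≼ ϱ (~ C ⊔ x) ∷ [] by (~ C , X ⊔ x) ∷ [] ⊩ # 1 ≼ # 0)
        refl ((λ z∈ → contradiction (_ , z∈) none) ∷ []) (spanˣ ∷ nonspanning ∷ spanning⁺ x∈C* ∷ [])) λ ()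

    module _ {y} (y∈X : y ∈ X) (y∈C* : y ∈ C*) (two : TwoLines x y X) where

      open TwoLines two

      private
        l₁ l₂ : Subset n
        l₁ = ((X ∪ ⁅ x ⁆) ∩ A) ∪ ⁅ y ⁆
        l₂ = X ─ A

        y∈E : y ∈ E M
        y∈E = X⊆E y∈X

        x≢y : x ≢ y
        x≢y refl = x∉X y∈X

        X⊆l₁∪l₂ : X ⊆ l₁ ∪ l₂
        X⊆l₁∪l₂ = sets (X ∷ A ∷ ⁅ x ⁆ ∷ ⁅ y ⁆ ∷ [])
          (λ X A x y → [] ⊢ X ⊑ (((X ⊔ x) ⊓ A) ⊔ y) ⊔ (X ∖ A)) refl []

        x∈l₁ : x ∈ l₁
        x∈l₁ = p⊆p∪q ⁅ y ⁆ (x∈p∩q⁺ (q⊆p∪q X ⁅ x ⁆ (x∈⁅x⁆ x) , x∈A))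

        y∈l₁ : y ∈ l₁
        y∈l₁ = q⊆p∪q ((X ∪ ⁅ x ⁆) ∩ A) ⁅ y ⁆ (x∈⁅x⁆ y)

        y∈l₂ : y ∈ l₂
        y∈l₂ = ∈-─⁺ y∈X y∉A

        -- The line l₂ contains y ∈ C*, so at most one of its points is off C*.

        not-both : ∀ {f} → f ∈ l₂ → f ≢ y → f ∉ C* → ∀ {f′} → f′ ∈ l₂ → f′ ≢ f → f′ ∈ C*
        not-both {f} f∈l₂ f≢y f∉C* {f′} f′∈l₂ f′≢f = case f′ ∈? C* of λ where
          (yes f′∈) → f′∈
          (no f′∉)  → contradiction (estimate M (C* ∷ l₂ ∷ ⁅ y ⁆ ∷ ⁅ f ⁆ ∷ ⁅ f′ ⁆ ∷ [])
            (λ C l y f f′ → f ⊑ ~ C ∷ f′ ⊑ ~ C ∷ f ⊑ l ∷ f′ ⊑ l ∷ y ⊑ l ∷ []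
              ∣ # 1 ⊕ ϱ (~ C) ≼ ϱ ● ∷ ϱ ● ≼ ϱ (~ C ⊔ y) ∷ ϱ l ≼ # 2 ∷ # 2 ≼ ϱ (f′ ⊔ f) ∷ []
              by (~ C , l) ∷ [] ⊩ # 1 ≼ # 0)
            refl (∉! f∉C* ∷ ∉! f′∉ ∷ ∈! f∈l₂ ∷ ∈! f′∈l₂ ∷ ∈! y∈l₂ ∷ [])
            (nonspanning ∷ spanning⁺ y∈C* ∷ line₂ ∷
              1<ρ-pair (X⊆E (p─q⊆p X A f′∈l₂)) (X⊆E (p─q⊆p X A f∈l₂)) f′≢f ∷ [])) λ ()

        -- The line through x and f has a third point, so it would be l₁ or l₂.

        third-line : ∀ {f} → f ∈ l₂ → f ≢ y → TwoLines x f X → Outcome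
        third-line {f} f∈l₂ f≢y two′ = contradiction (collapse (x∈p∪q⁻ l₁ l₂ (X⊆l₁∪l₂ g′∈X))) (<⇒≱ 3≤ˣ)
          where
          open TwoLines two′ renaming (A to A′; y∉A to f∉A′; line₁ to line₃; g to g′; g∈X to g′∈X; g∈A to g′∈A′; x∈A to x∈A′)
            using ()
          l₃ : Subset n
          l₃ = ((X ∪ ⁅ x ⁆) ∩ A′) ∪ ⁅ f ⁆
          x∈l₃ : x ∈ l₃
          x∈l₃ = p⊆p∪q ⁅ f ⁆ (x∈p∩q⁺ (q⊆p∪q X ⁅ x ⁆ (x∈⁅x⁆ x) , x∈A′))
          g′∈l₃ : g′ ∈ l₃
          g′∈l₃ = p⊆p∪q ⁅ f ⁆ (x∈p∩q⁺ (p⊆p∪q ⁅ x ⁆ g′∈X , g′∈A′))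
          f∈l₃ : f ∈ l₃
          f∈l₃ = q⊆p∪q ((X ∪ ⁅ x ⁆) ∩ A′) ⁅ f ⁆ (x∈⁅x⁆ f)
          f∈E : f ∈ E M
          f∈E = X⊆E (p─q⊆p X A f∈l₂)
          collapse : g′ ∈ l₁ ⊎ g′ ∈ l₂ → ρ X ≤ 2
          collapse (inj₁ g′∈l₁) = estimate M (X ∷ l₁ ∷ l₂ ∷ l₃ ∷ ⁅ x ⁆ ∷ ⁅ y ⁆ ∷ ⁅ f ⁆ ∷ ⁅ g′ ⁆ ∷ [])
            (λ X l₁ l₂ l₃ x y f g → x ⊑ l₁ ⊓ l₃ ∷ g ⊑ l₁ ⊓ l₃ ∷ y ⊑ l₁ ⊓ l₂ ∷ f ⊑ l₂ ⊓ l₃ ∷ X ⊑ l₁ ⊔ l₂ ∷ []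
              ∣ ϱ l₁ ≼ # 2 ∷ ϱ l₂ ≼ # 2 ∷ ϱ l₃ ≼ # 2 ∷ # 2 ≼ ϱ (x ⊔ g) ∷ # 2 ≼ ϱ (y ⊔ f) ∷ []
              by (l₁ , l₃) ∷ (l₁ ⊔ l₃ , l₂) ∷ [] ⊩ ϱ X ≼ # 2)
            refl (∩! x∈l₁ x∈l₃ ∷ ∩! g′∈l₁ g′∈l₃ ∷ ∩! y∈l₁ y∈l₂ ∷ ∩! f∈l₂ f∈l₃ ∷ X⊆l₁∪l₂ ∷ [])
            (line₁ ∷ line₂ ∷ line₃ ∷ 1<ρ-pair x∈E (X⊆E g′∈X) (λ { refl → x∉X g′∈X }) ∷
             1<ρ-pair y∈E f∈E (f≢y ∘ sym) ∷ [])
            where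
            ∩! : ∀ {w p q} → w ∈ p → w ∈ q → ⁅ w ⁆ ⊆ p ∩ q
            ∩! w∈p w∈q = ∈! (x∈p∩q⁺ (w∈p , w∈q))
          collapse (inj₂ g′∈l₂) = estimate M (X ∷ l₁ ∷ l₂ ∷ l₃ ∷ ⁅ x ⁆ ∷ ⁅ y ⁆ ∷ ⁅ f ⁆ ∷ ⁅ g′ ⁆ ∷ [])
            (λ X l₁ l₂ l₃ x y f g → x ⊑ l₁ ⊓ l₃ ∷ g ⊑ l₂ ⊓ l₃ ∷ y ⊑ l₁ ⊓ l₂ ∷ f ⊑ l₂ ⊓ l₃ ∷ X ⊑ l₁ ⊔ l₂ ∷ []
              ∣ ϱ l₁ ≼ # 2 ∷ ϱ l₂ ≼ # 2 ∷ ϱ l₃ ≼ # 2 ∷ # 2 ≼ ϱ (g ⊔ f) ∷ # 2 ≼ ϱ (x ⊔ y) ∷ []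
              by (l₂ , l₃) ∷ (l₂ ⊔ l₃ , l₁) ∷ [] ⊩ ϱ X ≼ # 2)
            refl (∩! x∈l₁ x∈l₃ ∷ ∩! g′∈l₂ g′∈l₃ ∷ ∩! y∈l₁ y∈l₂ ∷ ∩! f∈l₂ f∈l₃ ∷ X⊆l₁∪l₂ ∷ [])
            (line₁ ∷ line₂ ∷ line₃ ∷
             1<ρ-pair (X⊆E g′∈X) f∈E (λ { refl → f∉A′ g′∈A′ }) ∷ 1<ρ-pair x∈E y∈E x≢y ∷ [])
            where
            ∩! : ∀ {w p q} → w ∈ p → w ∈ q → ⁅ w ⁆ ⊆ p ∩ q
            ∩! w∈p w∈q = ∈! (x∈p∩q⁺ (w∈p , w∈q))

        through : ∀ {f} → f ∈ l₂ → f ≢ y → f ∈ C* → Outcome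
        through f∈l₂ f≢y f∈C* = [ id , third-line f∈l₂ f≢y ]′ (lines (p─q⊆p X A f∈l₂) f∈C*)

        h∈l₂ : h ∈ l₂
        h∈l₂ = ∈-─⁺ h∈X h∉A

      -- If `l₂` holds only `y` and `h`, then `X` lies on `l₁` except for `h`, and the descent ends
      -- with `z = h`. Otherwise `l₂` has a third element; at least one of it and `h` is in `C*`,
      -- and the partition there yields an outcome or an impossible third line through `x`.
      from-lines : Outcome
      from-lines = cases (nonempty? ((l₂ - y) - h))
        where
        cases : Dec (Nonempty ((l₂ - y) - h)) → Outcome
        cases (yes (f , f∈)) = by-C* (h ∈? C*)
          where
          f∈l₂ : f ∈ l₂
          f∈l₂ = proj₁ (∈--⁻ (proj₁ (∈--⁻ f∈)))
          f≢y : f ≢ y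
          f≢y = proj₂ (∈--⁻ (proj₁ (∈--⁻ f∈))) ∘ sym
          by-C* : Dec (h ∈ C*) → Outcome
          by-C* (yes h∈C*) = through h∈l₂ h≢y h∈C*
          by-C* (no h∉C*)  = through f∈l₂ f≢y (not-both h∈l₂ h≢y h∉C* f∈l₂ (proj₂ (∈--⁻ f∈) ∘ sym))
        cases (no none) = inj₂ (FromLine.cocircuitLine x∈C* v cl e x∈C small {L = l₁} {z = h}
          x∈l₁ h∈X
          ([ h∉A ∘ p∩q⊆q (X ∪ ⁅ x ⁆) A , h≢y ∘ x∈⁅y⁆⇒x≡y y ]′ ∘ x∈p∪q⁻ ((X ∪ ⁅ x ⁆) ∩ A) ⁅ y ⁆)
          (sets (X ∷ A ∷ ⁅ x ⁆ ∷ ⁅ y ⁆ ∷ []) (λ X A x y → y ⊑ X ∷ [] ⊢ ((X ⊔ x) ⊓ A) ⊔ y ⊑ X ⊔ x) refl (∈! y∈X ∷ []))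
          (sets (X ∷ A ∷ ⁅ x ⁆ ∷ ⁅ y ⁆ ∷ ⁅ h ⁆ ∷ [])
            (λ X A x y h → ((X ∖ A) ∖ y) ∖ h ⊑ ○ ∷ [] ⊢ X ⊑ (((X ⊔ x) ⊓ A) ⊔ y) ⊔ h)
            refl ((λ z∈ → contradiction (_ , z∈) none) ∷ []))
          line₁ (p⊆p∪q ⁅ y ⁆ (x∈p∩q⁺ (p⊆p∪q ⁅ x ⁆ g∈X , g∈A))) y∈l₁
          (λ { refl → y∉A g∈A }) (λ { refl → x∉X g∈X }) (x≢y ∘ sym))

    outcome : Outcome
    outcome = go meets-C*
      where
      go : Nonempty (X ∩ C*) → Outcome
      go (y , y∈) = let y∈X , y∈C* = x∈p∩q⁻ X C* y∈ in [ id , from-lines y∈X y∈C* ]′ (lines y∈X y∈C*)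

  search : ∀ s → Searchable s
  search zero ()
  search (suc s) X<s x∈C* v cl e x∈C small =
    At.outcome (search s) (ℕ.s≤s⁻¹ X<s) x∈C* v cl e x∈C small

  find : ∀ {x} → x ∈ C* → (e : Embedding M N) → x ∈ Embedding.C e → Outcome
  find x∈C* e x∈C = [ id , (λ { (X , v , cl , small) → search (suc ∣ X ∣) ℕₚ.≤-refl x∈C* v cl e x∈C small }) ]′
    (outcome-or-vertical x∈C* e x∈C)

-- Cocircuits attached to the points of a line.

module Pencil {n} (M : Matroid n) (M3 : ThreeConnected M) (4≤∣E∣ : 4 ≤ ∣ E M ∣)
  {L : Subset n} (L⊆E : L ⊆ E M) (ρL≤2 : rk M L ≤ 2)
  (flat : ∀ {e} → e ∈ E M → e ∉ L → 3 ≤ rk M (L ∪ ⁅ e ⁆)) where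

  open Rank M
  open ThreeConnected M3
  open Simple M M3 4≤∣E∣
  open Partitions M M3 4≤∣E∣
  open Verticals M M3 4≤∣E∣

  Cocircuit-at : Fin n → Set
  Cocircuit-at w = ∃ λ z → z ∈ E M × z ∉ L × HyperplaneComplement M ((L - w) ∪ ⁅ z ⁆)

  module Point {x z} (x∈L : x ∈ L) (z∈E : z ∈ E M) (z∉L : z ∉ L)
    (hc : HyperplaneComplement M ((L - x) ∪ ⁅ z ⁆)) where

    open HyperplaneComplement hc

    X : Subset n
    X = (L - x) ∪ ⁅ z ⁆

    x∉X : x ∉ X
    x∉X = [ (λ x∈ → proj₂ (∈--⁻ x∈) refl) , (λ x∈z → z∉L (subst (_∈ L) (x∈⁅y⁆⇒x≡y z x∈z) x∈L)) ]′
      ∘ x∈p∪q⁻ (L - x) ⁅ z ⁆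

    w∈X : ∀ {w} → w ∈ L → w ≢ x → w ∈ X
    w∈X w∈L w≢x = p⊆p∪q ⁅ z ⁆ (∈--⁺ w∈L w≢x)

    -- The complement of the cocircuit `X` is a hyperplane, hence closed, and it contains `S` but
    -- not `w`.
    off : ∀ {w S} → w ∈ X → S ⊆ ∁ X → 1 + ρ S ≤ ρ (S ∪ ⁅ w ⁆)
    off {w} {S} w∈X S⊆ = estimate M (S ∷ X ∷ ⁅ w ⁆ ∷ [])
      (λ S X w → S ⊑ ~ X ∷ w ⊑ X ∷ [] ∣ # 1 ⊕ ϱ (~ X) ≼ ϱ ● ∷ ϱ ● ≼ ϱ (~ X ⊔ w) ∷ [] by (S ⊔ w , ~ X) ∷ []
        ⊩ # 1 ⊕ ϱ S ≼ ϱ (S ⊔ w))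
      refl (S⊆ ∷ ∈! w∈X ∷ []) (nonspanning ∷ spanning⁺ w∈X ∷ [])

    avoids-X : ∀ {S} → S ⊆ ∁ L → z ∉ S → S ⊆ ∁ X
    avoids-X {S} S⊆∁L z∉S = sets (S ∷ L ∷ ⁅ x ⁆ ∷ ⁅ z ⁆ ∷ [])
      (λ S L x z → S ⊑ ~ L ∷ z ⊑ ~ S ∷ [] ⊢ S ⊑ ~ ((L ∖ x) ⊔ z)) refl (S⊆∁L ∷ ∉! z∉S ∷ [])

    -- As connectivities in M / L the two bounds are 1 and 2: the rank of L accounts for
    -- the remaining 2.

    module _ {w} (w∈L : w ∈ L) (w≢x : w ≢ x) {S : Subset n} (S⊆∁L : S ⊆ ∁ L) (z∉S : z ∉ S) where

      private
        L⊆∁S : L ⊆ ∁ S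
        L⊆∁S = sets (S ∷ L ∷ []) (λ S L → S ⊑ ~ L ∷ [] ⊢ L ⊑ ~ S) refl (S⊆∁L ∷ [])

        two : Two (∁ S)
        two = w , x , w≢x , (L⊆∁S w∈L , L⊆E w∈L) , (L⊆∁S x∈L , L⊆E x∈L)

        S⊆∁X : S ⊆ ∁ X
        S⊆∁X = avoids-X S⊆∁L z∉S

      conn-/₁ : ∀ {s} → s ∈ E M → s ∈ S → ρ ⊤ + 3 ≤ ρ (S ∪ L) + ρ (∁ S)
      conn-/₁ {s} s∈E s∈S = cases (2 ℕ.≤? ρ S)
        where
        cases : Dec (2 ≤ ρ S) → ρ ⊤ + 3 ≤ ρ (S ∪ L) + ρ (∁ S)
        -- `S` misses the cocircuit and does not span `w`, so adding `L` gains one over the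
        -- connectivity of `S` in M.
        cases (yes 2≤) = estimate M (S ∷ L ∷ ⁅ w ⁆ ∷ [])
          (λ S L w → w ⊑ L ∷ [] ∣ ϱ ● ⊕ # 2 ≼ ϱ S ⊕ ϱ (~ S) ∷ # 1 ⊕ ϱ S ≼ ϱ (S ⊔ w) ∷ [] by []
            ⊩ ϱ ● ⊕ # 3 ≼ ϱ (S ⊔ L) ⊕ ϱ (~ S))
          refl (∈! w∈L ∷ []) (conn-two S two 2≤ ∷ off (w∈X w∈L w≢x) S⊆∁X ∷ [])
        cases (no 2≰) = estimate M (S ∷ L ∷ ⁅ s ⁆ ∷ [])
          (λ S L s → s ⊑ S ∷ [] ∣ ϱ S ≼ # 1 ∷ ϱ ● ⊕ # 1 ≼ ϱ S ⊕ ϱ (~ S) ∷ # 3 ≼ ϱ (L ⊔ s) ∷ [] by []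
            ⊩ ϱ ● ⊕ # 3 ≼ ϱ (S ⊔ L) ⊕ ϱ (~ S))
          refl (∈! s∈S ∷ [])
          (ℕ.s≤s⁻¹ (≰⇒> 2≰) ∷ conn₁ S s∈E (L⊆E x∈L) s∈S (x∈∁p⇒x∉p (L⊆∁S x∈L)) ∷
           flat s∈E (x∈∁p⇒x∉p (S⊆∁L s∈S)) ∷ [])

      -- `S` does not span `x`, and `S ∪ ⁅ x ⁆` still misses the cocircuit and so does not span `w`:
      -- passing to `S ∪ L` gains 2.
      conn-/₂ : 2 ≤ ρ S → 1 + ρ S ≤ ρ (S ∪ ⁅ x ⁆) → ρ ⊤ + 4 ≤ ρ (S ∪ L) + ρ (∁ S)
      conn-/₂ 2≤ x∉cl = estimate M (S ∷ L ∷ ⁅ w ⁆ ∷ ⁅ x ⁆ ∷ [])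
        (λ S L w x → w ⊑ L ∷ x ⊑ L ∷ []
          ∣ ϱ ● ⊕ # 2 ≼ ϱ S ⊕ ϱ (~ S) ∷ # 1 ⊕ ϱ S ≼ ϱ (S ⊔ x) ∷ # 1 ⊕ ϱ (S ⊔ x) ≼ ϱ ((S ⊔ x) ⊔ w) ∷ [] by []
          ⊩ ϱ ● ⊕ # 4 ≼ ϱ (S ⊔ L) ⊕ ϱ (~ S))
        refl (∈! w∈L ∷ ∈! x∈L ∷ [])
        (conn-two S two 2≤ ∷ x∉cl ∷ off (w∈X w∈L w≢x) (∪-⊆ S⊆∁X (∉! x∉X)) ∷ [])

    Separated : Fin n → Subset n → Set
    Separated w B = Vertical M w B × Closed M w B × z ∉ B × L ⊆ B ∪ ⁅ w ⁆

    -- If the closed side containing z contained another point of L, it would contain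
    -- L - w, and the other side would span w without meeting X.

    separate : ∀ {w} → w ∈ L → w ≢ x → (∃ λ A → Vertical M w A) → ∃ (Separated w)
    separate {w} w∈L w≢x (A₀ , v₀) = orient (z ∈? A₀)
      where
      finish : ∀ {B₀} → z ∉ B₀ → (Σ[ B ∈ Subset n ] B ⊆ B₀ × Vertical M w B × Closed M w B) → ∃ (Separated w)
      finish z∉B₀ (B , B⊆B₀ , v , cl) = B , v , cl , z∉B , λ {u} u∈L → inside? u∈L (u ∈? B) (u ≟ᶠ w)
        where
        open VerticalFacts v
        z∉B : z ∉ B
        z∉B = z∉B₀ ∘ B⊆B₀
        inside? : ∀ {u} → u ∈ L → Dec (u ∈ B) → Dec (u ≡ w) → u ∈ B ∪ ⁅ w ⁆
        inside? u∈L (yes u∈B) _ = p⊆p∪q ⁅ w ⁆ u∈B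
        inside? u∈L (no _) (yes refl) = q⊆p∪q B ⁅ w ⁆ (x∈⁅x⁆ w)
        inside? {u} u∈L (no u∉B) (no u≢w) = contradiction (estimate M (X ∷ B ∷ ⁅ w ⁆ ∷ [])
            (λ X B w → B ⊑ ~ X ∷ [] ∣ ϱ (B ⊔ w) ≼ ϱ B ∷ # 1 ⊕ ϱ B ≼ ϱ (B ⊔ w) ∷ [] by [] ⊩ # 1 ≼ # 0)
            refl (B⊆∁X ∷ []) (spanˣ ∷ off (w∈X w∈L w≢x) B⊆∁X ∷ [])) λ ()
          where
          L∩B : ∀ {e} → e ∈ L → e ∉ B
          L∩B {e} e∈L e∈B = 1+n≰n {0} (estimate M (B ∷ L ∷ ⁅ w ⁆ ∷ ⁅ u ⁆ ∷ ⁅ e ⁆ ∷ [])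
            (λ B L w u e → w ⊑ L ∷ u ⊑ L ∷ e ⊑ L ∷ u ⊑ ~ B ∷ u ⊑ ~ w ∷ []
              ∣ # 1 ⊕ ϱ (~ (B ⊔ w)) ≼ ϱ (~ (B ⊔ w) ⊔ e) ∷ ϱ L ≼ # 2 ∷ # 2 ≼ ϱ (u ⊔ w)
              ∷ ϱ (~ (B ⊔ w) ⊔ w) ≼ ϱ (~ (B ⊔ w)) ∷ []
              by (~ (B ⊔ w) ⊔ w , L) ∷ [] ⊩ # 1 ≼ # 0)
            refl (∈! w∈L ∷ ∈! u∈L ∷ ∈! e∈L ∷ ∉! u∉B ∷ ≢! u≢w ∷ [])
            (cl e∈B ∷ ρL≤2 ∷ 1<ρ-pair (L⊆E u∈L) (L⊆E w∈L) u≢w ∷ spanʸ ∷ []))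
          B⊆∁X : B ⊆ ∁ X
          B⊆∁X {e} e∈B = x∉p⇒x∈∁p ([ (λ e∈ → L∩B (proj₁ (∈--⁻ e∈)) e∈B) ,
            (λ e∈z → z∉B (subst (_∈ B) (x∈⁅y⁆⇒x≡y z e∈z) e∈B)) ]′ ∘ x∈p∪q⁻ (L - x) ⁅ z ⁆)
      orient : Dec (z ∈ A₀) → ∃ (Separated w)
      orient (yes z∈A₀) = finish (x∈p⇒x∉∁p (p⊆p∪q ⁅ w ⁆ z∈A₀)) (close (swap-sides v₀))
      orient (no z∉A₀)  = finish z∉A₀ (close v₀)

    -- Uncrossing the sides A₁ and A₂ containing z in the contraction of L leaves one
    -- element in each of A₂ ─ A₁ and A₁ ─ A₂, and none outside A₁, A₂ and L.

    module TwoPoints {w₁ w₂ B₁ B₂} (w₁∈L : w₁ ∈ L) (w₂∈L : w₂ ∈ L) (w₁≢x : w₁ ≢ x) (w₂≢x : w₂ ≢ x)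
      (w₁≢w₂ : w₁ ≢ w₂) (s₁ : Separated w₁ B₁) (s₂ : Separated w₂ B₂) where

      private
        module V₁ = VerticalFacts (proj₁ s₁)
        module V₂ = VerticalFacts (proj₁ s₂)

        cl₁ = proj₁ (proj₂ s₁)
        cl₂ = proj₁ (proj₂ s₂)

        z∉B₁ : z ∉ B₁
        z∉B₁ = proj₁ (proj₂ (proj₂ s₁))
        z∉B₂ : z ∉ B₂
        z∉B₂ = proj₁ (proj₂ (proj₂ s₂))
        L⊆B₁w₁ : L ⊆ B₁ ∪ ⁅ w₁ ⁆
        L⊆B₁w₁ = proj₂ (proj₂ (proj₂ s₁))
        L⊆B₂w₂ : L ⊆ B₂ ∪ ⁅ w₂ ⁆
        L⊆B₂w₂ = proj₂ (proj₂ (proj₂ s₂))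

        A₁ A₂ J K D I : Subset n
        A₁ = ∁ (B₁ ∪ ⁅ w₁ ⁆)
        A₂ = ∁ (B₂ ∪ ⁅ w₂ ⁆)
        J  = A₂ ─ A₁
        K  = A₁ ─ A₂
        D  = ∁ ((A₁ ∪ A₂) ∪ L)
        I  = A₁ ∩ A₂

        in-B : ∀ {B w e} → L ⊆ B ∪ ⁅ w ⁆ → e ∈ L → e ≢ w → e ∈ B
        in-B {B} {w} L⊆ e∈L e≢w = [ id , (λ e∈w → contradiction (x∈⁅y⁆⇒x≡y w e∈w) e≢w) ]′ (x∈p∪q⁻ B ⁅ w ⁆ (L⊆ e∈L))

        A₁⊆∁L : A₁ ⊆ ∁ L
        A₁⊆∁L = p⊆q⇒∁p⊇∁q L⊆B₁w₁
        A₂⊆∁L : A₂ ⊆ ∁ L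
        A₂⊆∁L = p⊆q⇒∁p⊇∁q L⊆B₂w₂

        in-A : ∀ {B w} → w ∈ L → z ∉ B → z ∈ ∁ (B ∪ ⁅ w ⁆)
        in-A {B} {w} w∈L z∉B = x∉p⇒x∈∁p ([ z∉B , (λ z∈w → z∉L (subst (_∈ L) (sym (x∈⁅y⁆⇒x≡y w z∈w)) w∈L)) ]′
          ∘ x∈p∪q⁻ B ⁅ w ⁆)

        z∈A₁ : z ∈ A₁
        z∈A₁ = in-A w₁∈L z∉B₁
        z∈A₂ : z ∈ A₂
        z∈A₂ = in-A w₂∈L z∉B₂

        J⊆∁L : J ⊆ ∁ L
        J⊆∁L = A₂⊆∁L ∘ p─q⊆p A₂ A₁
        K⊆∁L : K ⊆ ∁ L
        K⊆∁L = A₁⊆∁L ∘ p─q⊆p A₁ A₂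

        out₁ : ∀ {e} → e ∈ L → e ≢ w₁ → 1 + ρ A₁ ≤ ρ (A₁ ∪ ⁅ e ⁆)
        out₁ e∈L e≢w₁ = cl₁ (in-B L⊆B₁w₁ e∈L e≢w₁)
        out₂ : ∀ {e} → e ∈ L → e ≢ w₂ → 1 + ρ A₂ ≤ ρ (A₂ ∪ ⁅ e ⁆)
        out₂ e∈L e≢w₂ = cl₂ (in-B L⊆B₂w₂ e∈L e≢w₂)

        0<ρ-─ : ∀ {S T w} → (ρ (S ∪ ⁅ w ⁆) ≤ ρ S) → 1 + ρ T ≤ ρ (T ∪ ⁅ w ⁆) → 1 ≤ ρ (S ─ T)
        0<ρ-─ {S} {T} {w} sp unsp = ≰⇒> λ ≤0 → 1+n≰n {0} (estimate M (S ∷ T ∷ ⁅ w ⁆ ∷ [])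
          (λ S T w → [] ∣ ϱ (S ⊔ w) ≼ ϱ S ∷ # 1 ⊕ ϱ T ≼ ϱ (T ⊔ w) ∷ ϱ (S ∖ T) ≼ # 0 ∷ []
            by (T , S ∖ T) ∷ (S ⊔ T , S ⊔ w) ∷ [] ⊩ # 1 ≼ # 0)
          refl [] (sp ∷ unsp ∷ ≤0 ∷ []))

        1≤ρJ : 1 ≤ ρ J
        1≤ρJ = 0<ρ-─ {w = w₂} V₂.spanʸ (out₁ w₂∈L (w₁≢w₂ ∘ sym))
        1≤ρK : 1 ≤ ρ K
        1≤ρK = 0<ρ-─ {w = w₁} V₁.spanʸ (out₂ w₁∈L w₁≢w₂)

        A∪L : ∀ {A w} → ρ (A ∪ ⁅ w ⁆) ≤ ρ A → w ∈ L → ρ (A ∪ L) ≤ ρ A + 1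
        A∪L {A} {w} sp w∈L = estimate M (A ∷ L ∷ ⁅ w ⁆ ∷ [])
          (λ A L w → w ⊑ L ∷ [] ∣ ϱ (A ⊔ w) ≼ ϱ A ∷ ϱ L ≼ # 2 ∷ # 1 ≼ ϱ w ∷ [] by (A ⊔ w , L) ∷ [] ⊩ ϱ (A ⊔ L) ≼ ϱ A ⊕ # 1)
          refl (∈! w∈L ∷ []) (sp ∷ ρL≤2 ∷ 0<ρ⁅⁆ (L⊆E w∈L) ∷ [])

        -- The side opposite to `B` spans `w`, so adding the line `L` raises its rank by at most 1.
        -- In both uses `L` lies in `B ∪ ⁅ w ⁆`, and as `L` has rank 2 the constant 3 means
        -- connectivity at most 1 in M / L.
        sep-/ : ∀ {B w} (v : Vertical M w B) → w ∈ L →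
                ρ (∁ (B ∪ ⁅ w ⁆) ∪ L) + ρ (∁ (∁ (B ∪ ⁅ w ⁆))) ≤ ρ ⊤ + 3
        sep-/ {B} {w} v w∈L = estimate M (B ∷ ⁅ w ⁆ ∷ L ∷ [])
          (λ B w L → [] ∣ ϱ (~ (B ⊔ w) ⊔ L) ≼ ϱ (~ (B ⊔ w)) ⊕ # 1 ∷ ϱ (B ⊔ w) ⊕ ϱ (~ (B ⊔ w)) ≼ ϱ ● ⊕ # 2 ∷ [] by []
            ⊩ ϱ (~ (B ⊔ w) ⊔ L) ⊕ ϱ (~ (~ (B ⊔ w))) ≼ ϱ ● ⊕ # 3)
          refl [] (A∪L (Vertical.spanʸ v) w∈L ∷ VerticalFacts.sepXx v ∷ [])

        -- Connectivity is symmetric under complements, so the two sides can be uncrossed on their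
        -- differences, as here, and also on intersection and union, as in `sepID`. The constant 6
        -- is twice the 3 of `sep-/`.
        sepJK : (ρ (J ∪ L) + ρ (∁ J)) + (ρ (K ∪ L) + ρ (∁ K)) ≤ (ρ ⊤ + ρ ⊤) + 6
        sepJK = estimate M (A₁ ∷ A₂ ∷ L ∷ [])
          (λ A₁ A₂ L → A₁ ⊑ ~ L ∷ A₂ ⊑ ~ L ∷ []
            ∣ ϱ (A₁ ⊔ L) ⊕ ϱ (~ A₁) ≼ ϱ ● ⊕ # 3 ∷ ϱ (A₂ ⊔ L) ⊕ ϱ (~ A₂) ≼ ϱ ● ⊕ # 3 ∷ []
            by (A₂ ⊔ L , ~ A₁) ∷ (A₁ ⊔ L , ~ A₂) ∷ []
            ⊩ (ϱ ((A₂ ∖ A₁) ⊔ L) ⊕ ϱ (~ (A₂ ∖ A₁))) ⊕ (ϱ ((A₁ ∖ A₂) ⊔ L) ⊕ ϱ (~ (A₁ ∖ A₂))) ≼ (ϱ ● ⊕ ϱ ●) ⊕ # 6)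
          refl (A₁⊆∁L ∷ A₂⊆∁L ∷ []) (sep-/ (proj₁ s₁) w₁∈L ∷ sep-/ (proj₁ s₂) w₂∈L ∷ [])

        sepID : (ρ (I ∪ L) + ρ (∁ I)) + (ρ (D ∪ L) + ρ (∁ D)) ≤ (ρ ⊤ + ρ ⊤) + 6
        sepID = estimate M (A₁ ∷ A₂ ∷ L ∷ [])
          (λ A₁ A₂ L → A₁ ⊑ ~ L ∷ A₂ ⊑ ~ L ∷ []
            ∣ ϱ (A₁ ⊔ L) ⊕ ϱ (~ A₁) ≼ ϱ ● ⊕ # 3 ∷ ϱ (A₂ ⊔ L) ⊕ ϱ (~ A₂) ≼ ϱ ● ⊕ # 3 ∷ []
            by (A₁ ⊔ L , A₂ ⊔ L) ∷ (~ A₁ , ~ A₂) ∷ []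
            ⊩ (ϱ ((A₁ ⊓ A₂) ⊔ L) ⊕ ϱ (~ (A₁ ⊓ A₂))) ⊕ (ϱ (~ ((A₁ ⊔ A₂) ⊔ L) ⊔ L) ⊕ ϱ (~ (~ ((A₁ ⊔ A₂) ⊔ L)))) ≼ (ϱ ● ⊕ ϱ ●) ⊕ # 6)
          refl (A₁⊆∁L ∷ A₂⊆∁L ∷ []) (sep-/ (proj₁ s₁) w₁∈L ∷ sep-/ (proj₁ s₂) w₂∈L ∷ [])

        lower : ∀ {S} → S ⊆ ∁ L → z ∉ S → 1 ≤ ρ S → ρ ⊤ + 3 ≤ ρ (S ∪ L) + ρ (∁ S)
        lower {S} S⊆ z∉S 1≤ = go (0<ρ⇒∃ S 1≤)
          where
          go : (∃ λ s → s ∈ S × s ∈ E M) → ρ ⊤ + 3 ≤ ρ (S ∪ L) + ρ (∁ S)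
          go (s , s∈S , s∈E) = conn-/₁ w₁∈L w₁≢x S⊆ z∉S s∈E s∈S

        half : ∀ {a b t} → a + b ≤ (t + t) + 6 → t + 3 ≤ b → a ≤ t + 3
        half {a} {b} {t} ab b≥ = +-cancelʳ-≤ (t + 3) a (t + 3) (≤-trans (+-monoʳ-≤ a b≥)
          (≤-trans ab (≤-reflexive (sym (+-swap t 3 t 3)))))

        -- `A` does not span `x`, so neither does `S`; with rank 2, `S` would then have connectivity
        -- 2 in M / L by `conn-/₂`.
        ≤1-of : ∀ {S A} → S ⊆ ∁ L → z ∉ S → S ⊆ A → 1 + ρ A ≤ ρ (A ∪ ⁅ x ⁆) →
                ρ (S ∪ L) + ρ (∁ S) ≤ ρ ⊤ + 3 → ρ S ≤ 1
        ≤1-of {S} {A} S⊆∁L z∉S S⊆A x∉clA upper = ℕ.s≤s⁻¹ (≰⇒> λ 2≤ → 1+n≰n {ρ ⊤ + 3}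
          (≤-trans (≤-reflexive (sym (ℕₚ.+-suc (ρ ⊤) 3)))
            (≤-trans (conn-/₂ w₁∈L w₁≢x S⊆∁L z∉S 2≤ (estimate M (S ∷ A ∷ ⁅ x ⁆ ∷ [])
              (λ S A x → S ⊑ A ∷ [] ∣ # 1 ⊕ ϱ A ≼ ϱ (A ⊔ x) ∷ [] by (S ⊔ x , A) ∷ [] ⊩ # 1 ⊕ ϱ S ≼ ϱ (S ⊔ x))
              refl (S⊆A ∷ []) (x∉clA ∷ []))) upper)))

        z∉J : z ∉ J
        z∉J z∈ = proj₂ (∈-─⁻ {p = A₂} z∈) z∈A₁
        z∉K : z ∉ K
        z∉K z∈ = proj₂ (∈-─⁻ {p = A₁} z∈) z∈A₂

        ρJ≤1 : ρ J ≤ 1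
        ρJ≤1 = ≤1-of J⊆∁L z∉J (p─q⊆p A₂ A₁) (out₂ x∈L (w₂≢x ∘ sym)) (half sepJK (lower K⊆∁L z∉K 1≤ρK))
        ρK≤1 : ρ K ≤ 1
        ρK≤1 = ≤1-of K⊆∁L z∉K (p─q⊆p A₁ A₂) (out₁ x∈L (w₁≢x ∘ sym))
          (half (≤-trans (≤-reflexive (+-comm (ρ (K ∪ L) + ρ (∁ K)) _)) sepJK) (lower J⊆∁L z∉J 1≤ρJ))

        ρD≤0 : ρ D ≤ 0
        ρD≤0 = ≮⇒≥ λ 1≤D → by-I (half sepID (lower
            (sets (A₁ ∷ A₂ ∷ L ∷ []) (λ A₁ A₂ L → [] ⊢ ~ ((A₁ ⊔ A₂) ⊔ L) ⊑ ~ L) refl [])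
            (x∈p⇒x∉∁p (p⊆p∪q L (p⊆p∪q A₂ z∈A₁))) 1≤D)) (2 ℕ.≤? ρ I)
          where
          by-I : ρ (I ∪ L) + ρ (∁ I) ≤ ρ ⊤ + 3 → Dec (2 ≤ ρ I) → Empty.⊥
          -- The bounds allow `I ∪ L` one more rank than `I`. As `I` does not span `w₁`, the set
          -- `I ∪ ⁅ w₁ ⁆` spans `L`; and `A₁`, which spans `w₁`, would then span `w₂`.
          by-I upper (yes 2≤I) = 1+n≰n {0} (estimate M (A₁ ∷ A₂ ∷ L ∷ ⁅ w₁ ⁆ ∷ ⁅ w₂ ⁆ ∷ [])
            (λ A₁ A₂ L w₁ w₂ → w₁ ⊑ L ∷ w₂ ⊑ L ∷ []
              ∣ ϱ ((A₁ ⊓ A₂) ⊔ L) ⊕ ϱ (~ (A₁ ⊓ A₂)) ≼ ϱ ● ⊕ # 3 ∷ ϱ ● ⊕ # 2 ≼ ϱ (A₁ ⊓ A₂) ⊕ ϱ (~ (A₁ ⊓ A₂))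
              ∷ # 1 ⊕ ϱ A₂ ≼ ϱ (A₂ ⊔ w₁) ∷ # 1 ⊕ ϱ A₁ ≼ ϱ (A₁ ⊔ w₂) ∷ ϱ (A₁ ⊔ w₁) ≼ ϱ A₁ ∷ []
              by (A₂ , (A₁ ⊓ A₂) ⊔ w₁) ∷ (A₁ ⊔ w₁ , (A₁ ⊓ A₂) ⊔ L) ∷ [] ⊩ # 1 ≼ # 0)
            refl (∈! w₁∈L ∷ ∈! w₂∈L ∷ [])
            (upper ∷ conn-two I two 2≤I ∷ out₂ w₁∈L w₁≢w₂ ∷ out₁ w₂∈L (w₁≢w₂ ∘ sym) ∷ V₁.spanʸ ∷ []))
            where
            two : Two (∁ I)
            two = w₁ , x , w₁≢x ,
              (x∉p⇒x∈∁p (λ w∈ → x∈∁p⇒x∉p (A₁⊆∁L (p∩q⊆p A₁ A₂ w∈)) w₁∈L) , L⊆E w₁∈L) ,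
              (x∉p⇒x∈∁p (λ x∈ → x∈∁p⇒x∉p (A₁⊆∁L (p∩q⊆p A₁ A₂ x∈)) x∈L) , L⊆E x∈L)
          by-I upper (no 2≰I) = 1+n≰n {2} (≤-trans V₁.3≤ʸ (estimate M (A₁ ∷ A₂ ∷ [])
            (λ A₁ A₂ → [] ∣ ϱ (A₁ ⊓ A₂) ≼ # 1 ∷ ϱ (A₁ ∖ A₂) ≼ # 1 ∷ [] by (A₁ ⊓ A₂ , A₁ ∖ A₂) ∷ [] ⊩ ϱ A₁ ≼ # 2)
            refl [] (ℕ.s≤s⁻¹ (≰⇒> 2≰I) ∷ ρK≤1 ∷ [])))

        B₁⊆ : B₁ ⊆ L ∪ (J ∪ D)
        B₁⊆ = sets (B₁ ∷ B₂ ∷ ⁅ w₁ ⁆ ∷ ⁅ w₂ ⁆ ∷ L ∷ [])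
          (λ B₁ B₂ w₁ w₂ L → w₁ ⊑ L ∷ [] ⊢ B₁ ⊑ L ⊔ (((~ (B₂ ⊔ w₂)) ∖ (~ (B₁ ⊔ w₁))) ⊔ ~ ((~ (B₁ ⊔ w₁) ⊔ ~ (B₂ ⊔ w₂)) ⊔ L)))
          refl (∈! w₁∈L ∷ [])

      -- Within the ground set `D` is empty and `J` is a single element `j`, so `B₁` consists of
      -- `L - w₁` and `j`. This closed side has rank 3 and is therefore a cocircuit by `RankThree`.
      cocircuit-at : Cocircuit-at w₁
      cocircuit-at = go (0<ρ⇒∃ J 1≤ρJ)
        where
        go : (∃ λ j → j ∈ J × j ∈ E M) → Cocircuit-at w₁
        go (j , j∈J , j∈E) = j , j∈E , x∈∁p⇒x∉p (J⊆∁L j∈J) ,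
          subst (HyperplaneComplement M) B₁≡ (V₁.RankThree.hyperplaneComplement cl₁ ρB₁≤3)
          where
          J∪D⊆ : ∀ {e} → e ∈ E M → e ∈ J ∪ D → e ≡ j
          J∪D⊆ {e} e∈E e∈ = [ (λ e∈J → only e∈J (e ≟ᶠ j)) ,
            (λ e∈D → contradiction (≤-trans (0<ρ⁅⁆ e∈E) (≤-trans (ρ-mono (∈! e∈D)) ρD≤0)) λ ()) ]′ (x∈p∪q⁻ J D e∈)
            where
            only : e ∈ J → Dec (e ≡ j) → e ≡ j
            only _ (yes eq) = eq
            only e∈J (no ne) = contradiction (≤-trans (1<ρ J e∈E j∈E ne e∈J j∈J) ρJ≤1) λ { (s≤s ()) }
          B₁⊆Lj : B₁ ⊆ L ∪ ⁅ j ⁆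
          B₁⊆Lj {e} e∈B₁ = [ p⊆p∪q ⁅ j ⁆ , (λ e∈JD → q⊆p∪q L ⁅ j ⁆
            (subst (e ∈_) (cong ⁅_⁆ (J∪D⊆ (closed⇒⊆E cl₁ e∈B₁) e∈JD)) (x∈⁅x⁆ e))) ]′ (x∈p∪q⁻ L (J ∪ D) (B₁⊆ e∈B₁))
          ρB₁≤3 : ρ B₁ ≤ 3
          ρB₁≤3 = estimate M (B₁ ∷ L ∷ ⁅ j ⁆ ∷ [])
            (λ B L j → B ⊑ L ⊔ j ∷ [] ∣ ϱ L ≼ # 2 ∷ ϱ j ≼ # 1 ∷ [] by (L , j) ∷ [] ⊩ ϱ B ≼ # 3)
            refl (B₁⊆Lj ∷ []) (ρL≤2 ∷ ρ-⁅⁆ j ∷ [])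
          j∈B₁ : j ∈ B₁
          j∈B₁ = ⁅⁆⊆⇒∈ (sets (B₁ ∷ A₂ ∷ ⁅ w₁ ⁆ ∷ ⁅ j ⁆ ∷ L ∷ [])
            (λ B A₂ w j L → j ⊑ A₂ ∖ ~ (B ⊔ w) ∷ w ⊑ L ∷ A₂ ⊑ ~ L ∷ [] ⊢ j ⊑ B) refl (∈! j∈J ∷ ∈! w₁∈L ∷ A₂⊆∁L ∷ []))
          B₁≡ : B₁ ≡ (L - w₁) ∪ ⁅ j ⁆
          B₁≡ = ⊆-antisym
            (sets (B₁ ∷ L ∷ ⁅ w₁ ⁆ ∷ ⁅ j ⁆ ∷ []) (λ B L w j → B ⊑ L ⊔ j ∷ w ⊑ ~ B ∷ [] ⊢ B ⊑ (L ∖ w) ⊔ j)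
              refl (B₁⊆Lj ∷ ∉! V₁.x∉X ∷ []))
            (sets (B₁ ∷ L ∷ ⁅ w₁ ⁆ ∷ ⁅ j ⁆ ∷ []) (λ B L w j → L ⊑ B ⊔ w ∷ j ⊑ B ∷ [] ⊢ (L ∖ w) ⊔ j ⊑ B)
              refl (L⊆B₁w₁ ∷ ∈! j∈B₁ ∷ []))

-- Segments and cosegments

module Cocircuits {n} (Q : Matroid n) where

  open Rank Q

  -- Coindependence is translated into a spanning complement, which frees later arguments from the
  -- truncated subtraction in the dual rank.
  corank-full : ∀ {X} → X ⊆ E Q → r (Q *) X ≡ ∣ X ∣ → ρ ⊤ ≤ ρ (∁ X)
  corank-full {X} X⊆E eq = ≤-reflexive (ℕₚ.+-cancelˡ-≡ ∣ X ∣ (ρ ⊤) (ρ (∁ X)) (begin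
    ∣ X ∣ + ρ ⊤                                            ≡⟨ cong₂ _+_ (sym eq) ρ-⊤ ⟩
    (∣ X ∣ + r Q (E Q ─ X) ∸ r Q (E Q)) + r Q (E Q)        ≡⟨ ℕₚ.m∸n+n≡m large ⟩
    ∣ X ∣ + r Q (E Q ─ X)                                  ≡⟨ cong (∣ X ∣ +_) (sym (ρ-∁ X)) ⟩
    ∣ X ∣ + ρ (∁ X) ∎))
    where
    open ≡-Reasoning
    large : r Q (E Q) ≤ ∣ X ∣ + r Q (E Q ─ X)
    large = ≤-trans (≤-reflexive (sym ρ-⊤)) (≤-trans
      (estimate Q (X ∷ []) (λ X → [] ∣ [] by (X , ~ X) ∷ [] ⊩ ϱ ● ≼ ϱ X ⊕ ϱ (~ X)) refl [] [])
      (+-mono-≤ (≤-trans (rk-≤-∣∣ Q X) (∣p∩q∣≤∣p∣ X (E Q))) (≤-reflexive (ρ-∁ X))))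

  full-corank : ∀ X → ρ ⊤ ≤ ρ (∁ X) → r (Q *) X ≡ ∣ X ∣
  full-corank X full = trans (cong (λ z → ∣ X ∣ + z ∸ r Q (E Q)) (trans (sym (ρ-∁ X))
      (trans (≤-antisym (ρ-mono λ _ → ∈⊤) full) ρ-⊤)))
    (ℕₚ.m+n∸n≡m ∣ X ∣ (r Q (E Q)))

  hyperplane⇒cocircuit : ∀ {D} → HyperplaneComplement Q D → Cocircuit Q D
  hyperplane⇒cocircuit {D} hc = (D⊆E , λ eq → <⇒≱ nonspanning (corank-full D⊆E eq)) ,
    λ { {X} (X⊆D , e , e∈D , e∉X) → D⊆E ∘ X⊆D , full-corank X (≤-trans (spanning⁺ e∈D) (ρ-mono
      (sets (X ∷ D ∷ ⁅ e ⁆ ∷ []) (λ X D e → X ⊑ D ∷ e ⊑ ~ X ∷ [] ⊢ ~ D ⊔ e ⊑ ~ X) refl (X⊆D ∷ ∉! e∉X ∷ [])))) }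
    where open HyperplaneComplement hc

  cocircuit⇒hyperplane : ∀ {D} → Cocircuit Q D → HyperplaneComplement Q D
  cocircuit⇒hyperplane {D} ((D⊆E , dep) , minimal) = record
    { D⊆E = D⊆E
    ; nonspanning = ≰⇒> λ full → dep (full-corank D full)
    ; spanning⁺ = λ {e} e∈D → ≤-trans
        (corank-full (D⊆E ∘ p─q⊆p D ⁅ e ⁆) (proj₂ (minimal (x∈p⇒p-x⊂p e∈D))))
        (ρ-mono (sets (D ∷ ⁅ e ⁆ ∷ []) (λ D e → [] ⊢ ~ (D ∖ e) ⊑ ~ D ⊔ e) refl []))
    }

-- Connectivity of M / L and of M / x for a point x of L.

module ThreePoints {n} (M : Matroid n) (M3 : ThreeConnected M) (4≤∣E∣ : 4 ≤ ∣ E M ∣)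
  {L : Subset n} (L⊆E : L ⊆ E M) (ρL≤2 : rk M L ≤ 2)
  (flat : ∀ {e} → e ∈ E M → e ∉ L → 3 ≤ rk M (L ∪ ⁅ e ⁆)) where

  open Rank M
  open ThreeConnected M3
  open Simple M M3 4≤∣E∣
  open Partitions M M3 4≤∣E∣
  open Verticals M M3 4≤∣E∣
  open Pencil M M3 4≤∣E∣ L⊆E ρL≤2 flat

  module Contracted (2≤ρL : 2 ≤ ρ L) where

    ρL≡2 : ρ L ≡ 2
    ρL≡2 = ≤-antisym ρL≤2 2≤ρL

    rk-/L : ∀ S → rk (M / L) S + 2 ≡ ρ (S ∪ L)
    rk-/L S = trans (cong (rk (M / L) S +_) (sym ρL≡2)) (rk-/ M L S)

    rk-/L-⊤ : rk (M / L) ⊤ + 2 ≡ ρ ⊤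
    rk-/L-⊤ = trans (rk-/L ⊤) (ρ-cong (λ _ → ∈⊤) (p⊆p∪q L))

    bound-/L : ∀ S k → rk (M / L) ⊤ + k ≤ rk (M / L) S + rk (M / L) (∁ S) →
               ρ ⊤ + (2 + k) ≤ ρ (S ∪ L) + ρ (∁ S ∪ L)
    bound-/L S k le = begin
      ρ ⊤ + (2 + k)                                      ≡⟨ cong (_+ (2 + k)) (sym rk-/L-⊤) ⟩
      (rk (M / L) ⊤ + 2) + (2 + k)                       ≡⟨ cong ((rk (M / L) ⊤ + 2) +_) (+-comm 2 k) ⟩
      (rk (M / L) ⊤ + 2) + (k + 2)                       ≡⟨ +-swap (rk (M / L) ⊤) 2 k 2 ⟩
      (rk (M / L) ⊤ + k) + (2 + 2)                       ≤⟨ +-monoˡ-≤ 4 le ⟩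
      (rk (M / L) S + rk (M / L) (∁ S)) + (2 + 2)        ≡⟨ +-swap (rk (M / L) S) _ 2 2 ⟩
      (rk (M / L) S + 2) + (rk (M / L) (∁ S) + 2)        ≡⟨ cong₂ _+_ (rk-/L S) (rk-/L (∁ S)) ⟩
      ρ (S ∪ L) + ρ (∁ S ∪ L) ∎
      where open ℕₚ.≤-Reasoning

    bound-/L⁻ : ∀ S k → ρ ⊤ + (2 + k) ≤ ρ (S ∪ L) + ρ (∁ S ∪ L) →
                rk (M / L) ⊤ + k ≤ rk (M / L) S + rk (M / L) (∁ S)
    bound-/L⁻ S k le = +-cancelʳ-≤ 4 _ _ (begin
      (rk (M / L) ⊤ + k) + (2 + 2)                       ≡⟨ +-swap (rk (M / L) ⊤) k 2 2 ⟩
      (rk (M / L) ⊤ + 2) + (k + 2)                       ≡⟨ cong₂ _+_ rk-/L-⊤ (+-comm k 2) ⟩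
      ρ ⊤ + (2 + k)                                      ≤⟨ le ⟩
      ρ (S ∪ L) + ρ (∁ S ∪ L)                            ≡⟨ cong₂ _+_ (sym (rk-/L S)) (sym (rk-/L (∁ S))) ⟩
      (rk (M / L) S + 2) + (rk (M / L) (∁ S) + 2)        ≡⟨ +-swap (rk (M / L) S) 2 _ 2 ⟩
      (rk (M / L) S + rk (M / L) (∁ S)) + (2 + 2) ∎)
      where open ℕₚ.≤-Reasoning

  module Triple {x₁ x₂ x₃} (x₁∈L : x₁ ∈ L) (x₂∈L : x₂ ∈ L) (x₃∈L : x₃ ∈ L)
    (x₁≢x₂ : x₁ ≢ x₂) (x₁≢x₃ : x₁ ≢ x₃) (x₂≢x₃ : x₂ ≢ x₃)
    (c₁ : Cocircuit-at x₁) (c₂ : Cocircuit-at x₂) (c₃ : Cocircuit-at x₃) where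

    open Contracted (1<ρ L (L⊆E x₁∈L) (L⊆E x₂∈L) x₁≢x₂ x₁∈L x₂∈L)

    private
      elt : ∀ {w} → Cocircuit-at w → Fin n
      elt = proj₁

      one : ∀ {S s} → S ⊆ ∁ L → s ∈ E M → s ∈ S → elt c₁ ∉ S → ρ ⊤ + 3 ≤ ρ (S ∪ L) + ρ (∁ S)
      one S⊆ s∈E s∈S y∉S = Point.conn-/₁ x₁∈L (proj₁ (proj₂ c₁)) (proj₁ (proj₂ (proj₂ c₁))) (proj₂ (proj₂ (proj₂ c₁)))
        x₂∈L (x₁≢x₂ ∘ sym) S⊆ y∉S s∈E s∈S

      -- A set avoiding the element attached to v does not span w ≠ v.

      two : ∀ {S v w} (v∈L : v ∈ L) (w∈L : w ∈ L) → v ≢ w → (cv : Cocircuit-at v) (cw : Cocircuit-at w) →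
            S ⊆ ∁ L → Two S → elt cv ∉ S → elt cw ∉ S → ρ ⊤ + 4 ≤ ρ (S ∪ L) + ρ (∁ S)
      two {S} v∈L w∈L v≢w (yv , yv∈E , yv∉L , hv) (yw , yw∈E , yw∉L , hw) S⊆ (a , b , a≢b , (a∈S , a∈E) , (b∈S , b∈E)) yv∉S yw∉S =
        Point.conn-/₂ w∈L yw∈E yw∉L hw v∈L v≢w S⊆ yw∉S (1<ρ S a∈E b∈E a≢b a∈S b∈S)
          (Point.off v∈L yv∈E yv∉L hv (Point.w∈X v∈L yv∈E yv∉L hv w∈L (v≢w ∘ sym))
            (Point.avoids-X v∈L yv∈E yv∉L hv S⊆ yv∉S))

    module _ (S : Subset n) where

      private
        S₀ T₀ : Subset n
        S₀ = S ─ L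
        T₀ = ∁ S ─ L

        S₀⊆ : S₀ ⊆ ∁ L
        S₀⊆ = sets (S ∷ L ∷ []) (λ S L → [] ⊢ S ∖ L ⊑ ~ L) refl []
        T₀⊆ : T₀ ⊆ ∁ L
        T₀⊆ = sets (S ∷ L ∷ []) (λ S L → [] ⊢ ~ S ∖ L ⊑ ~ L) refl []

        from-S : ∀ {k} → ρ ⊤ + k ≤ ρ (S₀ ∪ L) + ρ (∁ S₀) → ρ ⊤ + k ≤ ρ (S ∪ L) + ρ (∁ S ∪ L)
        from-S le = ≤-trans le (+-mono-≤
          (ρ-mono (sets (S ∷ L ∷ []) (λ S L → [] ⊢ (S ∖ L) ⊔ L ⊑ S ⊔ L) refl []))
          (ρ-mono (sets (S ∷ L ∷ []) (λ S L → [] ⊢ ~ (S ∖ L) ⊑ ~ S ⊔ L) refl [])))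

        from-T : ∀ {k} → ρ ⊤ + k ≤ ρ (T₀ ∪ L) + ρ (∁ T₀) → ρ ⊤ + k ≤ ρ (S ∪ L) + ρ (∁ S ∪ L)
        from-T le = ≤-trans le (≤-trans (≤-reflexive (+-comm (ρ (T₀ ∪ L)) _)) (+-mono-≤
          (ρ-mono (sets (S ∷ L ∷ []) (λ S L → [] ⊢ ~ (~ S ∖ L) ⊑ S ⊔ L) refl []))
          (ρ-mono (sets (S ∷ L ∷ []) (λ S L → [] ⊢ (~ S ∖ L) ⊔ L ⊑ ~ S ⊔ L) refl []))))

        ∉T₀ : ∀ {y} → y ∈ S₀ → y ∉ T₀
        ∉T₀ y∈S₀ y∈T₀ = x∈∁p⇒x∉p (proj₁ (∈-─⁻ {p = ∁ S} y∈T₀)) (proj₁ (∈-─⁻ {p = S} y∈S₀))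

      bound₁ : ∀ {a c} → a ∈ E M → c ∈ E M → a ∈ S₀ → c ∈ T₀ → ρ ⊤ + 3 ≤ ρ (S ∪ L) + ρ (∁ S ∪ L)
      bound₁ {a} {c} a∈E c∈E a∈ c∈ = side (elt c₁ ∈? S₀)
        where
        side : Dec (elt c₁ ∈ S₀) → ρ ⊤ + 3 ≤ ρ (S ∪ L) + ρ (∁ S ∪ L)
        side (yes y∈) = from-T (one T₀⊆ c∈E c∈ (∉T₀ y∈))
        side (no y∉)  = from-S (one S₀⊆ a∈E a∈ y∉)

      -- Of the three attached elements two lie both in `S₀` or both off it. In the first case `T₀`
      -- avoids them, in the second `S₀` does, and `two` applies to the side that avoids them.
      bound₂ : Two S₀ → Two T₀ → ρ ⊤ + 4 ≤ ρ (S ∪ L) + ρ (∁ S ∪ L)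
      bound₂ twoS twoT = side (elt c₁ ∈? S₀) (elt c₂ ∈? S₀) (elt c₃ ∈? S₀)
        where
        side : Dec (elt c₁ ∈ S₀) → Dec (elt c₂ ∈ S₀) → Dec (elt c₃ ∈ S₀) → ρ ⊤ + 4 ≤ ρ (S ∪ L) + ρ (∁ S ∪ L)
        side (no p) (no q) _ = from-S (two x₁∈L x₂∈L x₁≢x₂ c₁ c₂ S₀⊆ twoS p q)
        side (no p) (yes _) (no q) = from-S (two x₁∈L x₃∈L x₁≢x₃ c₁ c₃ S₀⊆ twoS p q)
        side (yes _) (no p) (no q) = from-S (two x₂∈L x₃∈L x₂≢x₃ c₂ c₃ S₀⊆ twoS p q)
        side (yes p) (yes q) _ = from-T (two x₁∈L x₂∈L x₁≢x₂ c₁ c₂ T₀⊆ twoT (∉T₀ p) (∉T₀ q))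
        side (yes p) (no _) (yes q) = from-T (two x₁∈L x₃∈L x₁≢x₃ c₁ c₃ T₀⊆ twoT (∉T₀ p) (∉T₀ q))
        side (no _) (yes p) (yes q) = from-T (two x₂∈L x₃∈L x₂≢x₃ c₂ c₃ T₀⊆ twoT (∉T₀ p) (∉T₀ q))

    contraction-3-connected : ThreeConnected (M / L)
    contraction-3-connected = record
      { conn₁ = λ S a∈ c∈ a∈S c∉S → bound-/L⁻ S 1 (bound₁ S (proj₁ (∈-─⁻ {p = E M} a∈)) (proj₁ (∈-─⁻ {p = E M} c∈))
          (inner a∈ a∈S) (inner c∈ (x∉p⇒x∈∁p c∉S)))
      ; conn₂ = λ S a∈ b∈ c∈ d∈ a≢b c≢d a∈S b∈S c∉S d∉S → bound-/L⁻ S 2 (bound₂ S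
          (_ , _ , a≢b , (inner a∈ a∈S , proj₁ (∈-─⁻ {p = E M} a∈)) , (inner b∈ b∈S , proj₁ (∈-─⁻ {p = E M} b∈)))
          (_ , _ , c≢d , (inner c∈ (x∉p⇒x∈∁p c∉S) , proj₁ (∈-─⁻ {p = E M} c∈)) ,
                         (inner d∈ (x∉p⇒x∈∁p d∉S) , proj₁ (∈-─⁻ {p = E M} d∈))))
      }
      where
      inner : ∀ {e S} → e ∈ E M ─ L → e ∈ S → e ∈ S ─ L
      inner e∈ e∈S = ∈-─⁺ e∈S (proj₂ (∈-─⁻ {p = E M} e∈))

  module UniqueSpore (ML3 : ThreeConnected (M / L)) (4≤∣E─L∣ : 4 ≤ ∣ E M ─ L ∣)
    {x y v w} (x∈L : x ∈ L) (v∈L : v ∈ L) (w∈L : w ∈ L) (v≢x : v ≢ x) (w≢x : w ≢ x) (v≢w : v ≢ w)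
    (y∈E : y ∈ E M) (y∉L : y ∉ L) (hc : HyperplaneComplement M ((L - x) ∪ ⁅ y ⁆)) where

    open HyperplaneComplement hc
    open Contracted (1<ρ L (L⊆E v∈L) (L⊆E x∈L) v≢x v∈L x∈L)
    open Contraction M M3 4≤∣E∣ (L⊆E x∈L) using (rk-/x)

    private
      module ML = Simple (M / L) ML3 4≤∣E─L∣

      x∈E : x ∈ E M
      x∈E = L⊆E x∈L

    Q : Matroid n
    Q = M / ⁅ x ⁆

    P D : Subset n
    P = L - x
    D = P ∪ ⁅ y ⁆

    x∉D : x ∉ D
    x∉D = Point.x∉X x∈L y∈E y∉L hc

    ρ-E : ∀ {S T′} → S ∩ E M ⊆ T′ → ρ S ≤ ρ T′
    ρ-E {S} {T′} S⊆ = ≤-trans (≤-reflexive (cong (r M) (⊆-antisym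
        (sets (S ∷ E M ∷ []) (λ S E → [] ⊢ S ⊓ E ⊑ (S ⊓ E) ⊓ E) refl [])
        (sets (S ∷ E M ∷ []) (λ S E → [] ⊢ (S ⊓ E) ⊓ E ⊑ S ⊓ E) refl [])))) (ρ-mono S⊆)

    rk-/x-⊤ : rk Q ⊤ + 1 ≡ ρ ⊤
    rk-/x-⊤ = trans (rk-/x ⊤) (ρ-cong (λ _ → ∈⊤) (p⊆p∪q ⁅ x ⁆))

    rk-/x-∋ : ∀ {S} → x ∈ S → rk Q S + 1 ≡ ρ S
    rk-/x-∋ {S} x∈S = trans (rk-/x S) (ρ-cong (∪-⊆ id (∈! x∈S)) (p⊆p∪q ⁅ x ⁆))

    hyperplane-/ : ∀ {D} → x ∉ D → HyperplaneComplement M D → HyperplaneComplement Q D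
    hyperplane-/ {D} x∉D h = record
      { D⊆E = λ e∈ → ∈-─⁺ (H.D⊆E e∈) (λ e∈x → x∉D (subst (_∈ D) (x∈⁅y⁆⇒x≡y x e∈x) e∈))
      ; nonspanning = +-cancelʳ-≤ 1 _ _ (≤-trans (≤-reflexive (cong suc (rk-/x-∋ (x∉p⇒x∈∁p x∉D))))
          (≤-trans H.nonspanning (≤-reflexive (sym rk-/x-⊤))))
      ; spanning⁺ = λ {e} e∈ → +-cancelʳ-≤ 1 _ _ (≤-trans (≤-reflexive rk-/x-⊤)
          (≤-trans (H.spanning⁺ e∈) (≤-reflexive (sym (rk-/x-∋ (p⊆p∪q ⁅ e ⁆ (x∉p⇒x∈∁p x∉D))))))) }
      where module H = HyperplaneComplement h

    hyperplane-/⁻ : ∀ {D} → HyperplaneComplement Q D → x ∉ D × HyperplaneComplement M D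
    hyperplane-/⁻ {D} h = x∉D′ , record
      { D⊆E = proj₁ ∘ ∈--⁻ ∘ H.D⊆E
      ; nonspanning = ≤-trans (≤-reflexive (cong suc (sym (rk-/x-∋ (x∉p⇒x∈∁p x∉D′)))))
          (≤-trans (+-monoˡ-≤ 1 H.nonspanning) (≤-reflexive rk-/x-⊤))
      ; spanning⁺ = λ {e} e∈ → ≤-trans (≤-reflexive (sym rk-/x-⊤))
          (≤-trans (+-monoˡ-≤ 1 (H.spanning⁺ e∈)) (≤-reflexive (rk-/x-∋ (p⊆p∪q ⁅ e ⁆ (x∉p⇒x∈∁p x∉D′))))) }
      where
      module H = HyperplaneComplement h
      x∉D′ : x ∉ D
      x∉D′ x∈D = proj₂ (∈--⁻ (H.D⊆E x∈D)) refl

    -- If `A` meets `L`, then `A ∪ ⁅ x ⁆` spans `L`, while the other side contains `x` and gains at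
    -- most 1. If not, `L` lies on the other side and only `A ∪ ⁅ x ⁆` gains at most 1.
    sep-/L : ∀ A → x ∉ A → ρ (A ∪ ⁅ x ⁆) + ρ (∁ A) ≤ ρ ⊤ + 2 → ρ (A ∪ L) + ρ (∁ A ∪ L) ≤ ρ ⊤ + 3
    sep-/L A x∉A sep = cases (nonempty? (A ∩ L))
      where
      cases : Dec (Nonempty (A ∩ L)) → ρ (A ∪ L) + ρ (∁ A ∪ L) ≤ ρ ⊤ + 3
      cases (yes (u , u∈)) = estimate M (A ∷ L ∷ ⁅ x ⁆ ∷ ⁅ u ⁆ ∷ [])
        (λ A L x u → x ⊑ L ∷ u ⊑ A ⊓ L ∷ x ⊑ ~ A ∷ []
          ∣ ϱ (A ⊔ x) ⊕ ϱ (~ A) ≼ ϱ ● ⊕ # 2 ∷ # 2 ≼ ϱ (u ⊔ x) ∷ # 1 ≼ ϱ x ∷ ϱ L ≼ # 2 ∷ ϱ L ≼ # 2 ∷ []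
          by (A ⊔ x , L) ∷ (~ A , L) ∷ []
          ⊩ ϱ (A ⊔ L) ⊕ ϱ (~ A ⊔ L) ≼ ϱ ● ⊕ # 3)
        refl (∈! x∈L ∷ ∈! u∈ ∷ ∉! x∉A ∷ [])
        (sep ∷ 1<ρ-pair (L⊆E (p∩q⊆q A L u∈)) x∈E (λ { refl → x∉A (p∩q⊆p A L u∈) }) ∷ 0<ρ⁅⁆ x∈E ∷ ρL≤2 ∷ ρL≤2 ∷ [])
      cases (no none) = estimate M (A ∷ L ∷ ⁅ x ⁆ ∷ [])
        (λ A L x → x ⊑ L ∷ A ⊓ L ⊑ ○ ∷ []
          ∣ ϱ (A ⊔ x) ⊕ ϱ (~ A) ≼ ϱ ● ⊕ # 2 ∷ # 1 ≼ ϱ x ∷ ϱ L ≼ # 2 ∷ []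
          by (A ⊔ x , L) ∷ []
          ⊩ ϱ (A ⊔ L) ⊕ ϱ (~ A ⊔ L) ≼ ϱ ● ⊕ # 3)
        refl (∈! x∈L ∷ (λ z∈ → contradiction (_ , z∈) none) ∷ []) (sep ∷ 0<ρ⁅⁆ x∈E ∷ ρL≤2 ∷ [])

    -- With an element a ≠ y of A off L, {a , y} would be a series pair.

    thin : ∀ {A} → A ⊆ E M → x ∉ A → 2 ≤ ∣ A ∣ → ∣ A ─ L ∣ ≤ 1 → ρ (A ∪ ⁅ x ⁆) + ρ (∁ A) ≤ ρ ⊤ + 2 → A ⊆ D
    thin {A} A⊆E x∉A 2≤A A─L≤1 sep = cases (nonempty? ((A ─ L) - y))
      where
      absurd : ∀ {a} → a ∈ A ─ L → y ≢ a → (∃ λ b → b ∈ A × a ≢ b) → Empty.⊥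
      absurd {a} a∈ y≢a (u , u∈A , a≢u) = 1+n≰n {0} (estimate M (A ∷ L ∷ ⁅ x ⁆ ∷ ⁅ y ⁆ ∷ ⁅ a ⁆ ∷ ⁅ u ⁆ ∷ [])
        (λ A L x y a u → A ∖ L ⊑ a ∷ x ⊑ L ∷ x ⊑ ~ A ∷ u ⊑ A ⊓ L ∷ a ⊑ A ∖ L ∷ y ⊑ ~ L ∷ y ⊑ ~ a ∷ []
          ∣ ϱ (A ⊔ x) ⊕ ϱ (~ A) ≼ ϱ ● ⊕ # 2 ∷ # 3 ≼ ϱ (L ⊔ a) ∷ ϱ L ≼ # 2 ∷ # 2 ≼ ϱ (u ⊔ x)
          ∷ # 1 ⊕ ϱ (~ ((L ∖ x) ⊔ y)) ≼ ϱ ● ∷ ϱ ● ≼ ϱ (~ ((L ∖ x) ⊔ y) ⊔ y) ∷ ϱ ● ≼ ϱ (~ (a ⊔ y))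
          ∷ ϱ L ≼ # 2 ∷ # 1 ≼ ϱ x ∷ []
          by (A ⊔ x , L) ∷ (~ A , ~ ((L ∖ x) ⊔ y)) ∷ (~ (A ⊔ ((L ∖ x) ⊔ y)) , L) ∷ []
          ⊩ # 1 ≼ # 0)
        refl (A─L⊆ ∷ ∈! x∈L ∷ ∉! x∉A ∷ ∈! (x∈p∩q⁺ (u∈A , u∈L)) ∷ ∈! a∈ ∷ ∉! y∉L ∷ ≢! y≢a ∷ [])
        (sep ∷ flat (A⊆E (proj₁ (∈-─⁻ {p = A} a∈))) (proj₂ (∈-─⁻ {p = A} a∈)) ∷ ρL≤2
          ∷ 1<ρ-pair (A⊆E u∈A) x∈E (λ { refl → x∉A u∈A }) ∷ nonspanning
          ∷ spanning⁺ (q⊆p∪q P ⁅ y ⁆ (x∈⁅x⁆ y))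
          ∷ ρ∁-pair (A⊆E (proj₁ (∈-─⁻ {p = A} a∈))) y∈E (y≢a ∘ sym) ∷ ρL≤2 ∷ 0<ρ⁅⁆ x∈E ∷ []))
        where
        A─L⊆ : A ─ L ⊆ ⁅ a ⁆
        A─L⊆ {b} b∈ = case b ≟ᶠ a of λ where
          (yes refl) → x∈⁅x⁆ a
          (no b≢a) → contradiction (1<∣∣ b≢a b∈ a∈) (ℕₚ.≤⇒≯ A─L≤1)
        u∈L : u ∈ L
        u∈L = case u ∈? L of λ where
          (yes p) → p
          (no p) → contradiction (sym (x∈⁅y⁆⇒x≡y a (A─L⊆ (∈-─⁺ u∈A p)))) a≢u
      another : ∀ a → ∃ λ b → b ∈ A × a ≢ b
      another a = go (1<∣∣⁻ A 2≤A)
        where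
        go : Pair A → ∃ λ b → b ∈ A × a ≢ b
        go (b , c , b≢c , b∈ , c∈) = case a ≟ᶠ b of λ where
          (yes refl) → c , c∈ , b≢c
          (no a≢b) → b , b∈ , a≢b
      cases : Dec (Nonempty ((A ─ L) - y)) → A ⊆ D
      cases (no none) = sets (A ∷ L ∷ ⁅ x ⁆ ∷ ⁅ y ⁆ ∷ [])
        (λ A L x y → (A ∖ L) ∖ y ⊑ ○ ∷ x ⊑ ~ A ∷ [] ⊢ A ⊑ (L ∖ x) ⊔ y)
        refl ((λ z∈ → contradiction (_ , z∈) none) ∷ ∉! x∉A ∷ [])
      cases (yes (a , a∈)) = Empty.⊥-elim (absurd (proj₁ (∈--⁻ a∈)) (proj₂ (∈--⁻ a∈)) (another a))

    -- Two elements off `L` on each side would give a 2-separation of M / L. So one side has at most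
    -- one such element, and `thin` applies to it.
    thin-side : ∀ {A} → A ⊆ E Q → 2 ≤ ∣ A ∣ → 2 ≤ ∣ E Q ─ A ∣ → ρ (A ∪ ⁅ x ⁆) + ρ (∁ A) ≤ ρ ⊤ + 2 →
                A ⊆ D ⊎ E Q ─ A ⊆ D
    thin-side {A} A⊆ 2≤A 2≤B sep = cases (2 ℕ.≤? ∣ A ─ L ∣) (2 ℕ.≤? ∣ B ─ L ∣)
      where
      B : Subset n
      B = E Q ─ A
      A⊆E : A ⊆ E M
      A⊆E = proj₁ ∘ ∈--⁻ ∘ A⊆
      B⊆E : B ⊆ E M
      B⊆E = proj₁ ∘ ∈--⁻ ∘ p─q⊆p (E Q) A
      x∉A : x ∉ A
      x∉A x∈A = proj₂ (∈--⁻ (A⊆ x∈A)) refl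
      x∉B : x ∉ B
      x∉B x∈B = proj₂ (∈--⁻ (p─q⊆p (E Q) A x∈B)) refl
      sepB : ρ (B ∪ ⁅ x ⁆) + ρ (∁ B) ≤ ρ ⊤ + 2
      sepB = ≤-trans (+-mono-≤
        (ρ-mono (sets (A ∷ E M ∷ ⁅ x ⁆ ∷ []) (λ A E x → x ⊑ ~ A ∷ [] ⊢ ((E ∖ x) ∖ A) ⊔ x ⊑ ~ A) refl (∉! x∉A ∷ [])))
        (ρ-E (sets (A ∷ E M ∷ ⁅ x ⁆ ∷ []) (λ A E x → [] ⊢ ~ ((E ∖ x) ∖ A) ⊓ E ⊑ A ⊔ x) refl [])))
        (≤-trans (≤-reflexive (+-comm (ρ (∁ A)) _)) sep)
      cases : Dec (2 ≤ ∣ A ─ L ∣) → Dec (2 ≤ ∣ B ─ L ∣) → A ⊆ D ⊎ B ⊆ D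
      cases (no ≱2) _ = inj₁ (thin A⊆E x∉A 2≤A (ℕ.s≤s⁻¹ (≰⇒> ≱2)) sep)
      cases (yes _) (no ≱2) = inj₂ (thin B⊆E x∉B 2≤B (ℕ.s≤s⁻¹ (≰⇒> ≱2)) sepB)
      cases (yes 2≤A′) (yes 2≤B′) = Empty.⊥-elim (go (1<∣∣⁻ (A ─ L) 2≤A′) (1<∣∣⁻ (B ─ L) 2≤B′))
        where
        go : Pair (A ─ L) → Pair (B ─ L) → Empty.⊥
        go (a , b , a≢b , a∈ , b∈) (c , d , c≢d , c∈ , d∈) = <⇒≱
          (ℕₚ.≤-<-trans (sep-/L A x∉A sep) (ℕₚ.+-monoʳ-< (ρ ⊤) (ℕₚ.n<1+n 3)))
          (bound-/L A 2 (ThreeConnected.conn₂ ML3 A (inA a∈) (inA b∈) (inB c∈) (inB d∈) a≢b c≢d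
            (proj₁ (∈-─⁻ a∈)) (proj₁ (∈-─⁻ b∈)) (offA c∈) (offA d∈)))
          where
          inA : ∀ {e} → e ∈ A ─ L → e ∈ E M ─ L
          inA e∈ = ∈-─⁺ (A⊆E (proj₁ (∈-─⁻ e∈))) (proj₂ (∈-─⁻ e∈))
          inB : ∀ {e} → e ∈ B ─ L → e ∈ E M ─ L
          inB e∈ = ∈-─⁺ (B⊆E (proj₁ (∈-─⁻ e∈))) (proj₂ (∈-─⁻ e∈))
          offA : ∀ {e} → e ∈ B ─ L → e ∉ A
          offA e∈ = proj₂ (∈-─⁻ {p = E Q} (proj₁ (∈-─⁻ {p = B} e∈)))

    connected-/x : ∀ {A a} → A ⊆ E Q → a ∈ A → 1 ≤ ∣ E Q ─ A ∣ → ρ ⊤ + 2 ≤ ρ (A ∪ ⁅ x ⁆) + ρ (∁ A)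
    connected-/x {A} {a} A⊆ a∈A 1≤B = go (0<∣∣⁻ (E Q ─ A) 1≤B)
      where
      A⊆E : A ⊆ E M
      A⊆E = proj₁ ∘ ∈--⁻ ∘ A⊆
      x∉A : x ∉ A
      x∉A x∈A = proj₂ (∈--⁻ (A⊆ x∈A)) refl
      go : Nonempty (E Q ─ A) → ρ ⊤ + 2 ≤ ρ (A ∪ ⁅ x ⁆) + ρ (∁ A)
      go (c , c∈) = cases (2 ℕ.≤? ρ A)
        where
        c∈EQ : c ∈ E Q
        c∈EQ = proj₁ (∈-─⁻ {p = E Q} c∈)
        c∉A : c ∉ A
        c∉A = proj₂ (∈-─⁻ {p = E Q} c∈)
        cases : Dec (2 ≤ ρ A) → ρ ⊤ + 2 ≤ ρ (A ∪ ⁅ x ⁆) + ρ (∁ A)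
        cases (yes 2≤) = ≤-trans (conn-two A
          (c , x , proj₂ (∈--⁻ c∈EQ) ∘ sym , (x∉p⇒x∈∁p c∉A , proj₁ (∈--⁻ c∈EQ)) , (x∉p⇒x∈∁p x∉A , x∈E)) 2≤)
          (+-monoˡ-≤ (ρ (∁ A)) (ρ-mono (p⊆p∪q ⁅ x ⁆)))
        cases (no 2≰) = estimate M (A ∷ ⁅ x ⁆ ∷ ⁅ a ⁆ ∷ [])
          (λ A x a → a ⊑ A ∷ [] ∣ ϱ A ≼ # 1 ∷ ϱ ● ⊕ # 1 ≼ ϱ A ⊕ ϱ (~ A) ∷ # 2 ≼ ϱ (a ⊔ x) ∷ [] by []
            ⊩ ϱ ● ⊕ # 2 ≼ ϱ (A ⊔ x) ⊕ ϱ (~ A))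
          refl (∈! a∈A ∷ [])
          (ℕ.s≤s⁻¹ (≰⇒> 2≰) ∷ conn₁ A (A⊆E a∈A) x∈E a∈A x∉A
            ∷ 1<ρ-pair (A⊆E a∈A) x∈E (λ { refl → x∉A a∈A }) ∷ [])

    sep-from-Q : ∀ {A k} → x ∉ A → rk Q A + rk Q (∁ A) < rk Q ⊤ + k → ρ (A ∪ ⁅ x ⁆) + ρ (∁ A) < ρ ⊤ + (1 + k)
    sep-from-Q {A} {k} x∉A lt = begin-strict
      ρ (A ∪ ⁅ x ⁆) + ρ (∁ A)        ≡⟨ cong₂ _+_ (sym (rk-/x A)) (sym (rk-/x-∋ (x∉p⇒x∈∁p x∉A))) ⟩
      (rk Q A + 1) + (rk Q (∁ A) + 1) ≡⟨ +-swap (rk Q A) 1 _ 1 ⟩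
      (rk Q A + rk Q (∁ A)) + 2      <⟨ ℕₚ.+-monoˡ-< 2 lt ⟩
      (rk Q ⊤ + k) + (1 + 1)         ≡⟨ +-swap (rk Q ⊤) k 1 1 ⟩
      (rk Q ⊤ + 1) + (k + 1)         ≡⟨ cong₂ _+_ rk-/x-⊤ (+-comm k 1) ⟩
      ρ ⊤ + (1 + k) ∎
      where open ℕₚ.≤-Reasoning

    separations : ∀ {k A} → k < 3 → Separation Q k A → A ⊆ D ⊎ E Q ─ A ⊆ D
    separations {0} _ (() , _)
    separations {1} {A} _ (_ , A⊆ , lt , 1≤A , 1≤B) = Empty.⊥-elim (go (0<∣∣⁻ A 1≤A))
      where
      x∉A : x ∉ A
      x∉A x∈A = proj₂ (∈--⁻ (A⊆ x∈A)) refl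
      go : Nonempty A → Empty.⊥
      go (a , a∈A) = <⇒≱ (sep-from-Q x∉A (Rank.<-conn Q 1 A⊆ lt)) (connected-/x A⊆ a∈A 1≤B)
    separations {2} {A} _ (_ , A⊆ , lt , 2≤A , 2≤B) = thin-side A⊆ 2≤A 2≤B
      (ℕ.s≤s⁻¹ (≤-trans (sep-from-Q (λ x∈A → proj₂ (∈--⁻ (A⊆ x∈A)) refl) (Rank.<-conn Q 2 A⊆ lt))
        (≤-reflexive (ℕₚ.+-suc (ρ ⊤) 2))))
    separations {suc (suc (suc _))} (s≤s (s≤s (s≤s ())))

module Closure {n} (Q : Matroid n) where

  open Rank Q

  private
    cl? : ∀ X e → Dec (e ∈ E Q × r Q (X ∪ ⁅ e ⁆) ≡ r Q X)
    cl? X e = (e ∈? E Q) ×-dec (r Q (X ∪ ⁅ e ⁆) ℕ.≟ r Q X)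

  ∈-cl⁺ : ∀ {X e} → X ⊆ E Q → e ∈ E Q → ρ (X ∪ ⁅ e ⁆) ≤ ρ X → e ∈ cl Q X
  ∈-cl⁺ {X} {e} X⊆E e∈E le = ∈-comprehension⁺ (cl? X)
    (e∈E , trans (sym (ρ-⊆E (∪-⊆ X⊆E (∈! e∈E)))) (trans (≤-antisym le (ρ-mono (p⊆p∪q ⁅ e ⁆))) (ρ-⊆E X⊆E)))

  ∈-cl⁻ : ∀ {X e} → X ⊆ E Q → e ∈ cl Q X → e ∈ E Q × ρ (X ∪ ⁅ e ⁆) ≤ ρ X
  ∈-cl⁻ {X} {e} X⊆E e∈ = let e∈E , eq = ∈-comprehension⁻ (cl? X) e∈ in
    e∈E , ≤-reflexive (trans (ρ-⊆E (∪-⊆ X⊆E (∈! e∈E))) (trans eq (sym (ρ-⊆E X⊆E))))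

-- The unique spore of M / x.

module SporeOf {n} (M : Matroid n) (M3 : ThreeConnected M) (4≤∣E∣ : 4 ≤ ∣ E M ∣)
  {L : Subset n} (L⊆E : L ⊆ E M) (ρL≤2 : rk M L ≤ 2)
  (flat : ∀ {e} → e ∈ E M → e ∉ L → 3 ≤ rk M (L ∪ ⁅ e ⁆))
  (ML3 : ThreeConnected (M / L)) (4≤∣E─L∣ : 4 ≤ ∣ E M ─ L ∣)
  {x y v w} (x∈L : x ∈ L) (v∈L : v ∈ L) (w∈L : w ∈ L) (v≢x : v ≢ x) (w≢x : w ≢ x) (v≢w : v ≢ w)
  (y∈E : y ∈ E M) (y∉L : y ∉ L) (hc : HyperplaneComplement M ((L - x) ∪ ⁅ y ⁆)) where

  open Rank M
  open Simple M M3 4≤∣E∣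
  open ThreePoints M M3 4≤∣E∣ L⊆E ρL≤2 flat
  open UniqueSpore ML3 4≤∣E─L∣ x∈L v∈L w∈L v≢x w≢x v≢w y∈E y∉L hc
  open Contracted (1<ρ L (L⊆E v∈L) (L⊆E x∈L) v≢x v∈L x∈L)
  open Contraction M M3 4≤∣E∣ (L⊆E x∈L) using (rk-/x)

  private
    module ML = Simple (M / L) ML3 4≤∣E─L∣
    module Qʳ = Rank Q
    module HC = HyperplaneComplement hc

    x∈E : x ∈ E M
    x∈E = L⊆E x∈L

    ∈EQ : ∀ {e} → e ∈ E M → e ≢ x → e ∈ E Q
    ∈EQ e∈E e≢x = ∈--⁺ e∈E e≢x

    P⊆EQ : P ⊆ E Q
    P⊆EQ e∈ = ∈EQ (L⊆E (proj₁ (∈--⁻ e∈))) (proj₂ (∈--⁻ e∈) ∘ sym)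

    y∈EQ : y ∈ E Q
    y∈EQ = ∈EQ y∈E (λ { refl → y∉L x∈L })

    v∈P : v ∈ P
    v∈P = ∈--⁺ v∈L v≢x

    P∪x : ρ (P ∪ ⁅ x ⁆) ≡ ρ L
    P∪x = ρ-cong (sets (L ∷ ⁅ x ⁆ ∷ []) (λ L x → x ⊑ L ∷ [] ⊢ (L ∖ x) ⊔ x ⊑ L) refl (∈! x∈L ∷ []))
      (sets (L ∷ ⁅ x ⁆ ∷ []) (λ L x → [] ⊢ L ⊑ (L ∖ x) ⊔ x) refl [])

    rkP : rk Q P ≡ 1
    rkP = ℕₚ.+-cancelʳ-≡ 1 (rk Q P) 1 (trans (rk-/x P) (trans P∪x ρL≡2))

    -- Both `L` and the span of `S ∪ ⁅ x ⁆` are the line through `x` and `u`.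
    on-L : ∀ {S e u} → ρ (S ∪ ⁅ x ⁆) ≤ 2 → u ∈ S → u ∈ L → u ≢ x → e ∈ S → e ∈ E M → e ∈ L
    on-L {S} {e} {u} ρS u∈S u∈L u≢x e∈S e∈E = case e ∈? L of λ where
      (yes e∈L) → e∈L
      (no e∉L) → contradiction (estimate M (S ∷ L ∷ ⁅ x ⁆ ∷ ⁅ e ⁆ ∷ ⁅ u ⁆ ∷ [])
        (λ S L x e u → x ⊑ L ∷ u ⊑ S ⊓ L ∷ e ⊑ S ∷ []
          ∣ ϱ (S ⊔ x) ≼ # 2 ∷ ϱ L ≼ # 2 ∷ # 2 ≼ ϱ (u ⊔ x) ∷ # 3 ≼ ϱ (L ⊔ e) ∷ []
          by (S ⊔ x , L) ∷ [] ⊩ # 1 ≼ # 0)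
        refl (∈! x∈L ∷ ∈! (x∈p∩q⁺ (u∈S , u∈L)) ∷ ∈! e∈S ∷ [])
        (ρS ∷ ρL≤2 ∷ 1<ρ-pair (L⊆E u∈L) x∈E u≢x ∷ flat e∈E e∉L ∷ [])) λ ()

  spore : Spore Q P y
  spore = ((P⊆EQ , ⊆-antisym cl⊆P P⊆cl) , trans (sym (Qʳ.ρ-⊆E P⊆EQ)) rkP) , y∈EQ ,
          Cocircuits.hyperplane⇒cocircuit Q (hyperplane-/ x∉D hc)
    where
    cl⊆P : cl Q P ⊆ P
    cl⊆P {e} e∈ = let e∈EQ , le = Closure.∈-cl⁻ Q P⊆EQ e∈ in
      ∈-─⁺ (on-L {P ∪ ⁅ e ⁆} (line le) (p⊆p∪q ⁅ e ⁆ v∈P) v∈L v≢x (q⊆p∪q P ⁅ e ⁆ (x∈⁅x⁆ e)) (proj₁ (∈--⁻ e∈EQ)))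
        (proj₂ (∈-─⁻ e∈EQ))
      where
      line : rk Q (P ∪ ⁅ e ⁆) ≤ rk Q P → ρ ((P ∪ ⁅ e ⁆) ∪ ⁅ x ⁆) ≤ 2
      line le = ≤-trans (≤-reflexive (sym (rk-/x (P ∪ ⁅ e ⁆))))
        (+-monoˡ-≤ 1 (≤-trans le (≤-reflexive rkP)))
    P⊆cl : P ⊆ cl Q P
    P⊆cl e∈P = Closure.∈-cl⁺ Q P⊆EQ (P⊆EQ e∈P) (rk-mono Q (∪-⊆ id (∈! e∈P)))

  -- The cocircuit of a spore has connectivity at most 1 in M / x, so it or its complement lies in
  -- `D`. The complement is too large, and a cocircuit inside the cocircuit `D` equals it. Of the
  -- elements `v` and `w` of `P` at most one is `s′`, so `P′` contains the other, and rank-one flats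
  -- of M / x with a common nonloop coincide.
  module _ {P′ s′} (spore′ : Spore Q P′ s′) where

    private
      D′ : Subset n
      D′ = P′ ∪ ⁅ s′ ⁆

      P′⊆EQ : P′ ⊆ E Q
      P′⊆EQ = proj₁ (proj₁ (proj₁ spore′))

      P′⊆E : P′ ⊆ E M
      P′⊆E = proj₁ ∘ ∈--⁻ ∘ P′⊆EQ

      x∉P′ : x ∉ P′
      x∉P′ x∈ = proj₂ (∈--⁻ (P′⊆EQ x∈)) refl

      hc′ : x ∉ D′ × HyperplaneComplement M D′
      hc′ = hyperplane-/⁻ (Cocircuits.cocircuit⇒hyperplane Q (proj₂ (proj₂ spore′)))

      module H′ = HyperplaneComplement (proj₂ hc′)

      x∉D′ : x ∉ D′
      x∉D′ = proj₁ hc′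

      rkP′ : rk Q P′ ≡ 1
      rkP′ = trans (Qʳ.ρ-⊆E P′⊆EQ) (proj₂ (proj₁ spore′))

      P′∪x : ρ (P′ ∪ ⁅ x ⁆) ≤ 2
      P′∪x = ≤-reflexive (trans (sym (rk-/x P′)) (cong (_+ 1) rkP′))

      D′⊆EQ : D′ ⊆ E Q
      D′⊆EQ = HyperplaneComplement.D⊆E (Cocircuits.cocircuit⇒hyperplane Q (proj₂ (proj₂ spore′)))

      clutter : D′ ⊆ D → D ⊆ D′
      clutter D′⊆D {e} e∈D = case e ∈? D′ of λ where
        (yes e∈D′) → e∈D′
        (no e∉D′) → contradiction (≤-trans (HC.spanning⁺ e∈D) (ρ-mono
          (sets (D ∷ D′ ∷ ⁅ e ⁆ ∷ []) (λ D D′ e → D′ ⊑ D ∷ e ⊑ ~ D′ ∷ [] ⊢ ~ D ⊔ e ⊑ ~ D′)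
            refl (D′⊆D ∷ ∉! e∉D′ ∷ [])))) (<⇒≱ H′.nonspanning)

      s′∈D′ : s′ ∈ D′
      s′∈D′ = q⊆p∪q P′ ⁅ s′ ⁆ (x∈⁅x⁆ s′)

      2≤∣D′∣ : 2 ≤ ∣ D′ ∣
      2≤∣D′∣ = ≰⇒> λ ≤1 → <⇒≱ H′.nonspanning
        (≤-trans (ρ∁⁅⁆ (H′.D⊆E s′∈D′)) (ρ-mono (p⊆q⇒∁p⊇∁q λ {e} e∈ → only ≤1 e∈ (e ≟ᶠ s′))))
        where
        only : ∀ {e} → ∣ D′ ∣ ≤ 1 → e ∈ D′ → Dec (e ≡ s′) → e ∈ ⁅ s′ ⁆
        only _ e∈ (yes refl) = x∈⁅x⁆ s′
        only ≤1 e∈ (no ne) = contradiction (1<∣∣ ne e∈ s′∈D′) (ℕₚ.≤⇒≯ ≤1)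

      4≤ρ : 4 ≤ ρ ⊤
      4≤ρ = go (others (E M ─ L) 4≤∣E─L∣ y y)
        where
        go : PairOff y y (E M ─ L) → 4 ≤ ρ ⊤
        go (c , d , c≢d , c∈ , d∈ , _) = ≤-trans (+-monoˡ-≤ 2 (ML.1<ρ-pair c∈ d∈ c≢d))
          (≤-trans (≤-reflexive (rk-/L (⁅ c ⁆ ∪ ⁅ d ⁆))) (ρ-mono λ _ → ∈⊤))

      2≤∣EQ─D′∣ : 2 ≤ ∣ E Q ─ D′ ∣
      2≤∣EQ─D′∣ = go (1<ρ⇒∃ (∁ (D′ ∪ ⁅ x ⁆)) (estimate M (D′ ∷ ⁅ s′ ⁆ ∷ ⁅ x ⁆ ∷ [])
        (λ D s x → [] ∣ # 4 ≼ ϱ ● ∷ ϱ ● ≼ ϱ (~ D ⊔ s) ∷ ϱ s ≼ # 1 ∷ ϱ x ≼ # 1 ∷ []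
          by (~ (D ⊔ x) , s ⊔ x) ∷ (s , x) ∷ [] ⊩ # 2 ≼ ϱ (~ (D ⊔ x)))
        refl [] (4≤ρ ∷ H′.spanning⁺ s′∈D′ ∷ ρ-⁅⁆ s′ ∷ ρ-⁅⁆ x ∷ [])))
        where
        inside′ : ∀ {e} → e ∈ ∁ (D′ ∪ ⁅ x ⁆) → e ∈ E M → e ∈ E Q ─ D′
        inside′ {e} e∈ e∈E = ∈-─⁺ (∈-─⁺ e∈E (x∈∁p⇒x∉p e∈ ∘ q⊆p∪q D′ ⁅ x ⁆))
          (x∈∁p⇒x∉p e∈ ∘ p⊆p∪q ⁅ x ⁆)
        go : Two (∁ (D′ ∪ ⁅ x ⁆)) →
             2 ≤ ∣ E Q ─ D′ ∣
        go (a , b , a≢b , (a∈ , a∈E) , (b∈ , b∈E)) = 1<∣∣ a≢b (inside′ a∈ a∈E) (inside′ b∈ b∈E)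

      sepD′ : ρ (D′ ∪ ⁅ x ⁆) + ρ (∁ D′) ≤ ρ ⊤ + 2
      sepD′ = estimate M (P′ ∷ ⁅ s′ ⁆ ∷ ⁅ x ⁆ ∷ [])
        (λ P s x → [] ∣ ϱ (P ⊔ x) ≼ # 2 ∷ ϱ s ≼ # 1 ∷ # 1 ⊕ ϱ (~ (P ⊔ s)) ≼ ϱ ● ∷ []
          by (P ⊔ x , s) ∷ [] ⊩ ϱ ((P ⊔ s) ⊔ x) ⊕ ϱ (~ (P ⊔ s)) ≼ ϱ ● ⊕ # 2)
        refl [] (P′∪x ∷ ρ-⁅⁆ s′ ∷ H′.nonspanning ∷ [])

      -- Otherwise `P′` would contain all of `E M ─ L` except perhaps `y` and `s′`, hence two
      -- elements independent in M / L, although `P′ ∪ ⁅ x ⁆` has rank at most 2 and shares `x` with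
      -- `L`.
      not-complement : ¬ (E Q ─ D′ ⊆ D)
      not-complement co⊆D = go (others (E M ─ L) 4≤∣E─L∣ y s′)
        where
        in-P′ : ∀ {c} → c ∈ E M ─ L → y ≢ c → s′ ≢ c → c ∈ P′
        in-P′ {c} c∈ y≢c s′≢c = case c ∈? P′ of λ where
          (yes c∈P′) → c∈P′
          (no c∉P′) → contradiction
            (co⊆D (∈-─⁺ (∈EQ (proj₁ (∈-─⁻ {p = E M} c∈)) (λ { refl → proj₂ (∈-─⁻ {p = E M} c∈) x∈L }))
              ([ c∉P′ , (λ c∈s → s′≢c (sym (x∈⁅y⁆⇒x≡y s′ c∈s))) ]′ ∘ x∈p∪q⁻ P′ ⁅ s′ ⁆)))
            ([ (λ c∈P → proj₂ (∈-─⁻ {p = E M} c∈) (proj₁ (∈--⁻ c∈P))) , (λ c∈y → y≢c (sym (x∈⁅y⁆⇒x≡y y c∈y))) ]′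
              ∘ x∈p∪q⁻ P ⁅ y ⁆)
        go : PairOff y s′ (E M ─ L) → Empty.⊥
        go (c , d , c≢d , c∈ , d∈ , y≢c , y≢d , s′≢c , s′≢d) = 1+n≰n {0} (estimate M
          (P′ ∷ L ∷ ⁅ x ⁆ ∷ ⁅ c ⁆ ∷ ⁅ d ⁆ ∷ [])
          (λ P L x c d → x ⊑ L ∷ c ⊑ P ∷ d ⊑ P ∷ []
            ∣ ϱ (P ⊔ x) ≼ # 2 ∷ ϱ L ≼ # 2 ∷ # 1 ≼ ϱ x ∷ # 4 ≼ ϱ ((c ⊔ d) ⊔ L) ∷ []
            by (P ⊔ x , L) ∷ [] ⊩ # 1 ≼ # 0)
          refl (∈! x∈L ∷ ∈! (in-P′ c∈ y≢c s′≢c) ∷ ∈! (in-P′ d∈ y≢d s′≢d) ∷ [])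
          (P′∪x ∷ ρL≤2 ∷ 0<ρ⁅⁆ x∈E ∷
            ≤-trans (+-monoˡ-≤ 2 (ML.1<ρ-pair c∈ d∈ c≢d)) (≤-reflexive (rk-/L (⁅ c ⁆ ∪ ⁅ d ⁆))) ∷ []))

      D′⊆D : D′ ⊆ D
      D′⊆D = [ (λ p → p) , (λ co⊆D → contradiction (λ {z} → co⊆D {z}) not-complement) ]′
        (thin-side D′⊆EQ 2≤∣D′∣ 2≤∣EQ─D′∣ sepD′)

      D⊆D′ : D ⊆ D′
      D⊆D′ = clutter D′⊆D

      shared : ∃ λ u → u ∈ P′ × u ∈ L
      shared = pick-of (member v∈L v≢x) (member w∈L w≢x)
        where
        member : ∀ {u} → u ∈ L → u ≢ x → u ∈ P′ ⊎ u ≡ s′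
        member {u} u∈L u≢x = [ inj₁ , inj₂ ∘ x∈⁅y⁆⇒x≡y s′ ]′ (x∈p∪q⁻ P′ ⁅ s′ ⁆
          (D⊆D′ (p⊆p∪q ⁅ y ⁆ (∈--⁺ u∈L u≢x))))
        pick-of : v ∈ P′ ⊎ v ≡ s′ → w ∈ P′ ⊎ w ≡ s′ → ∃ λ u → u ∈ P′ × u ∈ L
        pick-of (inj₁ v∈) _ = v , v∈ , v∈L
        pick-of (inj₂ _) (inj₁ w∈) = w , w∈ , w∈L
        pick-of (inj₂ p) (inj₂ q) = contradiction (trans p (sym q)) v≢w

      u : Fin n
      u = proj₁ shared
      u∈P′ : u ∈ P′
      u∈P′ = proj₁ (proj₂ shared)
      u∈L : u ∈ L
      u∈L = proj₂ (proj₂ shared)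
      u≢x : u ≢ x
      u≢x u≡x = x∉P′ (subst (_∈ P′) u≡x u∈P′)

      P′⊆P : P′ ⊆ P
      P′⊆P {e} e∈ = ∈-─⁺ (on-L {P′} P′∪x u∈P′ u∈L u≢x e∈ (P′⊆E e∈)) (proj₂ (∈-─⁻ (P′⊆EQ e∈)))

      P⊆P′ : P ⊆ P′
      P⊆P′ {e} e∈P = subst (e ∈_) (proj₂ (proj₁ (proj₁ spore′)))
        (Closure.∈-cl⁺ Q P′⊆EQ (P⊆EQ e∈P) (+-cancelʳ-≤ 1 _ _
          (≤-trans (≤-reflexive (rk-/x (P′ ∪ ⁅ e ⁆))) (≤-trans spanned (≤-reflexive (sym (rk-/x P′)))))))
        where
        spanned : ρ ((P′ ∪ ⁅ e ⁆) ∪ ⁅ x ⁆) ≤ ρ (P′ ∪ ⁅ x ⁆)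
        spanned = estimate M (P′ ∷ L ∷ ⁅ x ⁆ ∷ ⁅ e ⁆ ∷ ⁅ u ⁆ ∷ [])
          (λ P L x e u → x ⊑ L ∷ u ⊑ L ⊓ P ∷ e ⊑ L ∷ [] ∣ ϱ L ≼ # 2 ∷ # 2 ≼ ϱ (u ⊔ x) ∷ []
            by (P ⊔ x , L) ∷ [] ⊩ ϱ ((P ⊔ e) ⊔ x) ≼ ϱ (P ⊔ x))
          refl (∈! x∈L ∷ ∈! (x∈p∩q⁺ (u∈L , u∈P′)) ∷ ∈! (proj₁ (∈--⁻ e∈P)) ∷ [])
          (ρL≤2 ∷ 1<ρ-pair (L⊆E u∈L) x∈E u≢x ∷ [])

      y≡s′ : y ≡ s′
      y≡s′ = [ (λ y∈P′ → contradiction (proj₁ (∈--⁻ (P′⊆P y∈P′))) y∉L) , x∈⁅y⁆⇒x≡y s′ ]′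
        (x∈p∪q⁻ P′ ⁅ s′ ⁆ (D⊆D′ (q⊆p∪q P ⁅ y ⁆ (x∈⁅x⁆ y))))

    spore-unique : P′ ≡ P × s′ ≡ y
    spore-unique = ⊆-antisym P′⊆P P⊆P′ , sym y≡s′

  uniqueSpore : ThreeConnectedUpToUniqueSpore (M / ⁅ x ⁆) (L - x) y
  uniqueSpore = record { spore = spore ; unique = spore-unique ; separations = separations }

-- Listings of finite sets.

enumerate : (p : Subset n) → Fin ∣ p ∣ → Fin n
enumerate (true  ∷ p) zero    = zero
enumerate (true  ∷ p) (suc i) = suc (enumerate p i)
enumerate (false ∷ p) i       = suc (enumerate p i)

enumerate-∈ : (p : Subset n) (i : Fin ∣ p ∣) → enumerate p i ∈ p
enumerate-∈ (true  ∷ p) zero    = here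
enumerate-∈ (true  ∷ p) (suc i) = there (enumerate-∈ p i)
enumerate-∈ (false ∷ p) i       = there (enumerate-∈ p i)

enumerate-injective : (p : Subset n) → Injective _≡_ _≡_ (enumerate p)
enumerate-injective (true  ∷ p) {zero}  {zero}  eq = refl
enumerate-injective (true  ∷ p) {suc i} {suc j} eq = cong suc (enumerate-injective p (Finₚ.suc-injective eq))
enumerate-injective (false ∷ p) eq = enumerate-injective p (Finₚ.suc-injective eq)

enumerate-surjective : (p : Subset n) {e : Fin n} → e ∈ p → ∃ λ i → enumerate p i ≡ e
enumerate-surjective (true  ∷ p) here       = zero , refl
enumerate-surjective (true  ∷ p) (there e∈) = let i , eq = enumerate-surjective p e∈ in suc i , cong suc eq
enumerate-surjective (false ∷ p) (there e∈) = let i , eq = enumerate-surjective p e∈ in i , cong suc eq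

∈-range⁺ : (x : Fin t → Fin n) (i : Fin t) → x i ∈ range x
∈-range⁺ {suc t} x zero    = p⊆p∪q _ (x∈⁅x⁆ (x zero))
∈-range⁺ {suc t} x (suc i) = q⊆p∪q ⁅ x zero ⁆ _ (∈-range⁺ (x ∘ suc) i)

∈-range⁻ : (x : Fin t → Fin n) {e : Fin n} → e ∈ range x → ∃ λ i → x i ≡ e
∈-range⁻ {zero}  x e∈ = contradiction e∈ ∉⊥
∈-range⁻ {suc t} x e∈ = [ (λ e∈x → zero , sym (x∈⁅y⁆⇒x≡y (x zero) e∈x)) ,
  (λ e∈xs → let i , eq = ∈-range⁻ (x ∘ suc) e∈xs in suc i , eq) ]′
  (x∈p∪q⁻ ⁅ x zero ⁆ (range (x ∘ suc)) e∈)

range-enumerate : (p : Subset n) → range (enumerate p) ≡ p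
range-enumerate p = ⊆-antisym
  (λ e∈ → let i , eq = ∈-range⁻ (enumerate p) e∈ in subst (_∈ p) eq (enumerate-∈ p i))
  (λ e∈ → let i , eq = enumerate-surjective p e∈ in subst (_∈ range (enumerate p)) eq (∈-range⁺ (enumerate p) i))

∣triple∣ : {a b c : Fin n} → a ≢ b → a ≢ c → b ≢ c → ∣ ⁅ a ⁆ ∪ ⁅ b ⁆ ∪ ⁅ c ⁆ ∣ ≡ 3
∣triple∣ {a = a} {b} {c} a≢b a≢c b≢c = ≤-antisym
  (≤-∪ ⁅ a ⁆ _ 1 2 (one a) (≤-∪ ⁅ b ⁆ ⁅ c ⁆ 1 1 (one b) (one c)))
  (2<∣∣ a≢b a≢c b≢c (p⊆p∪q _ (x∈⁅x⁆ a)) (q⊆p∪q ⁅ a ⁆ _ (p⊆p∪q ⁅ c ⁆ (x∈⁅x⁆ b)))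
    (q⊆p∪q ⁅ a ⁆ _ (q⊆p∪q ⁅ b ⁆ ⁅ c ⁆ (x∈⁅x⁆ c))))
  where
  one : ∀ e → ∣ ⁅ e ⁆ ∣ ≤ 1
  one e = ≤-reflexive (∣⁅x⁆∣≡1 e)
  ≤-∪ : ∀ p q i j → ∣ p ∣ ≤ i → ∣ q ∣ ≤ j → ∣ p ∪ q ∣ ≤ i + j
  ≤-∪ p q i j p≤ q≤ = ≤-trans (ℕₚ.m≤m+n _ ∣ p ∩ q ∣)
    (≤-trans (≤-reflexive (∣∪∣+∣∩∣ p q)) (+-mono-≤ p≤ q≤))

injection-∣∣ : (f : Fin m → Fin n) (D : Subset m) {p : Subset n} → (∀ {i} → i ∈ D → f i ∈ p) →
               (∀ {i j} → i ∈ D → j ∈ D → f i ≡ f j → i ≡ j) → ∣ D ∣ ≤ ∣ p ∣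
injection-∣∣ {m} f D {p} into inj = subset-induction
  (λ D → ∀ p → (∀ {i} → i ∈ D → f i ∈ p) → (∀ {i j} → i ∈ D → j ∈ D → f i ≡ f j → i ≡ j) → ∣ D ∣ ≤ ∣ p ∣)
  (λ p _ _ → ≤-trans (≤-reflexive (∣⊥∣≡0 m)) z≤n)
  (λ D e e∈D ih p into inj → ≤-trans (∣p∣≤1+∣p-x∣ D e) (≤-trans
    (s≤s (ih (p - f e)
      (λ i∈ → ∈-─⁺ (into (proj₁ (∈--⁻ i∈)))
        (x≢y⇒x∉⁅y⁆ λ eq → proj₂ (∈--⁻ i∈) (inj e∈D (proj₁ (∈--⁻ i∈)) (sym eq))))
      (λ i∈ j∈ → inj (proj₁ (∈--⁻ i∈)) (proj₁ (∈--⁻ j∈)))))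
    (x∈p⇒∣p-x∣<∣p∣ (into e∈D))))
  D p into inj

module SegmentOf {n} (M : Matroid n) (M3 : ThreeConnected M) (4≤∣E∣ : 4 ≤ ∣ E M ∣)
  {L : Subset n} (L⊆E : L ⊆ E M) (ρL≤2 : rk M L ≤ 2)
  (flat : ∀ {e} → e ∈ E M → e ∉ L → 3 ≤ rk M (L ∪ ⁅ e ⁆)) where

  open Rank M
  open Simple M M3 4≤∣E∣

  independent-≤2 : ∀ {X} → X ⊆ E M → ∣ X ∣ ≤ 2 → Independent M X
  independent-≤2 {X} X⊆E X≤2 = X⊆E , trans (sym (ρ-⊆E X⊆E))
    (≤-antisym (≤-trans (rk-≤-∣∣ M X) (∣p∩q∣≤∣p∣ X (E M))) (lower (2 ℕ.≤? ∣ X ∣) (1 ℕ.≤? ∣ X ∣)))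
    where
    lower : Dec (2 ≤ ∣ X ∣) → Dec (1 ≤ ∣ X ∣) → ∣ X ∣ ≤ ρ X
    lower (yes 2≤) _ = go (1<∣∣⁻ X 2≤)
      where
      go : Pair X → ∣ X ∣ ≤ ρ X
      go (a , b , a≢b , a∈ , b∈) = ≤-trans X≤2 (1<ρ X (X⊆E a∈) (X⊆E b∈) a≢b a∈ b∈)
    lower (no 2≰) (yes 1≤) = go (0<∣∣⁻ X 1≤)
      where
      go : Nonempty X → ∣ X ∣ ≤ ρ X
      go (a , a∈) = ≤-trans (ℕ.s≤s⁻¹ (≰⇒> 2≰)) (≤-trans (0<ρ⁅⁆ (X⊆E a∈)) (ρ-mono (∈! a∈)))
    lower (no _) (no 1≰) = ≤-trans (ℕ.s≤s⁻¹ (≰⇒> 1≰)) z≤n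

  triangle : ∀ {T′} → T′ ⊆ L → ∣ T′ ∣ ≡ 3 → Triangle M T′
  triangle {T′} T⊆L ∣T∣ = ((L⊆E ∘ T⊆L , λ eq → 1+n≰n {2}
      (≤-trans (≤-reflexive (trans (sym ∣T∣) (trans (sym eq) (sym (ρ-⊆E (L⊆E ∘ T⊆L))))))
        (≤-trans (ρ-mono T⊆L) ρL≤2))) ,
    (λ X⊂T → independent-≤2 (L⊆E ∘ T⊆L ∘ proj₁ X⊂T) (ℕ.s≤s⁻¹ (≤-trans (p⊂q⇒∣p∣<∣q∣ X⊂T) (≤-reflexive ∣T∣))))) ,
    ∣T∣

  segment : ∀ {L′} → L′ ⊆ L → 3 ≤ ∣ L′ ∣ → Segment M L′
  segment L′⊆L 3≤ = L⊆E ∘ L′⊆L , 3≤ , λ T⊆ → triangle (L′⊆L ∘ T⊆)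

  cl-segment : ∀ {L′} → L′ ⊆ L → 2 ≤ ∣ L′ ∣ → cl M L′ ≡ L
  cl-segment {L′} L′⊆L 2≤ = go (1<∣∣⁻ L′ 2≤)
    where
    L′⊆E : L′ ⊆ E M
    L′⊆E = L⊆E ∘ L′⊆L
    go : Pair L′ → cl M L′ ≡ L
    go (a , b , a≢b , a∈ , b∈) = ⊆-antisym
      (λ {e} e∈ → let e∈E , le = Closure.∈-cl⁻ M L′⊆E e∈ in case e ∈? L of λ where
        (yes e∈L) → e∈L
        (no e∉L) → contradiction (≤-trans (flat e∈E e∉L) (widen le)) (ℕₚ.n≮n 2))
      (λ {e} e∈L → Closure.∈-cl⁺ M L′⊆E (L⊆E e∈L) (≤-trans (ρ-mono (∪-⊆ L′⊆L (∈! e∈L)))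
        (≤-trans ρL≤2 2≤ρ)))
      where
      2≤ρ : 2 ≤ ρ L′
      2≤ρ = 1<ρ L′ (L′⊆E a∈) (L′⊆E b∈) a≢b a∈ b∈
      widen : ∀ {e} → ρ (L′ ∪ ⁅ e ⁆) ≤ ρ L′ → ρ (L ∪ ⁅ e ⁆) ≤ 2
      widen {e} le = estimate M (L ∷ L′ ∷ ⁅ e ⁆ ∷ [])
        (λ L L′ e → L′ ⊑ L ∷ [] ∣ ϱ (L′ ⊔ e) ≼ ϱ L′ ∷ ϱ L ≼ # 2 ∷ [] by (L , L′ ⊔ e) ∷ [] ⊩ ϱ (L ⊔ e) ≼ # 2)
        refl (L′⊆L ∷ []) (le ∷ ρL≤2 ∷ [])

-- The four outcomes.

Outcome₁ Outcome₂ Outcome₃ Outcome₄ Outcomes : Matroid n → Matroid m → Subset n → Set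
Outcome₁ M N C* = ∃[ x ] x ∈ C* × Connected 3 (si (M / ⁅ x ⁆)) × si (M / ⁅ x ⁆) HasMinor N
Outcome₂ M N C* = ∃[ x₁ ] ∃[ x₂ ] ∃[ x₃ ] ∃[ x₄ ]
  Fan₄ M x₁ x₂ x₃ x₄ × x₁ ∈ C* × x₃ ∈ C* ×
  Connected 3 (si (M / ⁅ x₂ ⁆)) × si (M / ⁅ x₂ ⁆) HasMinor N
Outcome₃ {n} M N C* = Σ[ t ∈ ℕ ] Σ[ x ∈ (Fin t → Fin n) ] Σ[ y ∈ (Fin t → Fin n) ]
  SegmentCosegmentPair M x y × range x ⊆ C* ×
  (∃[ e ] cl M (range x) ─ range x ≡ ⁅ e ⁆ × e ∉ C* ×
     Connected 3 (si (M / ⁅ e ⁆)) × si (M / ⁅ e ⁆) HasMinor N) ×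
  Connected 3 (M / cl M (range x)) × (M / cl M (range x)) HasMinor N ×
  (∀ i → ThreeConnectedUpToUniqueSpore (M / ⁅ x i ⁆) (cl M (range x) - x i) (y i))
Outcome₄ {n} M N C* = Σ[ t ∈ ℕ ] Σ[ x ∈ (Fin t → Fin n) ] Σ[ y ∈ (Fin t → Fin n) ]
  SegmentCosegmentPair M x y × Flat M (range x) × ∣ range x ─ C* ∣ ≤ 1 ×
  Connected 3 (M / range x) × (M / range x) HasMinor N ×
  (∀ i → ThreeConnectedUpToUniqueSpore (M / ⁅ x i ⁆) (range x - x i) (y i))
Outcomes M N C* = Outcome₁ M N C* ⊎ Outcome₂ M N C* ⊎ Outcome₃ M N C* ⊎ Outcome₄ M N C*

module Conclusion {n m} (M : Matroid n) (M3 : ThreeConnected M) (4≤∣E∣ : 4 ≤ ∣ E M ∣)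
  (N : Matroid m) (N3 : ThreeConnected N) (4≤∣EN∣ : 4 ≤ ∣ E N ∣)
  (C* : Subset n) (hyp : HyperplaneComplement M C*) (line : CocircuitLine M N C*) where

  open Rank M
  open Simple M M3 4≤∣E∣
  open CocircuitLine line
  open SegmentOf M M3 4≤∣E∣ L⊆E ρL≤2 flat
  open Pencil M M3 4≤∣E∣ L⊆E ρL≤2 flat
  private
    module C* = HyperplaneComplement hyp
    module Emb = Embedding embedding

  4≤∣E─L∣ : 4 ≤ ∣ E M ─ L ∣
  4≤∣E─L∣ = ≤-trans 4≤∣EN∣ (injection-∣∣ Emb.f (E N)
    (λ i∈ → ∈-─⁺ (Emb.f∈E i∈) (Emb.f∉C i∈ ∘ L⊆C)) Emb.f-inj)

  Good : Fin n → Set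
  Good w = Connected 3 (si (M / ⁅ w ⁆))

  good? : ∀ w → Dec (Good w)
  good? w = [ yes , (λ { (k , X , 1≤k , k<3 , s) → no λ conn → conn 1≤k k<3 s }) ]′ (connected₃? (si (M / ⁅ w ⁆)))

  minor-at : ∀ {w} → w ∈ L → si (M / ⁅ w ⁆) HasMinor N
  minor-at w∈L = Contraction.minor-of-si M M3 4≤∣E∣ (L⊆E w∈L) N3 4≤∣EN∣ embedding (L⊆C w∈L)

  minor-/L : (M / L) HasMinor N
  minor-/L = embedding⇒hasMinor (lower-/ embedding L⊆C)

  -- Two points of `L` off `C*` would span `L`, and with it `x` in `C*`, from within the hyperplane
  -- complementary to `C*`.
  at-most-one-outside : ∣ L ─ C* ∣ ≤ 1
  at-most-one-outside = ≮⇒≥ λ 2≤ → go (1<∣∣⁻ (L ─ C*) 2≤)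
    where
    go : ¬ Pair (L ─ C*)
    go (a , b , a≢b , a∈ , b∈) = 1+n≰n {0} (estimate M (C* ∷ L ∷ ⁅ x ⁆ ∷ ⁅ a ⁆ ∷ ⁅ b ⁆ ∷ [])
      (λ C L x a b → a ⊑ L ∖ C ∷ b ⊑ L ∖ C ∷ x ⊑ L ∷ []
        ∣ # 1 ⊕ ϱ (~ C) ≼ ϱ ● ∷ ϱ ● ≼ ϱ (~ C ⊔ x) ∷ ϱ L ≼ # 2 ∷ # 2 ≼ ϱ (a ⊔ b) ∷ []
        by (~ C , L) ∷ [] ⊩ # 1 ≼ # 0)
      refl (∈! a∈ ∷ ∈! b∈ ∷ ∈! x∈L ∷ [])
      (C*.nonspanning ∷ C*.spanning⁺ x∈C* ∷ ρL≤2 ∷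
       1<ρ-pair (L⊆E (proj₁ (∈-─⁻ {p = L} a∈))) (L⊆E (proj₁ (∈-─⁻ {p = L} b∈))) a≢b ∷ []))

  bad⇒vertical : ∀ {w} → w ∈ L → ¬ Good w → ∃ λ X → Vertical M w X
  bad⇒vertical w∈L bad = [ (λ good → contradiction (λ {k} {X} → good {k} {X}) bad) , id ]′
    (Contraction.connected-or-vertical M M3 4≤∣E∣ (L⊆E w∈L))

  -- `L′` stands for `L` itself in outcome (iv) and for `L - e` in outcome (iii). In both cases its
  -- closure is `L`, so the cocircuits and spores are those of `L`.
  module BadSegment (L′ : Subset n) (L′⊆L : L′ ⊆ L) (3≤∣L′∣ : 3 ≤ ∣ L′ ∣) (x∈L′ : x ∈ L′)
    (bad : ∀ {w} → w ∈ L′ → ¬ Good w) where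

    private
      module X = Point x∈L z∈E z∉L cocircuit

    -- `x` has its cocircuit from the start. For any other point, `TwoPoints` asks for a second bad
    -- point different from `x`, which `3 ≤ ∣ L′ ∣` provides.
    attached : ∀ {w} → w ∈ L′ → Cocircuit-at w
    attached {w} w∈L′ = choose (w ≟ᶠ x)
      where
      pair : ∀ {w′} → w′ ∈ L′ → w ≢ x → w′ ≢ x → w ≢ w′ → Cocircuit-at w
      pair {w′} w′∈L′ w≢x w′≢x w≢w′ = X.TwoPoints.cocircuit-at (L′⊆L w∈L′) (L′⊆L w′∈L′) w≢x w′≢x w≢w′
        (proj₂ (sep w∈L′ w≢x)) (proj₂ (sep w′∈L′ w′≢x))
        where
        sep : ∀ {v} → v ∈ L′ → v ≢ x → ∃ (X.Separated v)
        sep v∈ v≢x = X.separate (L′⊆L v∈) v≢x (bad⇒vertical (L′⊆L v∈) (bad v∈))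
      partner : w ≢ x → PairBesides x L′ → Cocircuit-at w
      partner w≢x (b , c , x≢b , x≢c , b≢c , b∈ , c∈) = decide (w ≟ᶠ b)
        where
        decide : Dec (w ≡ b) → Cocircuit-at w
        decide (yes w≡b) = pair c∈ w≢x (x≢c ∘ sym) (λ w≡c → b≢c (trans (sym w≡b) w≡c))
        decide (no w≢b)  = pair b∈ w≢x (x≢b ∘ sym) w≢b
      choose : Dec (w ≡ x) → Cocircuit-at w
      choose (yes w≡x) = subst Cocircuit-at (sym w≡x) (z , z∈E , z∉L , cocircuit)
      choose (no w≢x)  = partner w≢x (2<∣∣⁻ L′ 3≤∣L′∣ x x∈L′)

    contraction : ThreeConnected (M / L)
    contraction = go (2<∣∣⁻ L′ 3≤∣L′∣ x x∈L′)
      where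
      go : PairBesides x L′ → ThreeConnected (M / L)
      go (b , c , x≢b , x≢c , b≢c , b∈ , c∈) = ThreePoints.Triple.contraction-3-connected M M3 4≤∣E∣ L⊆E ρL≤2 flat
        x∈L (L′⊆L b∈) (L′⊆L c∈) x≢b x≢c b≢c (attached x∈L′) (attached b∈) (attached c∈)

    attached-spore : ∀ {w} (w∈ : w ∈ L′) → ThreeConnectedUpToUniqueSpore (M / ⁅ w ⁆) (L - w) (proj₁ (attached w∈))
    attached-spore {w} w∈ = go (2<∣∣⁻ L′ 3≤∣L′∣ w w∈)
      where
      go : PairBesides w L′ →
           ThreeConnectedUpToUniqueSpore (M / ⁅ w ⁆) (L - w) (proj₁ (attached w∈))
      go (b , c , w≢b , w≢c , b≢c , b∈ , c∈) = SporeOf.uniqueSpore M M3 4≤∣E∣ L⊆E ρL≤2 flat contraction 4≤∣E─L∣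
        (L′⊆L w∈) (L′⊆L b∈) (L′⊆L c∈) (w≢b ∘ sym) (w≢c ∘ sym) b≢c
        (proj₁ (proj₂ (attached w∈))) (proj₁ (proj₂ (proj₂ (attached w∈)))) (proj₂ (proj₂ (proj₂ (attached w∈))))

    -- Two of the cocircuits sharing the element off L would make L ∪ {y} 2-separating.

    attached-distinct : ∀ {v w} (v∈ : v ∈ L′) (w∈ : w ∈ L′) → proj₁ (attached v∈) ≡ proj₁ (attached w∈) → v ≡ w
    attached-distinct {v} {w} v∈ w∈ eq = decide (v ≟ᶠ w)
      where
      open Verticals M M3 4≤∣E∣
      decide : Dec (v ≡ w) → v ≡ w
      go : v ≢ w → ∀ y → y ∈ E M → y ∉ L → HyperplaneComplement M ((L - v) ∪ ⁅ y ⁆) →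
           HyperplaneComplement M ((L - w) ∪ ⁅ y ⁆) → 1 ≤ 0
      decide (yes v≡w) = v≡w
      decide (no v≢w) = contradiction (go v≢w (proj₁ (attached w∈)) (proj₁ (proj₂ (attached w∈)))
        (proj₁ (proj₂ (proj₂ (attached w∈))))
        (subst (λ y → HyperplaneComplement M ((L - v) ∪ ⁅ y ⁆)) eq (proj₂ (proj₂ (proj₂ (attached v∈)))))
        (proj₂ (proj₂ (proj₂ (attached w∈))))) λ ()
      go v≢w y y∈E y∉L hv hw = estimate M (L ∷ ⁅ v ⁆ ∷ ⁅ w ⁆ ∷ ⁅ y ⁆ ∷ [])
        (λ L v w y → v ⊑ L ∷ w ⊑ L ∷ y ⊑ ~ L ∷ v ⊑ ~ w ∷ []
          ∣ ϱ L ≼ # 2 ∷ ϱ y ≼ # 1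
          ∷ # 1 ⊕ ϱ (~ ((L ∖ v) ⊔ y)) ≼ ϱ ● ∷ # 1 ⊕ ϱ (~ ((L ∖ w) ⊔ y)) ≼ ϱ ●
          ∷ ϱ ● ≼ ϱ (~ ((L ∖ v) ⊔ y) ⊔ w)
          ∷ ϱ ● ⊕ # 2 ≼ ϱ (L ⊔ y) ⊕ ϱ (~ (L ⊔ y)) ∷ []
          by (L , y) ∷ (~ ((L ∖ v) ⊔ y) , ~ ((L ∖ w) ⊔ y)) ∷ [] ⊩ # 1 ≼ # 0)
        refl (∈! (L′⊆L v∈) ∷ ∈! (L′⊆L w∈) ∷ ∉! y∉L ∷ ≢! v≢w ∷ [])
        (ρL≤2 ∷ ρ-⁅⁆ y ∷ HyperplaneComplement.nonspanning hv ∷ HyperplaneComplement.nonspanning hw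
         ∷ HyperplaneComplement.spanning⁺ hv (p⊆p∪q ⁅ y ⁆ (∈--⁺ (L′⊆L w∈) (v≢w ∘ sym)))
         ∷ conn-two (L ∪ ⁅ y ⁆) (two (others (E M ─ L) 4≤∣E─L∣ y y))
             (≤-trans (1<ρ L (L⊆E (L′⊆L v∈)) (L⊆E (L′⊆L w∈)) v≢w (L′⊆L v∈) (L′⊆L w∈)) (ρ-mono (p⊆p∪q ⁅ y ⁆))) ∷ [])
        where
        two : PairOff y y (E M ─ L) → Two (∁ (L ∪ ⁅ y ⁆))
        two (c , d , c≢d , c∈ , d∈ , y≢c , y≢d , _) = c , d , c≢d ,
          (off c∈ y≢c , proj₁ (∈-─⁻ {p = E M} c∈)) , (off d∈ y≢d , proj₁ (∈-─⁻ {p = E M} d∈))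
          where
          off : ∀ {e} → e ∈ E M ─ L → y ≢ e → e ∈ ∁ (L ∪ ⁅ y ⁆)
          off e∈ y≢e = x∉p⇒x∈∁p ([ proj₂ (∈-─⁻ {p = E M} e∈) , (λ e∈y → y≢e (sym (x∈⁅y⁆⇒x≡y y e∈y))) ]′ ∘ x∈p∪q⁻ L ⁅ y ⁆)

    xs ys : Fin ∣ L′ ∣ → Fin n
    xs = enumerate L′
    ys i = proj₁ (attached (enumerate-∈ L′ i))

    range≡ : range xs ≡ L′
    range≡ = range-enumerate L′

    cl≡ : cl M (range xs) ≡ L
    cl≡ = trans (cong (cl M) range≡) (cl-segment L′⊆L (≤-trans (ℕₚ.n≤1+n 2) 3≤∣L′∣))

    pair : SegmentCosegmentPair M xs ys
    pair = record
      { x-injective = enumerate-injective L′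
      ; y-injective = λ {i} {j} eq → enumerate-injective L′ (attached-distinct (enumerate-∈ L′ i) (enumerate-∈ L′ j) eq)
      ; segment = subst (Segment M) (sym range≡) (segment L′⊆L 3≤∣L′∣)
      ; disjoint = λ { (e , e∈) → let e∈x , e∈y = x∈p∩q⁻ (range xs) (range ys) e∈ ; i , yi≡e = ∈-range⁻ ys e∈y in
          proj₁ (proj₂ (proj₂ (attached (enumerate-∈ L′ i))))
            (subst (_∈ L) (sym yi≡e) (L′⊆L (subst (e ∈_) range≡ e∈x))) }
      ; cocircuit = λ i → subst (λ K → Cocircuit M ((K - xs i) ∪ ⁅ ys i ⁆)) (sym cl≡)
          (Cocircuits.hyperplane⇒cocircuit M (proj₂ (proj₂ (proj₂ (attached (enumerate-∈ L′ i)))))) }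

    spores : ∀ i → ThreeConnectedUpToUniqueSpore (M / ⁅ xs i ⁆) (L - xs i) (ys i)
    spores i = attached-spore (enumerate-∈ L′ i)

  -- A line of exactly three points is a triangle, and the cocircuit `(L - x) ∪ ⁅ z ⁆` then has
  -- three elements and is the triad of the fan.
  fan : ∀ {e y} → e ∈ L → y ∈ L → x ≢ e → x ≢ y → e ≢ y → L ⊆ ⁅ x ⁆ ∪ (⁅ e ⁆ ∪ ⁅ y ⁆) → Fan₄ M x e y z
  fan {e} {y} e∈L y∈L x≢e x≢y e≢y L⊆ =
    ((x≢e ∷ x≢y ∷ ≢z x∈L ∷ []) ∷ (e≢y ∷ ≢z e∈L ∷ []) ∷ (≢z y∈L ∷ []) ∷ [] ∷ []) ,
    triangle (∪-⊆ (∈! x∈L) (∪-⊆ (∈! e∈L) (∈! y∈L))) (∣triple∣ x≢e x≢y e≢y) ,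
    (subst (Cocircuit M) triad≡ (Cocircuits.hyperplane⇒cocircuit M cocircuit) , ∣triple∣ e≢y (≢z e∈L) (≢z y∈L))
    where
    ≢z : ∀ {w} → w ∈ L → w ≢ z
    ≢z w∈L refl = z∉L w∈L
    triad≡ : (L - x) ∪ ⁅ z ⁆ ≡ ⁅ e ⁆ ∪ ⁅ y ⁆ ∪ ⁅ z ⁆
    triad≡ = ⊆-antisym
      (sets (L ∷ ⁅ x ⁆ ∷ ⁅ e ⁆ ∷ ⁅ y ⁆ ∷ ⁅ z ⁆ ∷ [])
        (λ L x e y z → L ⊑ x ⊔ (e ⊔ y) ∷ [] ⊢ (L ∖ x) ⊔ z ⊑ e ⊔ y ⊔ z) refl (L⊆ ∷ []))
      (sets (L ∷ ⁅ x ⁆ ∷ ⁅ e ⁆ ∷ ⁅ y ⁆ ∷ ⁅ z ⁆ ∷ [])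
        (λ L x e y z → e ⊑ L ∷ y ⊑ L ∷ x ⊑ ~ e ∷ x ⊑ ~ y ∷ [] ⊢ e ⊔ y ⊔ z ⊑ (L ∖ x) ⊔ z)
        refl (∈! e∈L ∷ ∈! y∈L ∷ ≢! x≢e ∷ ≢! x≢y ∷ []))

  module _ (bad* : ∀ {w} → w ∈ L → w ∈ C* → ¬ Good w) where

    all-bad : (∀ {w} → w ∈ L → ¬ Good w) → Outcomes M N C*
    all-bad bad = inj₂ (inj₂ (inj₂ (∣ L ∣ , xs , ys , pair ,
        (subst (_⊆ E M) (sym range≡) L⊆E , trans cl≡ (sym range≡)) ,
        subst (λ K → ∣ K ─ C* ∣ ≤ 1) (sym range≡) at-most-one-outside ,
        subst (λ K → Connected 3 (M / K)) (sym range≡) (toConnected (M / L) contraction) ,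
        subst (λ K → (M / K) HasMinor N) (sym range≡) minor-/L ,
        λ i → subst (λ K → ThreeConnectedUpToUniqueSpore (M / ⁅ xs i ⁆) (K - xs i) (ys i)) (sym range≡) (spores i))))
      where open BadSegment L id 3≤∣L∣ x∈L bad

    module OneGood {e} (e∈L : e ∈ L) (good : Good e) where

      e∉C* : e ∉ C*
      e∉C* e∈C* = bad* e∈L e∈C* (λ {k} {X} → good {k} {X})

      rest⊆C* : L - e ⊆ C*
      rest⊆C* {w} w∈ = case w ∈? C* of λ where
        (yes w∈C*) → w∈C*
        (no w∉C*) → contradiction (1<∣∣ (proj₂ (∈--⁻ w∈)) (∈-─⁺ e∈L e∉C*)
          (∈-─⁺ (proj₁ (∈--⁻ w∈)) w∉C*)) (ℕₚ.≤⇒≯ at-most-one-outside)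

      e≢x : e ≢ x
      e≢x refl = e∉C* x∈C*

      x∈L-e : x ∈ L - e
      x∈L-e = ∈--⁺ x∈L (e≢x ∘ sym)

      long : 3 ≤ ∣ L - e ∣ → Outcomes M N C*
      long 3≤ = inj₂ (inj₂ (inj₁ (∣ L - e ∣ , xs , ys , pair ,
          subst (_⊆ C*) (sym range≡) rest⊆C* ,
          (e , trans (cong₂ _─_ cl≡ range≡) L─[L-e]≡ , e∉C* , (λ {k} {X} → good {k} {X}) , minor-at e∈L) ,
          subst (λ K → Connected 3 (M / K)) (sym cl≡) (toConnected (M / L) contraction) ,
          subst (λ K → (M / K) HasMinor N) (sym cl≡) minor-/L ,
          λ i → subst (λ K → ThreeConnectedUpToUniqueSpore (M / ⁅ xs i ⁆) (K - xs i) (ys i)) (sym cl≡) (spores i))))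
        where
        open BadSegment (L - e) (p─q⊆p L ⁅ e ⁆) 3≤ x∈L-e (λ w∈ → bad* (proj₁ (∈--⁻ w∈)) (rest⊆C* w∈))
        L─[L-e]≡ : L ─ (L - e) ≡ ⁅ e ⁆
        L─[L-e]≡ = ⊆-antisym
          (sets (L ∷ ⁅ e ⁆ ∷ []) (λ L e → [] ⊢ L ∖ (L ∖ e) ⊑ e) refl [])
          (sets (L ∷ ⁅ e ⁆ ∷ []) (λ L e → e ⊑ L ∷ [] ⊢ e ⊑ L ∖ (L ∖ e)) refl (∈! e∈L ∷ []))

      short : ¬ 3 ≤ ∣ L - e ∣ → Outcomes M N C*
      short 3≰ = go (1<∣∣⁻ (L - e) (ℕ.s≤s⁻¹ (≤-trans 3≤∣L∣ (∣p∣≤1+∣p-x∣ L e))))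
        where
        build : ∀ {y} → y ∈ L - e → x ≢ y → Outcomes M N C*
        build {y} y∈ x≢y = inj₂ (inj₁ (x , e , y , z , fan e∈L (proj₁ (∈--⁻ y∈)) (e≢x ∘ sym) x≢y (proj₂ (∈--⁻ y∈)) cover ,
            x∈C* , rest⊆C* y∈ , (λ {k} {X} → good {k} {X}) , minor-at e∈L))
          where
          cover : L ⊆ ⁅ x ⁆ ∪ (⁅ e ⁆ ∪ ⁅ y ⁆)
          cover {w} w∈ = decide (w ≟ᶠ x) (w ≟ᶠ e) (w ≟ᶠ y)
            where
            decide : Dec (w ≡ x) → Dec (w ≡ e) → Dec (w ≡ y) → w ∈ ⁅ x ⁆ ∪ (⁅ e ⁆ ∪ ⁅ y ⁆)
            decide (yes refl) _ _ = p⊆p∪q _ (x∈⁅x⁆ w)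
            decide (no _) (yes refl) _ = q⊆p∪q ⁅ x ⁆ _ (p⊆p∪q ⁅ y ⁆ (x∈⁅x⁆ w))
            decide (no _) (no _) (yes refl) = q⊆p∪q ⁅ x ⁆ _ (q⊆p∪q ⁅ e ⁆ _ (x∈⁅x⁆ w))
            decide (no w≢x) (no w≢e) (no w≢y) = contradiction
              (2<∣∣ x≢y (w≢x ∘ sym) (w≢y ∘ sym) x∈L-e y∈ (∈--⁺ w∈ w≢e)) 3≰
        go : Pair (L - e) → Outcomes M N C*
        go (a , b , a≢b , a∈ , b∈) = decide (x ≟ᶠ a)
          where
          decide : Dec (x ≡ a) → Outcomes M N C*
          decide (yes x≡a) = build b∈ (λ x≡b → a≢b (trans (sym x≡a) x≡b))
          decide (no x≢a)  = build a∈ x≢a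

    some-good-or-none : Outcomes M N C*
    some-good-or-none = decide (Finₚ.any? λ w → (w ∈? L) ×-dec good? w)
      where
      decide : Dec (∃ λ w → w ∈ L × Good w) → Outcomes M N C*
      decide (no none) = all-bad λ {w} w∈ good → none (w , w∈ , λ {k} {X} → good {k} {X})
      decide (yes (e , e∈L , good)) = length? (3 ℕ.≤? ∣ L - e ∣)
        where
        length? : Dec (3 ≤ ∣ L - e ∣) → Outcomes M N C*
        length? (yes 3≤) = OneGood.long e∈L (λ {k} {X} → good {k} {X}) 3≤
        length? (no 3≰)  = OneGood.short e∈L (λ {k} {X} → good {k} {X}) 3≰

  outcomes : Outcomes M N C*
  outcomes = decide (Finₚ.any? λ w → (w ∈? L ∩ C*) ×-dec good? w)
    where
    decide : Dec (∃ λ w → w ∈ L ∩ C* × Good w) → Outcomes M N C*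
    decide (yes (w , w∈ , good)) =
      inj₁ (w , p∩q⊆q L C* w∈ , (λ {k} {X} → good {k} {X}) , minor-at (p∩q⊆p L C* w∈))
    decide (no none) = some-good-or-none λ {w} w∈L w∈C* good → none (w , x∈p∩q⁺ (w∈L , w∈C*) , λ {k} {X} → good {k} {X})

theorem1p2 : ∀ {m n : ℕ} (M : Matroid n) (N : Matroid m) →
    Connected 3 M → Connected 3 N → 4 ≤ ∣ E N ∣ →
    (C* : Subset n) → Cocircuit M C* →
    (∃[ x₀ ] x₀ ∈ C* × (M / ⁅ x₀ ⁆) HasMinor N) →
      (∃[ x ] x ∈ C* × Connected 3 (si (M / ⁅ x ⁆)) × si (M / ⁅ x ⁆) HasMinor N)
    ⊎ (∃[ x₁ ] ∃[ x₂ ] ∃[ x₃ ] ∃[ x₄ ]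
         Fan₄ M x₁ x₂ x₃ x₄ × x₁ ∈ C* × x₃ ∈ C* ×
         Connected 3 (si (M / ⁅ x₂ ⁆)) × si (M / ⁅ x₂ ⁆) HasMinor N)
    ⊎ (Σ[ t ∈ ℕ ] Σ[ x ∈ (Fin t → Fin n) ] Σ[ y ∈ (Fin t → Fin n) ]
         SegmentCosegmentPair M x y × range x ⊆ C* ×
         (∃[ e ] cl M (range x) ─ range x ≡ ⁅ e ⁆ × e ∉ C* ×
            Connected 3 (si (M / ⁅ e ⁆)) × si (M / ⁅ e ⁆) HasMinor N) ×
         Connected 3 (M / cl M (range x)) × (M / cl M (range x)) HasMinor N ×
         (∀ i → ThreeConnectedUpToUniqueSpore (M / ⁅ x i ⁆)
                  (cl M (range x) - x i) (y i)))
    ⊎ (Σ[ t ∈ ℕ ] Σ[ x ∈ (Fin t → Fin n) ] Σ[ y ∈ (Fin t → Fin n) ]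
         SegmentCosegmentPair M x y × Flat M (range x) × ∣ range x ─ C* ∣ ≤ 1 ×
         Connected 3 (M / range x) × (M / range x) HasMinor N ×
         (∀ i → ThreeConnectedUpToUniqueSpore (M / ⁅ x i ⁆)
                  (range x - x i) (y i)))
theorem1p2 {m} {n} M N M-conn N-conn 4≤∣EN∣ C* cocircuit* (x₀ , x₀∈C* , minor) =
  [ (λ { (x , x∈C* , conn , e , x∈C) → inj₁ (x , x∈C* , (λ {k} {X} → conn {k} {X}) ,
      Contraction.minor-of-si M M3 4≤∣EM∣ (C*⊆E x∈C*) N3 4≤∣EN∣ e x∈C) }) ,
    Conclusion.outcomes M M3 4≤∣EM∣ N N3 4≤∣EN∣ C* hyp ]′
  (FindLine.find M M3 4≤∣EM∣ N N3 4≤∣EN∣ C* hyp x₀∈C* (proj₁ embedding₀) (proj₂ embedding₀ (x∈⁅x⁆ x₀)))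
  where
  M3 : ThreeConnected M
  M3 = fromConnected M M-conn
  N3 : ThreeConnected N
  N3 = fromConnected N N-conn
  hyp : HyperplaneComplement M C*
  hyp = Cocircuits.cocircuit⇒hyperplane M cocircuit*
  C*⊆E : C* ⊆ E M
  C*⊆E = HyperplaneComplement.D⊆E hyp
  embedding₀ : Σ[ e ∈ Embedding M N ] ⁅ x₀ ⁆ ⊆ Embedding.C e
  embedding₀ = lift-/ (∈! (C*⊆E x₀∈C*)) (hasMinor⇒embedding x₀ minor)
  4≤∣EM∣ : 4 ≤ ∣ E M ∣
  4≤∣EM∣ = ≤-trans 4≤∣EN∣ (injection-∣∣ (Embedding.f (proj₁ embedding₀)) (E N)
    (Embedding.f∈E (proj₁ embedding₀)) (Embedding.f-inj (proj₁ embedding₀)))
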